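{- There exists an absolute constant $C>0$ such that the following holds. For positive integers $n$ and $k$ with $k\mid n$, let $\mathrm{Comb}_{n,k}$ denote the $n$-vertex tree consisting of a path $P$ on $n/k$ vertices together with $n/k$ pairwise vertex-disjoint paths on $k$ vertices each, one beginning at each vertex of $P$ (each such $k$-vertex path has one endpoint equal to a vertex of $P$ and is otherwise disjoint from $P$). Then for every choice of $k=k(n)$ with $k\mid n$, the random graph $\mathcal{G}(n,C\frac{\log n}{n})$ contains a copy of $\mathrm{Comb}_{n,k}$ with probability tending to $1$ as $n\to\infty$.
   Context: $\mathcal{G}(n,p)$ denotes the binomial random graph on vertex set $[n]=\{1,\dots,n\}$ in which each of the $\binom n2$ possible edges is present independently with probability $p$. $\log$ denotes the natural logarithm. -}

module Defs where

open import Data.Bool.Base using (if_then_else_)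
open import Data.Fin.Base as Fin using (Fin; toℕ; combine; remQuot; finToFun; funToFin)
import Data.Fin.Properties as Fin
open import Data.Fin.Subset using (Subset; inside; outside; _∈_)
open import Data.Fin.Subset.Properties using (_∈?_)
open import Data.Integer.Base as ℤ using (+_; -[1+_])
import Data.Integer.Properties as ℤ
open import Data.List.Base as List using (List; allFin; cartesianProduct; filter; length)
open import Data.List.Membership.Propositional.Properties using (∈-lookup; ∈-filter⁻)
open import Data.Nat.Base as ℕ using (ℕ; zero; suc; pred; NonZero; z≤n; s≤s)
open import Data.Nat.Divisibility using (_∣_; quotient)
import Data.Nat.Properties as ℕ
open import Data.Product.Base using (∃; ∃-syntax; _×_; _,_; proj₂; map₂)
open import Data.Product.Properties using (≡-dec)
open import Data.Rational.Base as ℚ using (ℚ; mkℚ; 0ℚ; 1ℚ; ½)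
import Data.Rational.Properties as ℚ
open import Data.Rational.Solver using (module +-*-Solver)
open import Data.Rational.Unnormalised.Base as ℚᵘ using (mkℚᵘ)
import Data.Rational.Unnormalised.Properties as ℚᵘ
open import Data.Sum.Base as Sum using (_⊎_; inj₁; inj₂)
open import Data.Vec.Base using ([]; _∷_)
open import Function.Base using (_∘_)
open import Function.Definitions using (Injective)
open import Level using (0ℓ)
open import Relation.Binary.Core using (Rel)
open import Relation.Binary.Definitions as B using (Symmetric)
open import Relation.Binary.PropositionalEquality
open import Relation.Nullary.Decidable using (Dec; map′; does; _×-dec_; _⊎-dec_; _→-dec_)
open import Relation.Nullary.Negation using (¬_)
open import Relation.Unary using (Pred; Decidable)

-- Cauchy reals with an explicit modulus, so that no choice principle is needed.
-- Different sequences may represent the same real number; _<_ depends only on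
-- the numbers represented.
record ℝ : Set where
  field
    approx : ℕ → ℚ
    cauchy : ∀ {ε} → 0ℚ ℚ.< ε → ∃[ N ] (∀ {m n} → N ℕ.≤ m → N ℕ.≤ n →
               ℚ.∣ approx m ℚ.- approx n ∣ ℚ.≤ ε)

open ℝ public

private
  half-pos : ∀ {ε} → 0ℚ ℚ.< ε → 0ℚ ℚ.< ½ ℚ.* ε
  half-pos {ε} ε>0 = subst (ℚ._< ½ ℚ.* ε) (ℚ.*-zeroʳ ½) (ℚ.*-monoʳ-<-pos ½ ε>0)

  halves : ∀ ε → ½ ℚ.* ε ℚ.+ ½ ℚ.* ε ≡ ε
  halves ε = trans (sym (ℚ.*-distribʳ-+ ε ½ ½)) (ℚ.*-identityˡ ε)

  scale : ∀ {B ε} → 0ℚ ℚ.< B → 0ℚ ℚ.< ε → ∃[ δ ] 0ℚ ℚ.< δ × B ℚ.* δ ≡ ε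
  scale {B} {ε} B>0 ε>0 = δ , δ>0 , eq
    where
    instance
      B⁺ : ℚ.Positive B
      B⁺ = ℚ.positive B>0
      B≢0 : ℚ.NonZero B
      B≢0 = ℚ.pos⇒nonZero B
      B⁻¹⁺ : ℚ.Positive (ℚ.1/ B)
      B⁻¹⁺ = ℚ.1/pos⇒pos B
    δ : ℚ
    δ = ℚ.1/ B ℚ.* ε
    δ>0 : 0ℚ ℚ.< δ
    δ>0 = subst (ℚ._< δ) (ℚ.*-zeroʳ (ℚ.1/ B)) (ℚ.*-monoʳ-<-pos (ℚ.1/ B) ε>0)
    eq : B ℚ.* δ ≡ ε
    eq = trans (sym (ℚ.*-assoc B (ℚ.1/ B) ε))
           (trans (cong (ℚ._* ε) (ℚ.*-inverseʳ B)) (ℚ.*-identityˡ ε))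

  *-mono-nonNeg : ∀ {a b c d} → 0ℚ ℚ.≤ c → 0ℚ ℚ.≤ b → a ℚ.≤ b → c ℚ.≤ d → a ℚ.* c ℚ.≤ b ℚ.* d
  *-mono-nonNeg {a} {b} {c} {d} 0≤c 0≤b a≤b c≤d =
    ℚ.≤-trans (ℚ.*-monoʳ-≤-nonNeg c {{ℚ.nonNegative 0≤c}} a≤b)
              (ℚ.*-monoˡ-≤-nonNeg b {{ℚ.nonNegative 0≤b}} c≤d)

  tail-bound : (x : ℝ) → ∃[ B ] 0ℚ ℚ.< B × ∃[ N ] (∀ {m} → N ℕ.≤ m → ℚ.∣ approx x m ∣ ℚ.≤ B)
  tail-bound x with cauchy x (ℚ.positive⁻¹ 1ℚ)
  ... | N , close = 1ℚ ℚ.+ ℚ.∣ approx x N ∣ , B>0 , N , bound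
    where
    B>0 : 0ℚ ℚ.< 1ℚ ℚ.+ ℚ.∣ approx x N ∣
    B>0 = ℚ.+-mono-<-≤ {0ℚ} {1ℚ} {0ℚ} (ℚ.positive⁻¹ 1ℚ) (ℚ.0≤∣p∣ (approx x N))
    bound : ∀ {m} → N ℕ.≤ m → ℚ.∣ approx x m ∣ ℚ.≤ 1ℚ ℚ.+ ℚ.∣ approx x N ∣
    bound {m} N≤m = begin
      ℚ.∣ a ∣                       ≡⟨ cong ℚ.∣_∣ (solve 2 (λ a b → a := a :- b :+ b) refl a b) ⟩
      ℚ.∣ a ℚ.- b ℚ.+ b ∣           ≤⟨ ℚ.∣p+q∣≤∣p∣+∣q∣ (a ℚ.- b) b ⟩
      ℚ.∣ a ℚ.- b ∣ ℚ.+ ℚ.∣ b ∣     ≤⟨ ℚ.+-monoˡ-≤ ℚ.∣ b ∣ (close N≤m ℕ.≤-refl) ⟩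
      1ℚ ℚ.+ ℚ.∣ b ∣                ∎
      where
      open ℚ.≤-Reasoning
      open +-*-Solver
      a = approx x m
      b = approx x N

fromℚ : ℚ → ℝ
fromℚ q .approx _ = q
fromℚ q .cauchy {ε} ε>0 = 0 , λ _ _ →
  subst (λ r → ℚ.∣ r ∣ ℚ.≤ ε) (sym (ℚ.+-inverseʳ q)) (ℚ.<⇒≤ ε>0)

0ℝ 1ℝ : ℝ
0ℝ = fromℚ 0ℚ
1ℝ = fromℚ 1ℚ

infix  4 _<_
infixl 6 _+_ _-_
infixl 7 _*_

_+_ : ℝ → ℝ → ℝ
(x + y) .approx n = approx x n ℚ.+ approx y n
(x + y) .cauchy {ε} ε>0 with cauchy x (half-pos ε>0) | cauchy y (half-pos ε>0)
... | M , closex | N , closey = M ℕ.⊔ N , λ {m} {n} M⊔N≤m M⊔N≤n →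
  let open ℚ.≤-Reasoning
      open +-*-Solver
      a = approx x m ; b = approx y m ; c = approx x n ; d = approx y n
  in begin
    ℚ.∣ a ℚ.+ b ℚ.- (c ℚ.+ d) ∣
      ≡⟨ cong ℚ.∣_∣ (solve 4 (λ a b c d → a :+ b :- (c :+ d) := (a :- c) :+ (b :- d)) refl a b c d) ⟩
    ℚ.∣ (a ℚ.- c) ℚ.+ (b ℚ.- d) ∣
      ≤⟨ ℚ.∣p+q∣≤∣p∣+∣q∣ (a ℚ.- c) (b ℚ.- d) ⟩
    ℚ.∣ a ℚ.- c ∣ ℚ.+ ℚ.∣ b ℚ.- d ∣
      ≤⟨ ℚ.+-mono-≤ (closex (ℕ.m⊔n≤o⇒m≤o M N M⊔N≤m) (ℕ.m⊔n≤o⇒m≤o M N M⊔N≤n))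
                    (closey (ℕ.m⊔n≤o⇒n≤o M N M⊔N≤m) (ℕ.m⊔n≤o⇒n≤o M N M⊔N≤n)) ⟩
    ½ ℚ.* ε ℚ.+ ½ ℚ.* ε
      ≡⟨ halves ε ⟩
    ε ∎

-_ : ℝ → ℝ
(- x) .approx n = ℚ.- approx x n
(- x) .cauchy {ε} ε>0 = map₂ (λ close {m} {n} N≤m N≤n →
  let open +-*-Solver in
  subst (ℚ._≤ ε)
    (trans (sym (ℚ.∣-p∣≡∣p∣ (approx x m ℚ.- approx x n)))
           (cong ℚ.∣_∣ (solve 2 (λ a b → :- (a :- b) := :- a :- :- b) refl (approx x m) (approx x n))))
    (close N≤m N≤n)) (cauchy x ε>0)

_-_ : ℝ → ℝ → ℝ
x - y = x + (- y)

private
  product-split : ∀ a b c d → a ℚ.* b ℚ.- c ℚ.* d ≡ a ℚ.* (b ℚ.- d) ℚ.+ d ℚ.* (a ℚ.- c)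
  product-split a b c d = begin
    a ℚ.* b ℚ.- c ℚ.* d
      ≡⟨ solve 4 (λ ab ad dc cd → ab :- cd := (ab :- ad) :+ (ad :- cd)) refl
           (a ℚ.* b) (a ℚ.* d) (d ℚ.* c) (c ℚ.* d) ⟩
    (a ℚ.* b ℚ.- a ℚ.* d) ℚ.+ (a ℚ.* d ℚ.- c ℚ.* d)
      ≡⟨ cong₂ (λ u v → (a ℚ.* b ℚ.- a ℚ.* d) ℚ.+ (u ℚ.- v)) (ℚ.*-comm a d) (ℚ.*-comm c d) ⟩
    (a ℚ.* b ℚ.- a ℚ.* d) ℚ.+ (d ℚ.* a ℚ.- d ℚ.* c)
      ≡⟨ cong₂ ℚ._+_ (factor a b d) (factor d a c) ⟨
    a ℚ.* (b ℚ.- d) ℚ.+ d ℚ.* (a ℚ.- c) ∎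
    where
    open ≡-Reasoning
    open +-*-Solver
    factor : ∀ x y z → x ℚ.* (y ℚ.- z) ≡ x ℚ.* y ℚ.- x ℚ.* z
    factor x y z = trans (ℚ.*-distribˡ-+ x y (ℚ.- z)) (cong (x ℚ.* y ℚ.+_) (sym (ℚ.neg-distribʳ-* x z)))

  product-close : ∀ {a b c d A D δ η} → 0ℚ ℚ.≤ A → 0ℚ ℚ.≤ D →
                  ℚ.∣ a ∣ ℚ.≤ A → ℚ.∣ b ℚ.- d ∣ ℚ.≤ η → ℚ.∣ d ∣ ℚ.≤ D → ℚ.∣ a ℚ.- c ∣ ℚ.≤ δ →
                  ℚ.∣ a ℚ.* b ℚ.- c ℚ.* d ∣ ℚ.≤ A ℚ.* η ℚ.+ D ℚ.* δ
  product-close {a} {b} {c} {d} {A} {D} {δ} {η} 0≤A 0≤D a≤A bd≤η d≤D ac≤δ = begin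
    ℚ.∣ a ℚ.* b ℚ.- c ℚ.* d ∣
      ≡⟨ cong ℚ.∣_∣ (product-split a b c d) ⟩
    ℚ.∣ a ℚ.* (b ℚ.- d) ℚ.+ d ℚ.* (a ℚ.- c) ∣
      ≤⟨ ℚ.∣p+q∣≤∣p∣+∣q∣ (a ℚ.* (b ℚ.- d)) (d ℚ.* (a ℚ.- c)) ⟩
    ℚ.∣ a ℚ.* (b ℚ.- d) ∣ ℚ.+ ℚ.∣ d ℚ.* (a ℚ.- c) ∣
      ≡⟨ cong₂ ℚ._+_ (ℚ.∣p*q∣≡∣p∣*∣q∣ a (b ℚ.- d)) (ℚ.∣p*q∣≡∣p∣*∣q∣ d (a ℚ.- c)) ⟩
    ℚ.∣ a ∣ ℚ.* ℚ.∣ b ℚ.- d ∣ ℚ.+ ℚ.∣ d ∣ ℚ.* ℚ.∣ a ℚ.- c ∣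
      ≤⟨ ℚ.+-mono-≤ (*-mono-nonNeg (ℚ.0≤∣p∣ (b ℚ.- d)) 0≤A a≤A bd≤η)
                    (*-mono-nonNeg (ℚ.0≤∣p∣ (a ℚ.- c)) 0≤D d≤D ac≤δ) ⟩
    A ℚ.* η ℚ.+ D ℚ.* δ ∎
    where open ℚ.≤-Reasoning

_*_ : ℝ → ℝ → ℝ
(x * y) .approx n = approx x n ℚ.* approx y n
(x * y) .cauchy {ε} ε>0 =
  let Bx , Bx>0 , Nx , boundx = tail-bound x
      By , By>0 , Ny , boundy = tail-bound y
      δx , δx>0 , eqx = scale By>0 (half-pos ε>0)
      δy , δy>0 , eqy = scale Bx>0 (half-pos ε>0)
      Mx , closex = cauchy x δx>0
      My , closey = cauchy y δy>0
      N = Nx ℕ.⊔ Ny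
      M = Mx ℕ.⊔ My
  in N ℕ.⊔ M , λ {m} {n} ≤m ≤n →
  let N≤m = ℕ.m⊔n≤o⇒m≤o N M ≤m
      N≤n = ℕ.m⊔n≤o⇒m≤o N M ≤n
      M≤m = ℕ.m⊔n≤o⇒n≤o N M ≤m
      M≤n = ℕ.m⊔n≤o⇒n≤o N M ≤n
  in subst (ℚ.∣ approx x m ℚ.* approx y m ℚ.- approx x n ℚ.* approx y n ∣ ℚ.≤_)
       (trans (cong₂ ℚ._+_ eqy eqx) (halves ε))
       (product-close {approx x m} {approx y m} {approx x n} {approx y n}
         (ℚ.<⇒≤ Bx>0) (ℚ.<⇒≤ By>0)
         (boundx (ℕ.m⊔n≤o⇒m≤o Nx Ny N≤m))
         (closey (ℕ.m⊔n≤o⇒n≤o Mx My M≤m) (ℕ.m⊔n≤o⇒n≤o Mx My M≤n))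
         (boundy (ℕ.m⊔n≤o⇒n≤o Nx Ny N≤n))
         (closex (ℕ.m⊔n≤o⇒m≤o Mx My M≤m) (ℕ.m⊔n≤o⇒m≤o Mx My M≤n)))

∣_∣ : ℝ → ℝ
∣ x ∣ .approx n = ℚ.∣ approx x n ∣
∣ x ∣ .cauchy {ε} ε>0 = map₂ (λ close {m} {n} N≤m N≤n →
  ℚ.≤-trans (reverse-triangle (approx x m) (approx x n)) (close N≤m N≤n)) (cauchy x ε>0)
  where
  open +-*-Solver
  bound : ∀ a b → ℚ.∣ a ∣ ℚ.- ℚ.∣ b ∣ ℚ.≤ ℚ.∣ a ℚ.- b ∣
  bound a b = begin
    ℚ.∣ a ∣ ℚ.- ℚ.∣ b ∣
      ≡⟨ cong (λ r → ℚ.∣ r ∣ ℚ.- ℚ.∣ b ∣) (solve 2 (λ a b → a := a :- b :+ b) refl a b) ⟩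
    ℚ.∣ a ℚ.- b ℚ.+ b ∣ ℚ.- ℚ.∣ b ∣
      ≤⟨ ℚ.+-monoˡ-≤ (ℚ.- ℚ.∣ b ∣) (ℚ.∣p+q∣≤∣p∣+∣q∣ (a ℚ.- b) b) ⟩
    ℚ.∣ a ℚ.- b ∣ ℚ.+ ℚ.∣ b ∣ ℚ.- ℚ.∣ b ∣
      ≡⟨ solve 2 (λ u v → u :+ v :- v := u) refl ℚ.∣ a ℚ.- b ∣ ℚ.∣ b ∣ ⟩
    ℚ.∣ a ℚ.- b ∣ ∎
    where open ℚ.≤-Reasoning
  flip-sign : ∀ a b → ℚ.- (a ℚ.- b) ≡ b ℚ.- a
  flip-sign = solve 2 (λ a b → :- (a :- b) := b :- a) refl
  reverse-triangle : ∀ a b → ℚ.∣ ℚ.∣ a ∣ ℚ.- ℚ.∣ b ∣ ∣ ℚ.≤ ℚ.∣ a ℚ.- b ∣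
  reverse-triangle a b with ℚ.∣p∣≡p∨∣p∣≡-p (ℚ.∣ a ∣ ℚ.- ℚ.∣ b ∣)
  ... | inj₁ eq = subst (ℚ._≤ ℚ.∣ a ℚ.- b ∣) (sym eq) (bound a b)
  ... | inj₂ eq = subst₂ ℚ._≤_ (sym (trans eq (flip-sign ℚ.∣ a ∣ ℚ.∣ b ∣)))
                    (trans (cong ℚ.∣_∣ (sym (flip-sign a b))) (ℚ.∣-p∣≡∣p∣ (a ℚ.- b))) (bound b a)

_<_ : Rel ℝ 0ℓ
x < y = ∃[ ε ] 0ℚ ℚ.< ε × ∃[ N ] (∀ {n} → N ℕ.≤ n → approx x n ℚ.+ ε ℚ.≤ approx y n)

-- 1/a + 1/(a+1) + ⋯ + 1/(a+l-1).
reciprocalSum : (a l : ℕ) → .{{NonZero a}} → ℚ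
reciprocalSum a zero    = 0ℚ
reciprocalSum a (suc l) = + 1 ℚ./ a ℚ.+ reciprocalSum (suc a) l

private
  2^m≢0 : ∀ {m} → NonZero (2 ℕ.^ m)
  2^m≢0 {m} = ℕ.m^n≢0 2 m

-- The left Riemann sum of log n = ∫₁ⁿ dt/t with mesh h = 2⁻ᵐ: it has (n-1)/h
-- terms h · 1/(1 + jh) = 1/(2ᵐ + j).
logRiemannSum : (n m : ℕ) → ℚ
logRiemannSum n m = reciprocalSum (2 ℕ.^ m) (2 ℕ.^ m ℕ.* pred n) {{2^m≢0 {m}}}

private
  recip : (a : ℕ) → .{{NonZero a}} → ℚ
  recip a = + 1 ℚ./ a

  recip-anti : ∀ {a b} .{{_ : NonZero a}} .{{_ : NonZero b}} → a ℕ.≤ b → recip b ℚ.≤ recip a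
  recip-anti {suc a} {suc b} a≤b = ℚ.toℚᵘ-cancel-≤ (begin
    ℚ.toℚᵘ (recip (suc b))  ≃⟨ ℚ.toℚᵘ-fromℚᵘ (mkℚᵘ (+ 1) b) ⟩
    mkℚᵘ (+ 1) b            ≤⟨ ℚᵘ.*≤* (ℤ.*-monoˡ-≤-nonNeg (+ 1) (ℤ.+≤+ a≤b)) ⟩
    mkℚᵘ (+ 1) a            ≃⟨ ℚ.toℚᵘ-fromℚᵘ (mkℚᵘ (+ 1) a) ⟨
    ℚ.toℚᵘ (recip (suc a))  ∎)
    where open ℚᵘ.≤-Reasoning

  recip-nonNeg : ∀ a .{{_ : NonZero a}} → 0ℚ ℚ.≤ recip a
  recip-nonNeg a = ℚ.nonNegative⁻¹ (recip a) {{ℚ.normalize-nonNeg 1 a}}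

  recip-double : ∀ a .{{_ : NonZero a}} .{{_ : NonZero (2 ℕ.* a)}} → recip (2 ℕ.* a) ≡ ½ ℚ.* recip a
  recip-double (suc a) = ℚ.toℚᵘ-injective (begin
    ℚ.toℚᵘ (recip (2 ℕ.* suc a))         ≈⟨ ℚ.toℚᵘ-fromℚᵘ (mkℚᵘ (+ 1) _) ⟩
    mkℚᵘ (+ 1) (pred (2 ℕ.* suc a))      ≡⟨⟩
    ℚ.toℚᵘ ½ ℚᵘ.* mkℚᵘ (+ 1) a           ≈⟨ ℚᵘ.*-congˡ {ℚ.toℚᵘ ½} (ℚ.toℚᵘ-fromℚᵘ (mkℚᵘ (+ 1) a)) ⟨
    ℚ.toℚᵘ ½ ℚᵘ.* ℚ.toℚᵘ (recip (suc a)) ≈⟨ ℚ.toℚᵘ-homo-* ½ (recip (suc a)) ⟨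
    ℚ.toℚᵘ (½ ℚ.* recip (suc a))         ∎)
    where open import Relation.Binary.Reasoning.Setoid ℚᵘ.≃-setoid

  double≢0 : ∀ a → .{{NonZero a}} → NonZero (2 ℕ.* a)
  double≢0 a = ℕ.m*n≢0 2 a

  reciprocalSum-cong : ∀ {a b k l} .{{_ : NonZero a}} .{{_ : NonZero b}} → a ≡ b → k ≡ l →
                       reciprocalSum a k ≡ reciprocalSum b l
  reciprocalSum-cong refl refl = refl

  double-suc : ∀ a → 2 ℕ.* suc a ≡ suc (suc (2 ℕ.* a))
  double-suc a = ℕ.*-suc 2 a

  unfold : ∀ a l .{{_ : NonZero a}} →
           let instance _ = double≢0 a in
           reciprocalSum (2 ℕ.* a) (2 ℕ.* suc l) ≡
           ½ ℚ.* recip a ℚ.+ (recip (suc (2 ℕ.* a)) ℚ.+ reciprocalSum (2 ℕ.* suc a) (2 ℕ.* l))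
  unfold a l = trans (reciprocalSum-cong {a = 2 ℕ.* a} {b = 2 ℕ.* a} refl (double-suc l))
    (cong₂ ℚ._+_ (recip-double a)
      (cong (recip (suc (2 ℕ.* a)) ℚ.+_) (reciprocalSum-cong (sym (double-suc a)) (refl {x = 2 ℕ.* l}))))
    where instance _ = double≢0 a

  refine-upper : ∀ a l .{{_ : NonZero a}} →
                 let instance _ = double≢0 a in
                 reciprocalSum (2 ℕ.* a) (2 ℕ.* l) ℚ.≤ reciprocalSum a l
  refine-upper a zero    = ℚ.≤-refl
  refine-upper a (suc l) = begin
    reciprocalSum (2 ℕ.* a) (2 ℕ.* suc l)
      ≡⟨ unfold a l ⟩
    ½ ℚ.* recip a ℚ.+ (recip (suc (2 ℕ.* a)) ℚ.+ reciprocalSum (2 ℕ.* suc a) (2 ℕ.* l))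
      ≤⟨ ℚ.+-monoʳ-≤ (½ ℚ.* recip a) (ℚ.+-mono-≤ step (refine-upper (suc a) l)) ⟩
    ½ ℚ.* recip a ℚ.+ (½ ℚ.* recip a ℚ.+ reciprocalSum (suc a) l)
      ≡⟨ ℚ.+-assoc (½ ℚ.* recip a) (½ ℚ.* recip a) _ ⟨
    (½ ℚ.* recip a ℚ.+ ½ ℚ.* recip a) ℚ.+ reciprocalSum (suc a) l
      ≡⟨ cong (ℚ._+ reciprocalSum (suc a) l) (halves (recip a)) ⟩
    recip a ℚ.+ reciprocalSum (suc a) l ∎
    where
    open ℚ.≤-Reasoning
    instance _ = double≢0 a
    step : recip (suc (2 ℕ.* a)) ℚ.≤ ½ ℚ.* recip a
    step = subst (recip (suc (2 ℕ.* a)) ℚ.≤_) (recip-double a)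
             (recip-anti (ℕ.n≤1+n (2 ℕ.* a)))

  refine-lower : ∀ a l .{{_ : NonZero a}} →
                 let instance _ = double≢0 a in
                 reciprocalSum a l ℚ.≤ ½ ℚ.* recip a ℚ.+ reciprocalSum (2 ℕ.* a) (2 ℕ.* l)
  refine-lower a zero    = subst (0ℚ ℚ.≤_) (sym (ℚ.+-identityʳ (½ ℚ.* recip a)))
    (subst (ℚ._≤ ½ ℚ.* recip a) (ℚ.*-zeroʳ ½) (ℚ.*-monoˡ-≤-nonNeg ½ (recip-nonNeg a)))
  refine-lower a (suc l) = begin
    recip a ℚ.+ reciprocalSum (suc a) l
      ≤⟨ ℚ.+-monoʳ-≤ (recip a) (refine-lower (suc a) l) ⟩
    recip a ℚ.+ (½ ℚ.* recip (suc a) ℚ.+ rest)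
      ≤⟨ ℚ.+-monoʳ-≤ (recip a) (ℚ.+-monoˡ-≤ rest step) ⟩
    recip a ℚ.+ (recip (suc (2 ℕ.* a)) ℚ.+ rest)
      ≡⟨ cong (ℚ._+ (recip (suc (2 ℕ.* a)) ℚ.+ rest)) (halves (recip a)) ⟨
    ½ ℚ.* recip a ℚ.+ ½ ℚ.* recip a ℚ.+ (recip (suc (2 ℕ.* a)) ℚ.+ rest)
      ≡⟨ ℚ.+-assoc (½ ℚ.* recip a) (½ ℚ.* recip a) _ ⟩
    ½ ℚ.* recip a ℚ.+ (½ ℚ.* recip a ℚ.+ (recip (suc (2 ℕ.* a)) ℚ.+ rest))
      ≡⟨ cong (½ ℚ.* recip a ℚ.+_) (unfold a l) ⟨
    ½ ℚ.* recip a ℚ.+ reciprocalSum (2 ℕ.* a) (2 ℕ.* suc l) ∎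
    where
    open ℚ.≤-Reasoning
    instance _ = double≢0 a
    rest : ℚ
    rest = reciprocalSum (2 ℕ.* suc a) (2 ℕ.* l)
    step : ½ ℚ.* recip (suc a) ℚ.≤ recip (suc (2 ℕ.* a))
    step = subst (ℚ._≤ recip (suc (2 ℕ.* a))) (recip-double (suc a))
             (recip-anti (subst (suc (2 ℕ.* a) ℕ.≤_) (sym (double-suc a)) (ℕ.n≤1+n _)))

  n<2^n : ∀ n → n ℕ.< 2 ℕ.^ n
  n<2^n zero    = s≤s z≤n
  n<2^n (suc n) = ℕ.+-mono-≤ {1} (ℕ.m^n>0 2 n) (subst (suc n ℕ.≤_) (sym (ℕ.+-identityʳ (2 ℕ.^ n))) (n<2^n n))

  module _ (n : ℕ) where
    S : ℕ → ℚ
    S = logRiemannSum n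

    ρ : ℕ → ℚ
    ρ m = recip (2 ℕ.^ m) {{2^m≢0 {m}}}

    S-suc : ∀ m → let instance _ = double≢0 (2 ℕ.^ m) {{2^m≢0 {m}}} in
            S (suc m) ≡ reciprocalSum (2 ℕ.* 2 ℕ.^ m) (2 ℕ.* (2 ℕ.^ m ℕ.* pred n))
    S-suc m = cong (λ l → reciprocalSum (2 ℕ.* 2 ℕ.^ m) l {{double≢0 (2 ℕ.^ m) {{2^m≢0 {m}}}}})
                (ℕ.*-assoc 2 (2 ℕ.^ m) (pred n))

    S-step-≤ : ∀ m → S (suc m) ℚ.≤ S m
    S-step-≤ m = subst (ℚ._≤ S m) (sym (S-suc m))
      (refine-upper (2 ℕ.^ m) (2 ℕ.^ m ℕ.* pred n) {{2^m≢0 {m}}})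

    S-step-≥ : ∀ m → S m ℚ.≤ ρ (suc m) ℚ.+ S (suc m)
    S-step-≥ m = subst₂ (λ r s → S m ℚ.≤ r ℚ.+ s)
      (sym (recip-double (2 ℕ.^ m) {{2^m≢0 {m}}} {{2^m≢0 {suc m}}})) (sym (S-suc m))
      (refine-lower (2 ℕ.^ m) (2 ℕ.^ m ℕ.* pred n) {{2^m≢0 {m}}})

    S-anti : ∀ m d → S (d ℕ.+ m) ℚ.≤ S m
    S-anti m zero    = ℚ.≤-refl
    S-anti m (suc d) = ℚ.≤-trans (S-step-≤ (d ℕ.+ m)) (S-anti m d)

    S-gap : ∀ m d → S m ℚ.+ ρ (d ℕ.+ m) ℚ.≤ S (d ℕ.+ m) ℚ.+ ρ m
    S-gap m zero    = ℚ.≤-refl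
    S-gap m (suc d) = begin
      S m ℚ.+ r′                    ≡⟨ solve 2 (λ s r → s :+ r := s :+ (r :+ r) :- r) refl (S m) r′ ⟩
      S m ℚ.+ (r′ ℚ.+ r′) ℚ.- r′    ≡⟨ cong (λ r → S m ℚ.+ r ℚ.- r′) r′+r′≡r ⟩
      S m ℚ.+ ρ e ℚ.- r′            ≤⟨ ℚ.+-monoˡ-≤ (ℚ.- r′) (S-gap m d) ⟩
      S e ℚ.+ ρ m ℚ.- r′            ≤⟨ ℚ.+-monoˡ-≤ (ℚ.- r′) (ℚ.+-monoˡ-≤ (ρ m) (S-step-≥ e)) ⟩
      r′ ℚ.+ S (suc e) ℚ.+ ρ m ℚ.- r′ ≡⟨ solve 3 (λ r s t → r :+ s :+ t :- r := s :+ t) refl r′ (S (suc e)) (ρ m) ⟩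
      S (suc e) ℚ.+ ρ m             ∎
      where
      open ℚ.≤-Reasoning
      open +-*-Solver
      e = d ℕ.+ m
      r′ = ρ (suc e)
      r′+r′≡r : r′ ℚ.+ r′ ≡ ρ e
      r′+r′≡r = trans (cong₂ ℚ._+_ eq eq) (halves (ρ e))
        where
        eq : r′ ≡ ½ ℚ.* ρ e
        eq = recip-double (2 ℕ.^ e) {{2^m≢0 {e}}} {{2^m≢0 {suc e}}}

    S-close′ : ∀ m d → ℚ.∣ S m ℚ.- S (d ℕ.+ m) ∣ ℚ.≤ ρ m
    S-close′ m d = begin
      ℚ.∣ S m ℚ.- S e ∣         ≡⟨ ℚ.0≤p⇒∣p∣≡p nonNeg ⟩
      S m ℚ.- S e               ≡⟨ cong (ℚ._- S e) (ℚ.+-identityʳ (S m)) ⟨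
      S m ℚ.+ 0ℚ ℚ.- S e        ≤⟨ ℚ.+-monoˡ-≤ (ℚ.- S e) (ℚ.+-monoʳ-≤ (S m) (recip-nonNeg (2 ℕ.^ e) {{2^m≢0 {e}}})) ⟩
      S m ℚ.+ ρ e ℚ.- S e       ≤⟨ ℚ.+-monoˡ-≤ (ℚ.- S e) (S-gap m d) ⟩
      S e ℚ.+ ρ m ℚ.- S e       ≡⟨ solve 2 (λ s r → s :+ r :- s := r) refl (S e) (ρ m) ⟩
      ρ m                       ∎
      where
      open ℚ.≤-Reasoning
      open +-*-Solver
      e = d ℕ.+ m
      nonNeg : 0ℚ ℚ.≤ S m ℚ.- S e
      nonNeg = subst (ℚ._≤ S m ℚ.- S e) (ℚ.+-inverseʳ (S e)) (ℚ.+-monoˡ-≤ (ℚ.- S e) (S-anti m d))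

    S-close : ∀ {m k} → m ℕ.≤ k → ℚ.∣ S m ℚ.- S k ∣ ℚ.≤ ρ m
    S-close {m} {k} m≤k = subst (λ j → ℚ.∣ S m ℚ.- S j ∣ ℚ.≤ ρ m) (ℕ.m∸n+n≡m m≤k) (S-close′ m (k ℕ.∸ m))

    ρ-anti : ∀ {m k} → m ℕ.≤ k → ρ k ℚ.≤ ρ m
    ρ-anti {m} {k} m≤k = recip-anti {{2^m≢0 {m}}} {{2^m≢0 {k}}} (ℕ.^-monoʳ-≤ 2 m≤k)

    ρ-small : ∀ {ε} → 0ℚ ℚ.< ε → ∃[ N ] ρ N ℚ.≤ ε
    ρ-small {mkℚ (+ zero) d c} (ℚ.*<* (ℤ.+<+ ()))
    ρ-small {mkℚ (-[1+ _ ]) d c} (ℚ.*<* ())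
    ρ-small {ε@(mkℚ (+ suc a) d c)} ε>0 = suc d , ℚ.≤-trans
      (recip-anti {{_}} {{2^m≢0 {suc d}}} (ℕ.<⇒≤ (n<2^n (suc d))))
      (ℚ.toℚᵘ-cancel-≤ (begin
        ℚ.toℚᵘ (recip (suc d))  ≃⟨ ℚ.toℚᵘ-fromℚᵘ (mkℚᵘ (+ 1) d) ⟩
        mkℚᵘ (+ 1) d            ≤⟨ ℚᵘ.*≤* (ℤ.*-monoʳ-≤-nonNeg (+ suc d) (ℤ.+≤+ {1} {suc a} (s≤s z≤n))) ⟩
        mkℚᵘ (+ suc a) d        ∎))
      where open ℚᵘ.≤-Reasoning

    S-bound : ∀ {ε} N → ρ N ℚ.≤ ε → ∀ {m k} → N ℕ.≤ m → N ℕ.≤ k → ℚ.∣ S m ℚ.- S k ∣ ℚ.≤ ε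
    S-bound {ε} N ρN≤ε {m} {k} N≤m N≤k = Sum.[_,_]′ forward backward (ℕ.≤-total m k)
      where
      open +-*-Solver
      forward : m ℕ.≤ k → ℚ.∣ S m ℚ.- S k ∣ ℚ.≤ ε
      forward m≤k = ℚ.≤-trans (S-close m≤k) (ℚ.≤-trans (ρ-anti N≤m) ρN≤ε)
      backward : k ℕ.≤ m → ℚ.∣ S m ℚ.- S k ∣ ℚ.≤ ε
      backward k≤m = subst (ℚ._≤ ε)
        (trans (sym (ℚ.∣-p∣≡∣p∣ (S k ℚ.- S m)))
               (cong ℚ.∣_∣ (solve 2 (λ a b → :- (a :- b) := b :- a) refl (S k) (S m))))
        (ℚ.≤-trans (S-close k≤m) (ℚ.≤-trans (ρ-anti N≤k) ρN≤ε))

    S-cauchy : ∀ {ε} → 0ℚ ℚ.< ε → ∃[ N ] (∀ {m k} → N ℕ.≤ m → N ℕ.≤ k → ℚ.∣ S m ℚ.- S k ∣ ℚ.≤ ε)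
    S-cauchy ε>0 = let N , ρN≤ε = ρ-small ε>0 in N , S-bound N ρN≤ε

log : (n : ℕ) → .{{NonZero n}} → ℝ
log n .approx = logRiemannSum n
log n .cauchy = S-cauchy n

infixl 7 _/_

_/_ : ℝ → (n : ℕ) → .{{NonZero n}} → ℝ
x / n = x * fromℚ (+ 1 ℚ./ n)

record SimpleGraph (V : Set) : Set₁ where
  field
    Adj        : Rel V 0ℓ
    adj?       : B.Decidable Adj
    adj-sym    : Symmetric Adj
    adj-irrefl : ∀ {v} → ¬ Adj v v

open SimpleGraph public

IsCopy : {V W : Set} (G : SimpleGraph W) (H : SimpleGraph V) → (V → W) → Set
IsCopy G H f = Injective _≡_ _≡_ f × (∀ {u v} → Adj H u v → Adj G (f u) (f v))

-- A copy is a not necessarily induced subgraph.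
ContainsCopy : {V W : Set} → SimpleGraph W → SimpleGraph V → Set
ContainsCopy G H = ∃ (IsCopy G H)

PathAdj : ∀ {m} → Rel (Fin m) 0ℓ
PathAdj i j = suc (toℕ i) ≡ toℕ j ⊎ suc (toℕ j) ≡ toℕ i

private
  pathAdj? : ∀ {m} → B.Decidable (PathAdj {m})
  pathAdj? i j = (suc (toℕ i) ℕ.≟ toℕ j) ⊎-dec (suc (toℕ j) ℕ.≟ toℕ i)

  pathAdj-irrefl : ∀ {m} {i : Fin m} → ¬ PathAdj i i
  pathAdj-irrefl = Sum.[ ℕ.1+n≢n , ℕ.1+n≢n ]

-- The vertex (i , a) is the a-th vertex of the path starting at the i-th vertex
-- of P; P itself consists of the vertices (i , 0). In Comb n k the number of
-- these paths is the quotient n/k.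
CombAdj : ∀ {q k} → Rel (Fin q × Fin k) 0ℓ
CombAdj (i , a) (j , b) = (i ≡ j × PathAdj a b)
                        ⊎ (toℕ a ≡ 0 × toℕ b ≡ 0 × PathAdj i j)

Comb : (n k : ℕ) (k∣n : k ∣ n) → SimpleGraph (Fin (quotient k∣n) × Fin k)
Comb n k k∣n .Adj = CombAdj
Comb n k k∣n .adj? (i , a) (j , b) =
  (i Fin.≟ j ×-dec pathAdj? a b)
    ⊎-dec (toℕ a ℕ.≟ 0 ×-dec toℕ b ℕ.≟ 0 ×-dec pathAdj? i j)
Comb n k k∣n .adj-sym =
  Sum.map (λ (i≡j , ab) → sym i≡j , Sum.swap ab) (λ (a≡0 , b≡0 , ij) → b≡0 , a≡0 , Sum.swap ij)
Comb n k k∣n .adj-irrefl =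
  Sum.[ (λ (_ , aa) → pathAdj-irrefl aa) , (λ (_ , _ , ii) → pathAdj-irrefl ii) ]

module _ {q k n : ℕ} (G : SimpleGraph (Fin n)) (H : SimpleGraph (Fin q × Fin k)) where
  private
    all×? : {P : Pred (Fin q × Fin k) 0ℓ} → Decidable P → Dec (∀ v → P v)
    all×? P? = map′ (λ h (i , a) → h i a) (λ h i a → h (i , a))
                 (Fin.all? λ i → Fin.all? λ a → P? (i , a))

    isCopy? : Decidable (IsCopy G H)
    isCopy? f =
      map′ (λ h {u} {v} → h u v) (λ h u v → h)
        (all×? λ u → all×? λ v → (f u Fin.≟ f v) →-dec ≡-dec Fin._≟_ Fin._≟_ u v)
      ×-dec
      map′ (λ h {u} {v} → h u v) (λ h u v → h)
        (all×? λ u → all×? λ v → adj? H u v →-dec adj? G (f u) (f v))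

    isCopy-resp : ∀ {f g} → f ≗ g → IsCopy G H f → IsCopy G H g
    isCopy-resp f≗g (inj , hom) =
      (λ {u} {v} eq → inj (trans (f≗g u) (trans eq (sym (f≗g v))))) ,
      (λ {u} {v} uv → subst₂ (Adj G) (f≗g u) (f≗g v) (hom uv))

    decode : Fin (n ℕ.^ (q ℕ.* k)) → (Fin q × Fin k → Fin n)
    decode c (i , a) = finToFun c (combine i a)

    encode : (Fin q × Fin k → Fin n) → Fin (n ℕ.^ (q ℕ.* k))
    encode f = funToFin (f ∘ remQuot k)

    decode-encode : ∀ f → f ≗ decode (encode f)
    decode-encode f (i , a) = sym (trans (Fin.finToFun-funToFin (f ∘ remQuot k) (combine i a))
                                         (cong f (Fin.remQuot-combine i a)))

  containsCopy? : Dec (ContainsCopy G H)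
  containsCopy? = map′ (λ (c , copy) → decode c , copy)
                       (λ (f , copy) → encode f , isCopy-resp (decode-encode f) copy)
                       (Fin.any? (isCopy? ∘ decode))

possibleEdges : (n : ℕ) → List (Fin n × Fin n)
possibleEdges n = filter (λ (u , v) → u Fin.<? v) (cartesianProduct (allFin n) (allFin n))

Outcome : ℕ → Set
Outcome n = Subset (length (possibleEdges n))

graph : ∀ {n} → Outcome n → SimpleGraph (Fin n)
graph {n} ω = record
  { Adj        = λ u v → ∃[ e ] e ∈ ω × Joins e u v
  ; adj?       = λ u v → Fin.any? λ e → e ∈? ω ×-dec (edge e ≟ (u , v) ⊎-dec edge e ≟ (v , u))
  ; adj-sym    = λ (e , e∈ω , eq) → e , e∈ω , Sum.swap eq
  ; adj-irrefl = λ (e , _ , eq) → Sum.[_,_]′ (loopless e) (loopless e) eq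
  }
  where
  _≟_ = ≡-dec Fin._≟_ Fin._≟_
  infix 5 _≟_
  edge : Fin (length (possibleEdges n)) → Fin n × Fin n
  edge = List.lookup (possibleEdges n)
  Joins : Fin (length (possibleEdges n)) → Rel (Fin n) 0ℓ
  Joins e u v = edge e ≡ (u , v) ⊎ edge e ≡ (v , u)
  loopless : ∀ e {v} → ¬ (edge e ≡ (v , v))
  loopless e eq = Fin.<-irrefl refl (subst (λ (u , v) → u Fin.< v) eq
    (proj₂ (∈-filter⁻ (λ (u , v) → u Fin.<? v) {xs = cartesianProduct (allFin n) (allFin n)}
      (∈-lookup {xs = possibleEdges n} e))))

-- The probability of exactly the outcome ω when each of N elements is present
-- independently with probability p.
weight : ∀ {N} → ℝ → Subset N → ℝ
weight p []            = 1ℝ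
weight p (inside  ∷ ω) = p * weight p ω
weight p (outside ∷ ω) = (1ℝ - p) * weight p ω

sumSubsets : ∀ {N} → (Subset N → ℝ) → ℝ
sumSubsets {zero}  f = f []
sumSubsets {suc N} f = sumSubsets (f ∘ (inside ∷_)) + sumSubsets (f ∘ (outside ∷_))

-- ℙ[𝒢 n , p ⊨ A?] is the probability that 𝒢(n,p) has the property decided by A?.
-- The formula makes sense for every real p and is a probability when 0 ≤ p ≤ 1;
-- for fixed C > 0 this holds of p = C log n / n once n is large enough.
ℙ[𝒢_,_⊨_] : (n : ℕ) (p : ℝ) {A : Pred (SimpleGraph (Fin n)) 0ℓ} → Decidable A → ℝ
ℙ[𝒢 n , p ⊨ A? ] = sumSubsets {length (possibleEdges n)} λ ω →
  if does (A? (graph ω)) then weight p ω else 0ℝ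

-- x n is defined only for positive n.
_⟶_ : ((n : ℕ) → .{{NonZero n}} → ℝ) → ℝ → Set
x ⟶ a = ∀ ε → 0ℝ < ε → ∃[ N ] (∀ n → .{{_ : NonZero n}} → N ℕ.≤ n → ∣ x n - a ∣ < ε)

{-# OPTIONS --safe #-}

-- The copies of the comb are spread: the image of a uniformly random bijection
-- contains a given set of s edges with probability at most (64/n)ˢ. Indeed, once
-- the edges are oriented and classified as steps along P or along a tooth (4ˢ
-- choices), the positions of all children follow from those of the at most s roots.
-- For a spread family the argument of Frankston, Kahn, Narayanan and Park applies.
-- Given a random set W, replace each member S by its fragment T, the part outside W
-- of the first member contained in W ∪ S. Since T lies in the first member contained
-- in W ∪ T, there are on average so few fragments larger than half the previous bound
-- that they may be discarded. Exposing O(log n) random sets of density O(1/n) brings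
-- the sizes down to a constant 2ʲ, and one last set of density O(1/n), with a larger
-- constant, removes what is left. The failure probability depends only on j and on
-- the last constant, so it can be made as small as desired. All of this is done with
-- rational probabilities, namely the rational approximations of C log n / n.

module Submission where

import Defs as D
open import Algebra.Bundles using (module CommutativeRing)
open import Data.Bool.Base using (Bool; if_then_else_; true; false)
open import Data.Empty using () renaming (⊥ to ⊥₀)
open import Data.Fin.Base as Fin using (Fin; zero; suc; toℕ; combine; remQuot)
import Data.Fin.Properties as Fin
import Data.Fin.Subset.Properties as S
open import Data.Integer.Base as ℤ using (-[1+_])
import Data.Integer.Properties as ℤ
import Data.Integer.Solver as ℤ
open import Data.List.Base as List using (List; []; _∷_; filter; map; length; allFin; concatMap)
import Data.List.Membership.Propositional.Properties as L
import Data.List.Properties as List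
open import Data.List.Relation.Unary.All as All using (All; []; _∷_)
import Data.List.Relation.Unary.All.Properties as All
open import Data.List.Relation.Unary.AllPairs using ([]; _∷_)
open import Data.List.Relation.Unary.Any as Any using (Any; here; there; any?)
import Data.List.Relation.Unary.Any.Properties as Any
open import Data.List.Relation.Unary.Unique.Propositional using (Unique)
import Data.List.Relation.Unary.Unique.Propositional.Properties as Unique
open import Data.Nat.Base as ℕ using (ℕ; zero; suc; pred; NonZero; z≤n; s≤s)
open import Data.Nat.Divisibility using (_∣_; divides)
import Data.Nat.Properties as ℕ
import Data.Nat.Solver as ℕ
open import Data.Product.Base using (_×_; _,_; proj₁; proj₂; ∃-syntax; Σ-syntax)
open import Data.Rational.Base as ℚ using (ℚ; mkℚ; 0ℚ; 1ℚ; ½)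
import Data.Rational.Properties as ℚ
open import Data.Rational.Solver using (module +-*-Solver)
open import Data.Rational.Unnormalised.Base as ℚᵘ using (mkℚᵘ; *≡*)
import Data.Rational.Unnormalised.Properties as ℚᵘ
open import Data.Sum.Base as Sum using (_⊎_; inj₁; inj₂)
open import Data.Unit.Base using (tt)
open import Data.Vec.Base as Vec using (Vec; []; _∷_; lookup; toList; here; there)
import Data.Vec.Membership.Propositional.Properties as Vec
import Data.Vec.Properties as Vec
open import Function.Base using (_∘_; id)
open import Relation.Binary.Definitions using (DecidableEquality; tri<; tri≈; tri>)
open import Relation.Binary.PropositionalEquality
open import Relation.Nullary.Decidable using (Dec; yes; no; does; map′; ¬?; dec-true; _×-dec_; _⊎-dec_)
open import Relation.Nullary.Negation using (¬_; contradiction)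
open import Relation.Unary using (Decidable)

-- A round that lowers the size bound from `2b` to `b` costs an error of order `2^-b`, which is not
-- small once `b` is bounded. Halving down to the empty set would therefore leave a constant
-- probability of failure. This is why the rounds stop at size `2^j`, where their costs still form a
-- geometric series with sum `O(2^-j)`, and why the last set gets a constant of its own, chosen
-- after `j`. That constant may depend on the desired error without affecting `C`: the last set has
-- density `O(1/n)`, which the slack in `C log n / n` absorbs for large `n`. The logarithm comes
-- only from the number of rounds, about `2 log₂ n` halvings of the initial bound `n²` on the size
-- of a member. On the counting side, any factor `Kˢ` for sets of `s` edges is harmless, since it
-- only replaces the spread `1/n` by `K/n`. Hence estimates that lose a constant per edge are good
-- enough, and neither the shape of the forest formed by the `s` edges nor the exact count of its
-- extensions is needed.

module RandomSubsets where
  open import Algebra.Properties.Semiring.Exp (CommutativeRing.semiring ℚ.+-*-commutativeRing) public using (_^_; ^-homo-*)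
  open import Data.Fin.Subset using (Subset; inside; outside; _∈_; _⊆_; _∪_; _─_; ∁; ⊥; ∣_∣)
  open import Data.List.Membership.Propositional using (find; lose) renaming (_∈_ to _∈ₗ_)
  open import Data.Rational.Base using (_+_; _*_; _-_; -_; _≤_; _<_)

  -- Order, indicators and finite sums in the rationals.

  module OrderedField where
    *-monoʳ : ∀ {a b c} → 0ℚ ≤ a → b ≤ c → a * b ≤ a * c
    *-monoʳ {a} 0≤a = ℚ.*-monoˡ-≤-nonNeg a {{ℚ.nonNegative 0≤a}}

    *-monoˡ : ∀ {a b c} → 0ℚ ≤ c → a ≤ b → a * c ≤ b * c
    *-monoˡ {c = c} 0≤c = ℚ.*-monoʳ-≤-nonNeg c {{ℚ.nonNegative 0≤c}}

    0≤* : ∀ {a b} → 0ℚ ≤ a → 0ℚ ≤ b → 0ℚ ≤ a * b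
    0≤* {a} {b} 0≤a 0≤b = subst (_≤ a * b) (ℚ.*-zeroʳ a) (*-monoʳ 0≤a 0≤b)

    0≤+ : ∀ {a b} → 0ℚ ≤ a → 0ℚ ≤ b → 0ℚ ≤ a + b
    0≤+ = ℚ.+-mono-≤

    0≤1 : 0ℚ ≤ 1ℚ
    0≤1 = ℚ.nonNegative⁻¹ 1ℚ

    p≤q⇒0≤q-p : ∀ {p q} → p ≤ q → 0ℚ ≤ q - p
    p≤q⇒0≤q-p {p} {q} p≤q = subst (_≤ q - p) (ℚ.+-inverseʳ p) (ℚ.+-monoˡ-≤ (- p) p≤q)

    0≤q-p⇒p≤q : ∀ {p q} → 0ℚ ≤ q - p → p ≤ q
    0≤q-p⇒p≤q {p} {q} 0≤ = subst₂ _≤_ (ℚ.+-identityˡ p)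
      (solve 2 (λ p q → q :- p :+ p := q) refl p q) (ℚ.+-monoˡ-≤ p 0≤)
      where open +-*-Solver

    0≤^ : ∀ {a} n → 0ℚ ≤ a → 0ℚ ≤ a ^ n
    0≤^ zero    0≤a = 0≤1
    0≤^ (suc n) 0≤a = 0≤* 0≤a (0≤^ n 0≤a)

    ^-anti : ∀ {a m n} → 0ℚ ≤ a → a ≤ 1ℚ → m ℕ.≤ n → a ^ n ≤ a ^ m
    ^-anti {a} {n = n} 0≤a a≤1 z≤n = ^≤1 n
      where
      ^≤1 : ∀ n → a ^ n ≤ 1ℚ
      ^≤1 zero    = ℚ.≤-refl
      ^≤1 (suc n) = ℚ.≤-trans (*-monoʳ 0≤a (^≤1 n)) (subst (_≤ 1ℚ) (sym (ℚ.*-identityʳ a)) a≤1)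
    ^-anti 0≤a a≤1 (s≤s m≤n) = *-monoʳ 0≤a (^-anti 0≤a a≤1 m≤n)

  open OrderedField public

  module Indicator where
    𝟙 : ∀ {a} {A : Set a} → Dec A → ℚ
    𝟙 d = if does d then 1ℚ else 0ℚ

    private variable
      A B : Set

    𝟙-yes : (d : Dec A) → A → 𝟙 d ≡ 1ℚ
    𝟙-yes (yes _) a = refl
    𝟙-yes (no ¬a) a = contradiction a ¬a

    0≤𝟙 : (d : Dec A) → 0ℚ ≤ 𝟙 d
    0≤𝟙 (yes _) = 0≤1
    0≤𝟙 (no _)  = ℚ.≤-refl

    𝟙≤1 : (d : Dec A) → 𝟙 d ≤ 1ℚ
    𝟙≤1 (yes _) = ℚ.≤-refl
    𝟙≤1 (no _)  = 0≤1

    𝟙-mono : (d : Dec A) (e : Dec B) → (A → B) → 𝟙 d ≤ 𝟙 e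
    𝟙-mono (no _)  e f = 0≤𝟙 e
    𝟙-mono (yes a) e f = ℚ.≤-reflexive (sym (𝟙-yes e (f a)))

    𝟙≤ : (d : Dec A) → ∀ {x} → 0ℚ ≤ x → (A → 1ℚ ≤ x) → 𝟙 d ≤ x
    𝟙≤ (yes a) 0≤x 1≤x = 1≤x a
    𝟙≤ (no _)  0≤x 1≤x = 0≤x

    𝟙-cover : (d : Dec A) (e : Dec B) → (¬ A → B) → 1ℚ ≤ 𝟙 d * 1ℚ + 𝟙 e
    𝟙-cover (yes _) e f = subst (_≤ 1ℚ * 1ℚ + 𝟙 e) (ℚ.+-identityʳ 1ℚ) (ℚ.+-monoʳ-≤ 1ℚ (0≤𝟙 e))
    𝟙-cover (no ¬a) e f = ℚ.≤-reflexive (sym (trans (cong (0ℚ * 1ℚ +_) (𝟙-yes e (f ¬a))) (ℚ.+-identityˡ 1ℚ)))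

    𝟙-×-≤ : (d : Dec A) (e : Dec B) → ∀ {a b} → 0ℚ ≤ b → (B → a ≤ b) → 𝟙 (d ×-dec e) * a ≤ 𝟙 d * b
    𝟙-×-≤ (no _)  e {a} {b} 0≤b f = ℚ.≤-reflexive (trans (ℚ.*-zeroˡ a) (sym (ℚ.*-zeroˡ b)))
    𝟙-×-≤ (yes _) (yes y) 0≤b f = *-monoʳ 0≤1 (f y)
    𝟙-×-≤ (yes _) (no _) {a} {b} 0≤b f = subst₂ _≤_ (sym (ℚ.*-zeroˡ a)) (sym (ℚ.*-identityˡ b)) 0≤b

  open Indicator public

  module ListSum where
    private variable
      A B : Set

    ∑ : List A → (A → ℚ) → ℚ
    ∑ []       f = 0ℚ
    ∑ (x ∷ xs) f = f x + ∑ xs f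

    ∑-mono : ∀ (xs : List A) {f g} → (∀ {x} → x ∈ₗ xs → f x ≤ g x) → ∑ xs f ≤ ∑ xs g
    ∑-mono []       f≤g = ℚ.≤-refl
    ∑-mono (x ∷ xs) f≤g = ℚ.+-mono-≤ (f≤g (here refl)) (∑-mono xs (f≤g ∘ there))

    ∑-+ : ∀ (xs : List A) f g → ∑ xs (λ x → f x + g x) ≡ ∑ xs f + ∑ xs g
    ∑-+ []       f g = refl
    ∑-+ (x ∷ xs) f g = trans (cong (f x + g x +_) (∑-+ xs f g))
      (solve 4 (λ a b c d → a :+ b :+ (c :+ d) := a :+ c :+ (b :+ d)) refl (f x) (g x) (∑ xs f) (∑ xs g))
      where open +-*-Solver

    ∑-* : ∀ (xs : List A) c f → ∑ xs (λ x → c * f x) ≡ c * ∑ xs f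
    ∑-* []       c f = sym (ℚ.*-zeroʳ c)
    ∑-* (x ∷ xs) c f = trans (cong (c * f x +_) (∑-* xs c f)) (sym (ℚ.*-distribˡ-+ c (f x) (∑ xs f)))

    ∑-map : ∀ (xs : List A) (h : A → B) f → ∑ (map h xs) f ≡ ∑ xs (f ∘ h)
    ∑-map []       h f = refl
    ∑-map (x ∷ xs) h f = cong (f (h x) +_) (∑-map xs h f)

    ∑-nonNeg : ∀ (xs : List A) {f} → (∀ x → 0ℚ ≤ f x) → 0ℚ ≤ ∑ xs f
    ∑-nonNeg []       0≤f = ℚ.≤-refl
    ∑-nonNeg (x ∷ xs) 0≤f = 0≤+ (0≤f x) (∑-nonNeg xs 0≤f)

    ∑-filter : ∀ {P : A → Set} (P? : Decidable P) xs f → ∑ (filter P? xs) f ≡ ∑ xs (λ x → 𝟙 (P? x) * f x)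
    ∑-filter P? []       f = refl
    ∑-filter P? (x ∷ xs) f with P? x
    ... | yes _ = cong₂ _+_ (sym (ℚ.*-identityˡ (f x))) (∑-filter P? xs f)
    ... | no _  = trans (∑-filter P? xs f) (trans (sym (ℚ.+-identityˡ _)) (cong (_+ ∑ xs (λ x → 𝟙 (P? x) * f x)) (sym (ℚ.*-zeroˡ (f x)))))

  open ListSum public

  -- Expectation over a random subset with independent elements.

  module Expectation where
    private variable
      N : ℕ

    𝔼 : ℚ → (Subset N → ℚ) → ℚ
    𝔼 {zero}  p f = f []
    𝔼 {suc N} p f = p * 𝔼 p (f ∘ (inside ∷_)) + (1ℚ - p) * 𝔼 p (f ∘ (outside ∷_))

    𝔼-cong : ∀ p {f g : Subset N → ℚ} → f ≗ g → 𝔼 p f ≡ 𝔼 p g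
    𝔼-cong {zero}  p f≗g = f≗g []
    𝔼-cong {suc N} p f≗g = cong₂ _+_ (cong (p *_) (𝔼-cong p (f≗g ∘ (inside ∷_))))
                                     (cong ((1ℚ - p) *_) (𝔼-cong p (f≗g ∘ (outside ∷_))))

    𝔼-+ : ∀ p (f g : Subset N → ℚ) → 𝔼 p (λ W → f W + g W) ≡ 𝔼 p f + 𝔼 p g
    𝔼-+ {zero}  p f g = refl
    𝔼-+ {suc N} p f g = trans
      (cong₂ (λ x y → p * x + (1ℚ - p) * y) (𝔼-+ p (f ∘ (inside ∷_)) (g ∘ (inside ∷_)))
                                            (𝔼-+ p (f ∘ (outside ∷_)) (g ∘ (outside ∷_))))
      (solve 6 (λ p r a b c d → p :* (a :+ b) :+ r :* (c :+ d) := p :* a :+ r :* c :+ (p :* b :+ r :* d)) refl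
        p (1ℚ - p) (𝔼 p (f ∘ (inside ∷_))) (𝔼 p (g ∘ (inside ∷_))) (𝔼 p (f ∘ (outside ∷_))) (𝔼 p (g ∘ (outside ∷_))))
      where open +-*-Solver

    𝔼-* : ∀ p c (f : Subset N → ℚ) → 𝔼 p (λ W → c * f W) ≡ c * 𝔼 p f
    𝔼-* {zero}  p c f = refl
    𝔼-* {suc N} p c f = trans
      (cong₂ (λ x y → p * x + (1ℚ - p) * y) (𝔼-* p c (f ∘ (inside ∷_))) (𝔼-* p c (f ∘ (outside ∷_))))
      (solve 5 (λ p r c a b → p :* (c :* a) :+ r :* (c :* b) := c :* (p :* a :+ r :* b)) refl
        p (1ℚ - p) c (𝔼 p (f ∘ (inside ∷_))) (𝔼 p (f ∘ (outside ∷_))))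
      where open +-*-Solver

    𝔼-const : ∀ p c → 𝔼 {N} p (λ _ → c) ≡ c
    𝔼-const {zero}  p c = refl
    𝔼-const {suc N} p c = trans (cong (λ x → p * x + (1ℚ - p) * x) (𝔼-const {N} p c))
      (solve 2 (λ p c → p :* c :+ (con 1ℚ :- p) :* c := c) refl p c)
      where open +-*-Solver

    -- An element is missed by both independent sets with probability `(1 - p)(1 - q)`. This allows
    -- one random set to be exposed in several rounds.
    𝔼-∪ : ∀ p q (f : Subset N → ℚ) → 𝔼 (p + q - p * q) f ≡ 𝔼 p (λ W → 𝔼 q (λ V → f (W ∪ V)))
    𝔼-∪ {zero}  p q f = refl
    𝔼-∪ {suc N} p q f = begin
      r * 𝔼 r f₁ + (1ℚ - r) * 𝔼 r f₀
        ≡⟨ cong₂ (λ x y → r * x + (1ℚ - r) * y) (𝔼-∪ p q f₁) (𝔼-∪ p q f₀) ⟩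
      r * A + (1ℚ - r) * B
        ≡⟨ solve 4 (λ p q A B → (p :+ q :- p :* q) :* A :+ (con 1ℚ :- (p :+ q :- p :* q)) :* B :=
             p :* (q :* A :+ (con 1ℚ :- q) :* A) :+ (con 1ℚ :- p) :* (q :* A :+ (con 1ℚ :- q) :* B)) refl p q A B ⟩
      p * (q * A + (1ℚ - q) * A) + (1ℚ - p) * (q * A + (1ℚ - q) * B)
        ≡⟨ cong₂ (λ x y → p * x + (1ℚ - p) * y) (linear F₁ F₁) (linear F₁ F₀) ⟨
      p * 𝔼 p (λ W → q * F₁ W + (1ℚ - q) * F₁ W) + (1ℚ - p) * 𝔼 p (λ W → q * F₁ W + (1ℚ - q) * F₀ W) ∎
      where
      open ≡-Reasoning
      open +-*-Solver
      r = p + q - p * q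
      f₁ = f ∘ (inside ∷_)
      f₀ = f ∘ (outside ∷_)
      F₁ F₀ : Subset N → ℚ
      F₁ W = 𝔼 q (λ V → f₁ (W ∪ V))
      F₀ W = 𝔼 q (λ V → f₀ (W ∪ V))
      A = 𝔼 p F₁
      B = 𝔼 p F₀
      linear : ∀ F G → 𝔼 p (λ W → q * F W + (1ℚ - q) * G W) ≡ q * 𝔼 p F + (1ℚ - q) * 𝔼 p G
      linear F G = trans (𝔼-+ p (λ W → q * F W) (λ W → (1ℚ - q) * G W)) (cong₂ _+_ (𝔼-* p q F) (𝔼-* p (1ℚ - q) G))

    module _ {p : ℚ} (0≤p : 0ℚ ≤ p) (p≤1 : p ≤ 1ℚ) where
      𝔼-mono : {f g : Subset N → ℚ} → (∀ W → f W ≤ g W) → 𝔼 p f ≤ 𝔼 p g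
      𝔼-mono {zero}  f≤g = f≤g []
      𝔼-mono {suc N} f≤g = ℚ.+-mono-≤ (*-monoʳ 0≤p (𝔼-mono (f≤g ∘ (inside ∷_))))
                                      (*-monoʳ (p≤q⇒0≤q-p p≤1) (𝔼-mono (f≤g ∘ (outside ∷_))))

      𝔼-nonNeg : {f : Subset N → ℚ} → (∀ W → 0ℚ ≤ f W) → 0ℚ ≤ 𝔼 p f
      𝔼-nonNeg {N} {f} 0≤f = subst (_≤ 𝔼 p f) (𝔼-const {N} p 0ℚ) (𝔼-mono 0≤f)

    Decreasing : (Subset N → ℚ) → Set
    Decreasing f = ∀ {V W} → V ⊆ W → f W ≤ f V

    -- An induction in place of a coupling: raising the density of the first element from `p` to `r`
    -- lowers the expectation by `r - p` times the gap between the branches without and with that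
    -- element, and the gap is nonnegative because `f` decreases.
    𝔼-antitone : ∀ {p r} → 0ℚ ≤ p → p ≤ r → r ≤ 1ℚ → {f : Subset N → ℚ} → Decreasing f → 𝔼 r f ≤ 𝔼 p f
    𝔼-antitone {zero}  0≤p p≤r r≤1 {f} dec = ℚ.≤-refl
    𝔼-antitone {suc N} {p} {r} 0≤p p≤r r≤1 {f} dec = begin
      r * 𝔼 r f₁ + (1ℚ - r) * 𝔼 r f₀
        ≤⟨ 0≤q-p⇒p≤q (subst (0ℚ ≤_)
             (solve 4 (λ p r A B → (r :- p) :* (B :- A) := (p :* A :+ (con 1ℚ :- p) :* B) :- (r :* A :+ (con 1ℚ :- r) :* B)) refl
               p r (𝔼 r f₁) (𝔼 r f₀))
             (0≤* (p≤q⇒0≤q-p p≤r) (p≤q⇒0≤q-p (𝔼-mono (ℚ.≤-trans 0≤p p≤r) r≤1 (λ W → dec {outside ∷ W} {inside ∷ W} (S.out⊆ S.⊆-refl)))))) ⟩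
      p * 𝔼 r f₁ + (1ℚ - p) * 𝔼 r f₀
        ≤⟨ ℚ.+-mono-≤ (*-monoʳ 0≤p (𝔼-antitone 0≤p p≤r r≤1 {f₁} (λ V⊆W → dec (S.s⊆s V⊆W))))
                      (*-monoʳ (p≤q⇒0≤q-p (ℚ.≤-trans p≤r r≤1)) (𝔼-antitone 0≤p p≤r r≤1 {f₀} (λ V⊆W → dec (S.s⊆s V⊆W)))) ⟩
      p * 𝔼 p f₁ + (1ℚ - p) * 𝔼 p f₀ ∎
      where
      open ℚ.≤-Reasoning
      open +-*-Solver
      f₁ = f ∘ (inside ∷_)
      f₀ = f ∘ (outside ∷_)

  open Expectation public

  module SubsetSum where
    private variable
      N : ℕ

    ∑⊆ : Subset N → (Subset N → ℚ) → ℚ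
    ∑⊆ []            f = f []
    ∑⊆ (inside ∷ Z)  f = ∑⊆ Z (f ∘ (inside ∷_)) + ∑⊆ Z (f ∘ (outside ∷_))
    ∑⊆ (outside ∷ Z) f = ∑⊆ Z (f ∘ (outside ∷_))

    ∑⊆-mono : ∀ (Z : Subset N) {f g} → (∀ U → f U ≤ g U) → ∑⊆ Z f ≤ ∑⊆ Z g
    ∑⊆-mono []            f≤g = f≤g []
    ∑⊆-mono (inside ∷ Z)  f≤g = ℚ.+-mono-≤ (∑⊆-mono Z (f≤g ∘ (inside ∷_))) (∑⊆-mono Z (f≤g ∘ (outside ∷_)))
    ∑⊆-mono (outside ∷ Z) f≤g = ∑⊆-mono Z (f≤g ∘ (outside ∷_))

    ∑⊆-cong : ∀ (Z : Subset N) {f g} → (∀ U → f U ≡ g U) → ∑⊆ Z f ≡ ∑⊆ Z g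
    ∑⊆-cong []            f≗g = f≗g []
    ∑⊆-cong (inside ∷ Z)  f≗g = cong₂ _+_ (∑⊆-cong Z (f≗g ∘ (inside ∷_))) (∑⊆-cong Z (f≗g ∘ (outside ∷_)))
    ∑⊆-cong (outside ∷ Z) f≗g = ∑⊆-cong Z (f≗g ∘ (outside ∷_))

    ∑⊆-+ : ∀ (Z : Subset N) f g → ∑⊆ Z (λ U → f U + g U) ≡ ∑⊆ Z f + ∑⊆ Z g
    ∑⊆-+ []            f g = refl
    ∑⊆-+ (inside ∷ Z)  f g = trans
      (cong₂ _+_ (∑⊆-+ Z (f ∘ (inside ∷_)) (g ∘ (inside ∷_))) (∑⊆-+ Z (f ∘ (outside ∷_)) (g ∘ (outside ∷_))))
      (solve 4 (λ a b c d → a :+ b :+ (c :+ d) := a :+ c :+ (b :+ d)) refl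
        (∑⊆ Z (f ∘ (inside ∷_))) (∑⊆ Z (g ∘ (inside ∷_))) (∑⊆ Z (f ∘ (outside ∷_))) (∑⊆ Z (g ∘ (outside ∷_))))
      where open +-*-Solver
    ∑⊆-+ (outside ∷ Z) f g = ∑⊆-+ Z (f ∘ (outside ∷_)) (g ∘ (outside ∷_))

    ∑⊆-* : ∀ (Z : Subset N) c f → ∑⊆ Z (λ U → c * f U) ≡ c * ∑⊆ Z f
    ∑⊆-* []            c f = refl
    ∑⊆-* (inside ∷ Z)  c f = trans (cong₂ _+_ (∑⊆-* Z c (f ∘ (inside ∷_))) (∑⊆-* Z c (f ∘ (outside ∷_))))
      (sym (ℚ.*-distribˡ-+ c (∑⊆ Z (f ∘ (inside ∷_))) (∑⊆ Z (f ∘ (outside ∷_)))))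
    ∑⊆-* (outside ∷ Z) c f = ∑⊆-* Z c (f ∘ (outside ∷_))

    ∑⊆-zero : ∀ (Z : Subset N) → ∑⊆ Z (λ _ → 0ℚ) ≡ 0ℚ
    ∑⊆-zero []            = refl
    ∑⊆-zero (inside ∷ Z)  = cong₂ _+_ (∑⊆-zero Z) (∑⊆-zero Z)
    ∑⊆-zero (outside ∷ Z) = ∑⊆-zero Z

    ∑⊆-nonNeg : ∀ (Z : Subset N) {f} → (∀ U → 0ℚ ≤ f U) → 0ℚ ≤ ∑⊆ Z f
    ∑⊆-nonNeg Z {f} 0≤f = subst (_≤ ∑⊆ Z f) (∑⊆-zero Z) (∑⊆-mono Z 0≤f)

    term≤∑⊆ : ∀ {U} (Z : Subset N) {f} → (∀ V → 0ℚ ≤ f V) → U ⊆ Z → f U ≤ ∑⊆ Z f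
    term≤∑⊆ {U = []}          []            0≤f U⊆Z = ℚ.≤-refl
    term≤∑⊆ {U = inside ∷ U}  (inside ∷ Z)  {f} 0≤f U⊆Z = subst (_≤ ∑⊆ (inside ∷ Z) f) (ℚ.+-identityʳ _)
      (ℚ.+-mono-≤ (term≤∑⊆ Z (0≤f ∘ (inside ∷_)) (S.drop-∷-⊆ U⊆Z)) (∑⊆-nonNeg Z (0≤f ∘ (outside ∷_))))
    term≤∑⊆ {U = outside ∷ U} (inside ∷ Z)  {f} 0≤f U⊆Z = subst (_≤ ∑⊆ (inside ∷ Z) f) (ℚ.+-identityˡ _)
      (ℚ.+-mono-≤ (∑⊆-nonNeg Z (0≤f ∘ (inside ∷_))) (term≤∑⊆ Z (0≤f ∘ (outside ∷_)) (S.drop-∷-⊆ U⊆Z)))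
    term≤∑⊆ {U = inside ∷ U}  (outside ∷ Z) 0≤f U⊆Z = contradiction (U⊆Z here) λ ()
    term≤∑⊆ {U = outside ∷ U} (outside ∷ Z) 0≤f U⊆Z = term≤∑⊆ Z (0≤f ∘ (outside ∷_)) (S.drop-∷-⊆ U⊆Z)

    ∑-∑⊆-swap : ∀ {A : Set} (xs : List A) (Z : Subset N) (f : A → Subset N → ℚ) →
                ∑ xs (λ x → ∑⊆ Z (f x)) ≡ ∑⊆ Z (λ U → ∑ xs (λ x → f x U))
    ∑-∑⊆-swap []       Z f = sym (∑⊆-zero Z)
    ∑-∑⊆-swap (x ∷ xs) Z f = trans (cong (∑⊆ Z (f x) +_) (∑-∑⊆-swap xs Z f))
                                   (sym (∑⊆-+ Z (f x) (λ U → ∑ xs (λ x → f x U))))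

    2ℚ : ℚ
    2ℚ = 1ℚ + 1ℚ

    0≤2 : 0ℚ ≤ 2ℚ
    0≤2 = 0≤+ 0≤1 0≤1

    -- Only subsets of both `Z` and `F` are counted. The bound is in terms of `F`, which will be a
    -- single member of bounded size, whereas `Z` is a random set of any size.
    ∑⊆-𝟙⊆ : ∀ (Z F : Subset N) → ∑⊆ Z (λ U → 𝟙 (U S.⊆? F)) ≤ 2ℚ ^ ∣ F ∣
    ∑⊆-𝟙⊆ []            []            = 𝟙≤1 ([] S.⊆? [])
    ∑⊆-𝟙⊆ (inside ∷ Z)  (inside ∷ F)  = subst (∑⊆ (inside ∷ Z) (λ U → 𝟙 (U S.⊆? inside ∷ F)) ≤_)
      (solve 1 (λ x → x :+ x := con 2ℚ :* x) refl (2ℚ ^ ∣ F ∣))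
      (ℚ.+-mono-≤
        (ℚ.≤-trans (∑⊆-mono Z (λ U → 𝟙-mono (inside ∷ U S.⊆? inside ∷ F) (U S.⊆? F) S.drop-∷-⊆)) (∑⊆-𝟙⊆ Z F))
        (ℚ.≤-trans (∑⊆-mono Z (λ U → 𝟙-mono (outside ∷ U S.⊆? inside ∷ F) (U S.⊆? F) S.drop-∷-⊆)) (∑⊆-𝟙⊆ Z F)))
      where open +-*-Solver
    ∑⊆-𝟙⊆ (inside ∷ Z)  (outside ∷ F) = subst (∑⊆ (inside ∷ Z) (λ U → 𝟙 (U S.⊆? outside ∷ F)) ≤_)
      (ℚ.+-identityˡ (2ℚ ^ ∣ F ∣))
      (ℚ.+-mono-≤
        (subst (∑⊆ Z (λ U → 𝟙 (inside ∷ U S.⊆? outside ∷ F)) ≤_) (∑⊆-zero Z)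
          (∑⊆-mono Z (λ U → 𝟙-mono {B = ⊥₀} (inside ∷ U S.⊆? outside ∷ F) (no (λ ())) (λ sub → case-out (sub here)))))
        (ℚ.≤-trans (∑⊆-mono Z (λ U → 𝟙-mono (outside ∷ U S.⊆? outside ∷ F) (U S.⊆? F) S.drop-∷-⊆)) (∑⊆-𝟙⊆ Z F)))
      where
      case-out : ∀ {n} {p : Subset n} → Fin.zero ∈ outside ∷ p → ⊥₀
      case-out ()
    ∑⊆-𝟙⊆ (outside ∷ Z) (b ∷ F)       = ℚ.≤-trans
      (∑⊆-mono Z (λ U → 𝟙-mono (outside ∷ U S.⊆? b ∷ F) (U S.⊆? F) S.drop-∷-⊆))
      (ℚ.≤-trans (∑⊆-𝟙⊆ Z F) (cons b))
      where
      open +-*-Solver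
      cons : ∀ b → 2ℚ ^ ∣ F ∣ ≤ 2ℚ ^ ∣ b ∷ F ∣
      cons outside = ℚ.≤-refl
      cons inside  = subst₂ _≤_ (ℚ.+-identityˡ _) (solve 1 (λ x → x :+ x := con 2ℚ :* x) refl (2ℚ ^ ∣ F ∣))
        (ℚ.+-monoˡ-≤ (2ℚ ^ ∣ F ∣) (0≤^ ∣ F ∣ 0≤2))

  open SubsetSum public

  -- Trading disjoint pairs of sets for nested pairs.

  module Transfer where
    private variable
      N : ℕ

    -- A disjoint pair (W , U) is traded for (W ∪ U , U): an element of U is then
    -- charged p r ≥ q instead of (1 - p) q.
    𝔼-∑⊆∁≤𝔼-∑⊆ : ∀ {p q r} → 0ℚ ≤ p → p ≤ 1ℚ → 0ℚ ≤ q → q ≤ p * r →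
      (g : Subset N → Subset N → ℚ) → (∀ Z U → 0ℚ ≤ g Z U) →
      𝔼 p (λ W → ∑⊆ (∁ W) λ U → g (W ∪ U) U * q ^ ∣ U ∣) ≤ 𝔼 p (λ Z → ∑⊆ Z λ U → g Z U * r ^ ∣ U ∣)
    𝔼-∑⊆∁≤𝔼-∑⊆ {zero}  0≤p p≤1 0≤q q≤pr g 0≤g = ℚ.≤-refl
    𝔼-∑⊆∁≤𝔼-∑⊆ {suc N} {p} {q} {r} 0≤p p≤1 0≤q q≤pr g 0≤g = begin
      p * L g₁₀ + p̄ * 𝔼 p (λ W → ∑⊆ (∁ W) (λ U → g₁₁ (W ∪ U) U * (q * q ^ ∣ U ∣)) + ∑⊆ (∁ W) (λ U → g₀₀ (W ∪ U) U * q ^ ∣ U ∣))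
        ≡⟨ cong (λ x → p * L g₁₀ + p̄ * x) (factor ∁ (λ W U → g₁₁ (W ∪ U) U) (λ W U → g₀₀ (W ∪ U) U) q) ⟩
      p * L g₁₀ + p̄ * (q * L g₁₁ + L g₀₀)
        ≡⟨ solve 6 (λ a b c p p̄ q → p :* a :+ p̄ :* (q :* b :+ c) := p̄ :* (q :* b) :+ (p :* a :+ p̄ :* c)) refl (L g₁₀) (L g₁₁) (L g₀₀) p p̄ q ⟩
      p̄ * (q * L g₁₁) + (p * L g₁₀ + p̄ * L g₀₀)
        ≤⟨ ℚ.+-mono-≤ heavy (ℚ.+-mono-≤ (*-monoʳ 0≤p (rec g₁₀ (λ _ _ → 0≤g _ _))) (*-monoʳ (p≤q⇒0≤q-p p≤1) (rec g₀₀ (λ _ _ → 0≤g _ _)))) ⟩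
      p * (r * R g₁₁) + (p * R g₁₀ + p̄ * R g₀₀)
        ≡⟨ solve 6 (λ a b c p p̄ r → p :* (r :* b) :+ (p :* a :+ p̄ :* c) := p :* (r :* b :+ a) :+ p̄ :* c) refl (R g₁₀) (R g₁₁) (R g₀₀) p p̄ r ⟩
      p * (r * R g₁₁ + R g₁₀) + p̄ * R g₀₀
        ≡⟨ cong (λ x → p * x + p̄ * R g₀₀) (factor (λ Z → Z) g₁₁ g₁₀ r) ⟨
      p * 𝔼 p (λ Z → ∑⊆ Z (λ U → g₁₁ Z U * (r * r ^ ∣ U ∣)) + ∑⊆ Z (λ U → g₁₀ Z U * r ^ ∣ U ∣)) + p̄ * R g₀₀ ∎
      where
      open ℚ.≤-Reasoning
      open +-*-Solver
      p̄ = 1ℚ - p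
      -- The indices record whether the first element lies in `Z` and in `U`. There is no `g₀₁`,
      -- because `U` is contained in `Z` on both sides.
      g₁₁ g₁₀ g₀₀ : Subset N → Subset N → ℚ
      g₁₁ Z U = g (inside ∷ Z) (inside ∷ U)
      g₁₀ Z U = g (inside ∷ Z) (outside ∷ U)
      g₀₀ Z U = g (outside ∷ Z) (outside ∷ U)
      L R : (Subset N → Subset N → ℚ) → ℚ
      L g = 𝔼 p (λ W → ∑⊆ (∁ W) λ U → g (W ∪ U) U * q ^ ∣ U ∣)
      R g = 𝔼 p (λ Z → ∑⊆ Z λ U → g Z U * r ^ ∣ U ∣)
      rec : ∀ g → (∀ Z U → 0ℚ ≤ g Z U) → L g ≤ R g
      rec = 𝔼-∑⊆∁≤𝔼-∑⊆ 0≤p p≤1 0≤q q≤pr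
      factor : ∀ (Φ : Subset N → Subset N) (f h : Subset N → Subset N → ℚ) x →
        𝔼 p (λ W → ∑⊆ (Φ W) (λ U → f W U * (x * x ^ ∣ U ∣)) + ∑⊆ (Φ W) (λ U → h W U * x ^ ∣ U ∣)) ≡
        x * 𝔼 p (λ W → ∑⊆ (Φ W) (λ U → f W U * x ^ ∣ U ∣)) + 𝔼 p (λ W → ∑⊆ (Φ W) (λ U → h W U * x ^ ∣ U ∣))
      factor Φ f h x = trans
        (𝔼-cong p (λ W → cong (_+ ∑⊆ (Φ W) (λ U → h W U * x ^ ∣ U ∣))
          (trans (∑⊆-cong (Φ W) (λ U → solve 3 (λ a x y → a :* (x :* y) := x :* (a :* y)) refl (f W U) x (x ^ ∣ U ∣)))
                 (∑⊆-* (Φ W) x (λ U → f W U * x ^ ∣ U ∣)))))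
        (trans (𝔼-+ p (λ W → x * ∑⊆ (Φ W) (λ U → f W U * x ^ ∣ U ∣)) (λ W → ∑⊆ (Φ W) (λ U → h W U * x ^ ∣ U ∣)))
               (cong (_+ 𝔼 p (λ W → ∑⊆ (Φ W) (λ U → h W U * x ^ ∣ U ∣))) (𝔼-* p x (λ W → ∑⊆ (Φ W) (λ U → f W U * x ^ ∣ U ∣)))))
      0≤L : 0ℚ ≤ L g₁₁
      0≤L = 𝔼-nonNeg 0≤p p≤1 (λ W → ∑⊆-nonNeg (∁ W) (λ U → 0≤* (0≤g (inside ∷ (W ∪ U)) (inside ∷ U)) (0≤^ ∣ U ∣ 0≤q)))
      heavy : p̄ * (q * L g₁₁) ≤ p * (r * R g₁₁)
      heavy = begin
        p̄ * (q * L g₁₁)   ≤⟨ *-monoˡ (0≤* 0≤q 0≤L) (subst (p̄ ≤_) (ℚ.+-identityʳ 1ℚ) (ℚ.+-monoʳ-≤ 1ℚ (ℚ.neg-antimono-≤ 0≤p))) ⟩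
        1ℚ * (q * L g₁₁)  ≡⟨ ℚ.*-identityˡ (q * L g₁₁) ⟩
        q * L g₁₁         ≤⟨ *-monoˡ 0≤L q≤pr ⟩
        p * r * L g₁₁     ≤⟨ *-monoʳ (ℚ.≤-trans 0≤q q≤pr) (rec g₁₁ (λ _ _ → 0≤g _ _)) ⟩
        p * r * R g₁₁     ≡⟨ ℚ.*-assoc p r (R g₁₁) ⟩
        p * (r * R g₁₁)   ∎

  open Transfer public

  -- Fragments of the members of a family.

  module Fragments where
    private variable
      N : ℕ

    -- The default ⊥ is irrelevant: `firstFit` is used where some member fits.
    firstFit : List (Subset N) → Subset N → Subset N
    firstFit []      Z = ⊥
    firstFit (S ∷ H) Z = if does (S S.⊆? Z) then S else firstFit H Z

    firstFit-∈ : ∀ {H : List (Subset N)} {Z} → Any (_⊆ Z) H → firstFit H Z ∈ₗ H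
    firstFit-∈ {H = S ∷ H} {Z} some with S S.⊆? Z
    firstFit-∈ some         | yes _  = here refl
    firstFit-∈ (here S⊆Z)   | no S⊈Z = contradiction (λ {x} → S⊆Z {x}) S⊈Z
    firstFit-∈ (there some) | no _   = there (firstFit-∈ some)

    firstFit-⊆ : ∀ {H : List (Subset N)} {Z} → Any (_⊆ Z) H → firstFit H Z ⊆ Z
    firstFit-⊆ {H = S ∷ H} {Z} some with S S.⊆? Z
    firstFit-⊆ some         | yes S⊆Z = S⊆Z
    firstFit-⊆ (here S⊆Z)   | no S⊈Z  = contradiction (λ {x} → S⊆Z {x}) S⊈Z
    firstFit-⊆ (there some) | no _    = firstFit-⊆ some

    -- Members before the chosen one do not fit into `Z`, hence not into the smaller `Y` either,
    -- while the chosen one still fits.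
    firstFit-stable : ∀ {H : List (Subset N)} {Y Z} → Any (_⊆ Z) H → firstFit H Z ⊆ Y → Y ⊆ Z → firstFit H Y ≡ firstFit H Z
    firstFit-stable {H = S ∷ H} {Y} {Z} some F⊆Y Y⊆Z with S S.⊆? Z | S S.⊆? Y
    firstFit-stable some F⊆Y Y⊆Z         | yes _   | yes _   = refl
    firstFit-stable some F⊆Y Y⊆Z         | yes _   | no S⊈Y  = contradiction (λ {x} → F⊆Y {x}) S⊈Y
    firstFit-stable some F⊆Y Y⊆Z         | no S⊈Z  | yes S⊆Y = contradiction (λ {x} → S.⊆-trans S⊆Y Y⊆Z {x}) S⊈Z
    firstFit-stable (here S⊆Z) F⊆Y Y⊆Z   | no S⊈Z  | no _    = contradiction (λ {x} → S⊆Z {x}) S⊈Z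
    firstFit-stable (there some) F⊆Y Y⊆Z | no _    | no _    = firstFit-stable some F⊆Y Y⊆Z

    ∣firstFit∣≤ : ∀ {H : List (Subset N)} {a} → All (λ S → ∣ S ∣ ℕ.≤ a) H → ∀ Z → ∣ firstFit H Z ∣ ℕ.≤ a
    ∣firstFit∣≤ {N} {[]} {a} [] Z = subst (ℕ._≤ a) (sym (S.∣⊥∣≡0 N)) z≤n
    ∣firstFit∣≤ {H = S ∷ H} (S≤a ∷ H≤a) Z with S S.⊆? Z
    ... | yes _ = S≤a
    ... | no _  = ∣firstFit∣≤ H≤a Z

    -- A smallest possible remainder outside `W` would be the customary choice. The first member
    -- that fits serves as well and requires no minimisation: recovering it from `W` together with
    -- the fragment needs only `firstFit-stable`.
    fragment : List (Subset N) → Subset N → Subset N → Subset N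
    fragment H W S = firstFit H (W ∪ S) ─ W

    private
      ∈─⁻ : ∀ (p q : Subset N) {x} → x ∈ p ─ q → x ∈ p × x ∈ ∁ q
      ∈─⁻ p q x∈ = S.p─q⊆p p q x∈ , S.x∉p⇒x∈∁p (λ x∈q → disjoint p q x∈ x∈q)
        where
        disjoint : ∀ {N} (p q : Subset N) {x} → x ∈ p ─ q → x ∈ q → ⊥₀
        disjoint (_ ∷ _) (inside ∷ _)  () here
        disjoint (_ ∷ p) (inside ∷ q)  (there x∈) (there x∈q) = disjoint p q x∈ x∈q
        disjoint (_ ∷ p) (outside ∷ q) (there x∈) (there x∈q) = disjoint p q x∈ x∈q

    module _ {H : List (Subset N)} (W : Subset N) where
      fragment⊆∁ : ∀ S → fragment H W S ⊆ ∁ W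
      fragment⊆∁ S = proj₂ ∘ ∈─⁻ (firstFit H (W ∪ S)) W

      firstFit⊆∪fragment : ∀ S → firstFit H (W ∪ S) ⊆ W ∪ fragment H W S
      firstFit⊆∪fragment S {x} x∈ with x S.∈? W
      ... | yes x∈W = S.x∈p∪q⁺ (inj₁ x∈W)
      ... | no x∉W  = S.x∈p∪q⁺ (inj₂ (S.x∈p∧x∉q⇒x∈p─q x∈ x∉W))

      module _ {S : Subset N} (S∈H : S ∈ₗ H) where
        fits : Any (_⊆ W ∪ S) H
        fits = Any.map (λ { refl → λ {x} → S.q⊆p∪q W S {x} }) S∈H

        fragment⊆ : fragment H W S ⊆ S
        fragment⊆ x∈ with ∈─⁻ (firstFit H (W ∪ S)) W x∈
        ... | x∈F , x∈∁W with S.x∈p∪q⁻ W S (firstFit-⊆ fits x∈F)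
        ...   | inj₁ x∈W = contradiction x∈W (S.x∈∁p⇒x∉p x∈∁W)
        ...   | inj₂ x∈S = x∈S

        -- W ∪ T determines a small set containing the fragment T.
        fragment⊆firstFit : fragment H W S ⊆ firstFit H (W ∪ fragment H W S)
        fragment⊆firstFit = subst (fragment H W S ⊆_)
          (sym (firstFit-stable {Y = W ∪ fragment H W S} fits (firstFit⊆∪fragment S) (λ x∈ → S.x∈p∪q⁺ (Sum.map₂ fragment⊆ (S.x∈p∪q⁻ W (fragment H W S) x∈)))))
          (S.p─q⊆p (firstFit H (W ∪ S)) W)

  open Fragments public

  -- One round of exposure for a spread family.

  module SpreadLemma where
    private variable
      N : ℕ

    size : List (Subset N) → ℚ
    size H = ∑ H (λ _ → 1ℚ)

    -- `M` is a fixed number rather than the current `size H`, so that members may be discarded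
    -- without renormalising. As `H` is a list, equal fragments of different members are counted
    -- separately.
    IsSpread : ℚ → ℚ → List (Subset N) → Set
    IsSpread M q H = ∀ U → ∑ H (λ S → 𝟙 (U S.⊆? S)) ≤ M * q ^ ∣ U ∣

    avoids? : (H : List (Subset N)) (W : Subset N) → Dec (¬ Any (_⊆ W) H)
    avoids? H W = ¬? (any? (S._⊆? W) H)

    avoids-decreasing : ∀ (H : List (Subset N)) → Decreasing (𝟙 ∘ avoids? H)
    avoids-decreasing H {V} {W} V⊆W = 𝟙-mono (avoids? H W) (avoids? H V)
      (λ none some → none (Any.map (λ S⊆V {x} x∈S → V⊆W (S⊆V {x} x∈S)) some))

    module _ {H : List (Subset N)} {M q : ℚ} (0≤M : 0ℚ ≤ M) (0≤q : 0ℚ ≤ q) (spread : IsSpread M q H)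
             {p r : ℚ} (0≤p : 0ℚ ≤ p) (p≤1 : p ≤ 1ℚ) (0≤r : 0ℚ ≤ r) (r≤1 : r ≤ 1ℚ) (q≤pr : q ≤ p * r)
             {a : ℕ} (H≤a : All (λ S → ∣ S ∣ ℕ.≤ a) H) (b : ℕ) where
      smallFragments : Subset N → List (Subset N)
      smallFragments W = filter (λ T → ∣ T ∣ ℕ.≤? b) (map (fragment H W) H)

      large : Subset N → ℚ
      large W = ∑ H (λ S → 𝟙 (b ℕ.<? ∣ fragment H W S ∣))

      size-smallFragments : ∀ W → size H ≤ size (smallFragments W) + large W
      size-smallFragments W = begin
        size H
          ≤⟨ ∑-mono H (λ {S} _ → trichotomy (fragment H W S)) ⟩
        ∑ H (λ S → 𝟙 (∣ fragment H W S ∣ ℕ.≤? b) * 1ℚ + 𝟙 (b ℕ.<? ∣ fragment H W S ∣))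
          ≡⟨ ∑-+ H (λ S → 𝟙 (∣ fragment H W S ∣ ℕ.≤? b) * 1ℚ) (λ S → 𝟙 (b ℕ.<? ∣ fragment H W S ∣)) ⟩
        ∑ H (λ S → 𝟙 (∣ fragment H W S ∣ ℕ.≤? b) * 1ℚ) + large W
          ≡⟨ cong (_+ large W) (∑-map H (fragment H W) (λ T → 𝟙 (∣ T ∣ ℕ.≤? b) * 1ℚ)) ⟨
        ∑ (map (fragment H W) H) (λ T → 𝟙 (∣ T ∣ ℕ.≤? b) * 1ℚ) + large W
          ≡⟨ cong (_+ large W) (∑-filter (λ T → ∣ T ∣ ℕ.≤? b) (map (fragment H W) H) (λ _ → 1ℚ)) ⟨
        size (smallFragments W) + large W ∎
        where
        open ℚ.≤-Reasoning
        trichotomy : ∀ T → 1ℚ ≤ 𝟙 (∣ T ∣ ℕ.≤? b) * 1ℚ + 𝟙 (b ℕ.<? ∣ T ∣)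
        trichotomy T = 𝟙-cover (∣ T ∣ ℕ.≤? b) (b ℕ.<? ∣ T ∣) ℕ.≰⇒>

      -- A fragment lies in the member that it replaces, so a set inside the fragment lies inside
      -- that member.
      smallFragments-spread : ∀ W → IsSpread M q (smallFragments W)
      smallFragments-spread W U = ℚ.≤-trans
        (begin
          ∑ (smallFragments W) (λ T → 𝟙 (U S.⊆? T))
            ≡⟨ ∑-filter (λ T → ∣ T ∣ ℕ.≤? b) (map (fragment H W) H) (λ T → 𝟙 (U S.⊆? T)) ⟩
          ∑ (map (fragment H W) H) (λ T → 𝟙 (∣ T ∣ ℕ.≤? b) * 𝟙 (U S.⊆? T))
            ≡⟨ ∑-map H (fragment H W) (λ T → 𝟙 (∣ T ∣ ℕ.≤? b) * 𝟙 (U S.⊆? T)) ⟩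
          ∑ H (λ S → 𝟙 (∣ fragment H W S ∣ ℕ.≤? b) * 𝟙 (U S.⊆? fragment H W S))
            ≤⟨ ∑-mono H (λ {S} S∈H → subst (𝟙 (∣ fragment H W S ∣ ℕ.≤? b) * 𝟙 (U S.⊆? fragment H W S) ≤_) (ℚ.*-identityˡ (𝟙 (U S.⊆? S)))
                 (ℚ.≤-trans (*-monoˡ (0≤𝟙 (U S.⊆? fragment H W S)) (𝟙≤1 (∣ fragment H W S ∣ ℕ.≤? b)))
                   (*-monoʳ 0≤1 (𝟙-mono (U S.⊆? fragment H W S) (U S.⊆? S) (λ U⊆ {x} x∈ → fragment⊆ W S∈H (U⊆ {x} x∈)))))) ⟩
          ∑ H (λ S → 𝟙 (U S.⊆? S)) ∎)
        (spread U)
        where open ℚ.≤-Reasoning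

      -- If `V` contains a fragment, then `W ∪ V` contains the whole member from which the fragment
      -- was cut.
      avoids-smallFragments : ∀ W V → 𝟙 (avoids? H (W ∪ V)) ≤ 𝟙 (avoids? (smallFragments W) V)
      avoids-smallFragments W V = 𝟙-mono (avoids? H (W ∪ V)) (avoids? (smallFragments W) V) (λ none some → none (lift some))
        where
        lift : Any (_⊆ V) (smallFragments W) → Any (_⊆ W ∪ V) H
        lift some with find (Any.map⁻ (Any.filter⁻ (λ T → ∣ T ∣ ℕ.≤? b) some))
        ... | S , S∈H , T⊆V = lose (firstFit-∈ (fits W S∈H))
          (λ x∈F → S.x∈p∪q⁺ (Sum.map₂ T⊆V (S.x∈p∪q⁻ W (fragment H W S) (firstFit⊆∪fragment {H = H} W S x∈F))))

      -- A large fragment is a set `U` disjoint from `W` that lies in `S` and in the first member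
      -- within `W ∪ U`. Spread allows at most `M q^|U|` members `S` for each `U`. After the
      -- transfer to `Z = W ∪ U`, the set `U` is one of at most `2^a` subsets of the first member
      -- within `Z`, and each has weight at most `r^(b+1)`.
      𝔼-large : 𝔼 p large ≤ M * (2ℚ ^ a * r ^ suc b)
      𝔼-large = begin
        𝔼 p large
          ≤⟨ 𝔼-mono 0≤p p≤1 large≤ ⟩
        𝔼 p (λ W → ∑⊆ (∁ W) λ U → g (W ∪ U) U * q ^ ∣ U ∣)
          ≤⟨ 𝔼-∑⊆∁≤𝔼-∑⊆ 0≤p p≤1 0≤q q≤pr g 0≤g ⟩
        𝔼 p (λ Z → ∑⊆ Z λ U → g Z U * r ^ ∣ U ∣)
          ≤⟨ 𝔼-mono 0≤p p≤1 few ⟩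
        𝔼 {N} p (λ _ → M * (2ℚ ^ a * r ^ suc b))
          ≡⟨ 𝔼-const {N} p _ ⟩
        M * (2ℚ ^ a * r ^ suc b) ∎
        where
        open ℚ.≤-Reasoning
        open +-*-Solver
        good? : (Z U : Subset N) → Dec (U ⊆ firstFit H Z × b ℕ.< ∣ U ∣)
        good? Z U = U S.⊆? firstFit H Z ×-dec b ℕ.<? ∣ U ∣
        g : Subset N → Subset N → ℚ
        g Z U = M * 𝟙 (good? Z U)
        0≤g : ∀ Z U → 0ℚ ≤ g Z U
        0≤g Z U = 0≤* 0≤M (0≤𝟙 (good? Z U))
        single : ∀ W {S} → S ∈ₗ H → 𝟙 (b ℕ.<? ∣ fragment H W S ∣) ≤ ∑⊆ (∁ W) (λ U → 𝟙 (good? (W ∪ U) U) * 𝟙 (U S.⊆? S))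
        single W {S} S∈H = 𝟙≤ (b ℕ.<? ∣ T ∣) (∑⊆-nonNeg (∁ W) 0≤term) (λ b<T →
          subst (_≤ ∑⊆ (∁ W) (λ U → 𝟙 (good? (W ∪ U) U) * 𝟙 (U S.⊆? S)))
            (trans (cong₂ _*_ (𝟙-yes (good? (W ∪ T) T) ((λ {x} → fragment⊆firstFit W S∈H {x}) , b<T)) (𝟙-yes (T S.⊆? S) (fragment⊆ W S∈H)))
                   (ℚ.*-identityˡ 1ℚ))
            (term≤∑⊆ {U = T} (∁ W) 0≤term (fragment⊆∁ {H = H} W S)))
          where
          T = fragment H W S
          0≤term : ∀ U → 0ℚ ≤ 𝟙 (good? (W ∪ U) U) * 𝟙 (U S.⊆? S)
          0≤term U = 0≤* (0≤𝟙 (good? (W ∪ U) U)) (0≤𝟙 (U S.⊆? S))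
        large≤ : ∀ W → large W ≤ ∑⊆ (∁ W) λ U → g (W ∪ U) U * q ^ ∣ U ∣
        large≤ W = begin
          large W
            ≤⟨ ∑-mono H (single W) ⟩
          ∑ H (λ S → ∑⊆ (∁ W) (λ U → 𝟙 (good? (W ∪ U) U) * 𝟙 (U S.⊆? S)))
            ≡⟨ ∑-∑⊆-swap H (∁ W) (λ S U → 𝟙 (good? (W ∪ U) U) * 𝟙 (U S.⊆? S)) ⟩
          ∑⊆ (∁ W) (λ U → ∑ H (λ S → 𝟙 (good? (W ∪ U) U) * 𝟙 (U S.⊆? S)))
            ≤⟨ ∑⊆-mono (∁ W) (λ U → begin
                 ∑ H (λ S → 𝟙 (good? (W ∪ U) U) * 𝟙 (U S.⊆? S))  ≡⟨ ∑-* H (𝟙 (good? (W ∪ U) U)) (λ S → 𝟙 (U S.⊆? S)) ⟩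
                 𝟙 (good? (W ∪ U) U) * ∑ H (λ S → 𝟙 (U S.⊆? S))  ≤⟨ *-monoʳ (0≤𝟙 (good? (W ∪ U) U)) (spread U) ⟩
                 𝟙 (good? (W ∪ U) U) * (M * q ^ ∣ U ∣)           ≡⟨ solve 3 (λ x y z → x :* (y :* z) := y :* x :* z) refl (𝟙 (good? (W ∪ U) U)) M (q ^ ∣ U ∣) ⟩
                 g (W ∪ U) U * q ^ ∣ U ∣                         ∎) ⟩
          ∑⊆ (∁ W) (λ U → g (W ∪ U) U * q ^ ∣ U ∣) ∎
        2^-mono : ∀ {m n} → m ℕ.≤ n → 2ℚ ^ m ≤ 2ℚ ^ n
        2^-mono {n = zero}  z≤n = ℚ.≤-refl
        2^-mono {n = suc n} z≤n = ℚ.≤-trans (2^-mono {n = n} z≤n)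
          (subst (_≤ 2ℚ * 2ℚ ^ n) (ℚ.*-identityˡ (2ℚ ^ n)) (*-monoˡ (0≤^ n 0≤2) (subst (_≤ 2ℚ) (ℚ.+-identityʳ 1ℚ) (ℚ.+-monoʳ-≤ 1ℚ 0≤1))))
        2^-mono (s≤s m≤n) = *-monoʳ 0≤2 (2^-mono m≤n)
        few : ∀ Z → ∑⊆ Z (λ U → g Z U * r ^ ∣ U ∣) ≤ M * (2ℚ ^ a * r ^ suc b)
        few Z = begin
          ∑⊆ Z (λ U → g Z U * r ^ ∣ U ∣)
            ≤⟨ ∑⊆-mono Z (λ U → subst₂ _≤_ (sym (ℚ.*-assoc M (𝟙 (good? Z U)) (r ^ ∣ U ∣)))
                 (solve 3 (λ x y z → x :* (y :* z) := x :* z :* y) refl M (𝟙 (U S.⊆? firstFit H Z)) (r ^ suc b))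
                 (*-monoʳ 0≤M (𝟙-×-≤ (U S.⊆? firstFit H Z) (b ℕ.<? ∣ U ∣) (0≤^ (suc b) 0≤r) (^-anti 0≤r r≤1)))) ⟩
          ∑⊆ Z (λ U → M * r ^ suc b * 𝟙 (U S.⊆? firstFit H Z))
            ≡⟨ ∑⊆-* Z (M * r ^ suc b) (λ U → 𝟙 (U S.⊆? firstFit H Z)) ⟩
          M * r ^ suc b * ∑⊆ Z (λ U → 𝟙 (U S.⊆? firstFit H Z))
            ≤⟨ *-monoʳ (0≤* 0≤M (0≤^ (suc b) 0≤r)) (ℚ.≤-trans (∑⊆-𝟙⊆ Z (firstFit H Z)) (2^-mono (∣firstFit∣≤ H≤a Z))) ⟩
          M * r ^ suc b * 2ℚ ^ a
            ≡⟨ solve 3 (λ x y z → x :* y :* z := x :* (z :* y)) refl M (r ^ suc b) (2ℚ ^ a) ⟩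
          M * (2ℚ ^ a * r ^ suc b) ∎

      -- Multiplying the failure probability by the number of members makes the loss additive: each
      -- discarded member adds at most 1, so `𝔼-large` enters directly, without Markov's inequality
      -- or any conditioning on a good `W`.
      round : ∀ {p′ δ} → 0ℚ ≤ p′ → p′ ≤ 1ℚ →
        (∀ H′ → IsSpread M q H′ → All (λ S → ∣ S ∣ ℕ.≤ b) H′ → size H′ * 𝔼 p′ (𝟙 ∘ avoids? H′) ≤ δ) →
        size H * 𝔼 (p + p′ - p * p′) (𝟙 ∘ avoids? H) ≤ δ + M * (2ℚ ^ a * r ^ suc b)
      round {p′} {δ} 0≤p′ p′≤1 rest = begin
        size H * 𝔼 (p + p′ - p * p′) (𝟙 ∘ avoids? H)
          ≡⟨ cong (size H *_) (𝔼-∪ p p′ (𝟙 ∘ avoids? H)) ⟩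
        size H * 𝔼 p (λ W → 𝔼 p′ (λ V → 𝟙 (avoids? H (W ∪ V))))
          ≡⟨ 𝔼-* p (size H) (λ W → 𝔼 p′ (λ V → 𝟙 (avoids? H (W ∪ V)))) ⟨
        𝔼 p (λ W → size H * 𝔼 p′ (λ V → 𝟙 (avoids? H (W ∪ V))))
          ≤⟨ 𝔼-mono 0≤p p≤1 conditional ⟩
        𝔼 p (λ W → δ + large W)
          ≡⟨ 𝔼-+ p (λ _ → δ) large ⟩
        𝔼 {N} p (λ _ → δ) + 𝔼 p large
          ≤⟨ ℚ.+-mono-≤ (ℚ.≤-reflexive (𝔼-const {N} p δ)) 𝔼-large ⟩
        δ + M * (2ℚ ^ a * r ^ suc b) ∎
        where
        open ℚ.≤-Reasoning
        conditional : ∀ W → size H * 𝔼 p′ (λ V → 𝟙 (avoids? H (W ∪ V))) ≤ δ + large W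
        conditional W = begin
          size H * X
            ≤⟨ *-monoˡ (𝔼-nonNeg 0≤p′ p′≤1 (λ V → 0≤𝟙 (avoids? H (W ∪ V)))) (size-smallFragments W) ⟩
          (size (smallFragments W) + large W) * X
            ≡⟨ ℚ.*-distribʳ-+ X (size (smallFragments W)) (large W) ⟩
          size (smallFragments W) * X + large W * X
            ≤⟨ ℚ.+-mono-≤
                 (ℚ.≤-trans (*-monoʳ (∑-nonNeg (smallFragments W) (λ _ → 0≤1)) (𝔼-mono 0≤p′ p′≤1 (avoids-smallFragments W)))
                   (rest (smallFragments W) (smallFragments-spread W) (All.all-filter (λ T → ∣ T ∣ ℕ.≤? b) (map (fragment H W) H))))
                 (*-monoʳ (∑-nonNeg H (λ S → 0≤𝟙 (b ℕ.<? ∣ fragment H W S ∣)))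
                   (ℚ.≤-trans (𝔼-mono 0≤p′ p′≤1 (λ V → 𝟙≤1 (avoids? H (W ∪ V)))) (ℚ.≤-reflexive (𝔼-const {N} p′ 1ℚ)))) ⟩
          δ + large W * 1ℚ
            ≡⟨ cong (δ +_) (ℚ.*-identityʳ (large W)) ⟩
          δ + large W ∎
          where X = 𝔼 p′ (λ V → 𝟙 (avoids? H (W ∪ V)))

  open SpreadLemma public

  -- Iterating the rounds.

  module Rounds where
    private variable
      N : ℕ

    -- A member of size `2b` has `4^b` subsets; the weight `1/8` per element of a fragment beats
    -- this count and leaves `2^-b`. It amounts to rounds of density `8q`.
    ⅛ : ℚ
    ⅛ = ½ * (½ * ½)

    0≤½ : 0ℚ ≤ ½
    0≤½ = ℚ.nonNegative⁻¹ ½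

    ½≤1 : ½ ≤ 1ℚ
    ½≤1 = subst (_≤ 1ℚ) (ℚ.+-identityˡ ½) (ℚ.+-monoˡ-≤ ½ 0≤½)

    0≤⅛ : 0ℚ ≤ ⅛
    0≤⅛ = 0≤* 0≤½ (0≤* 0≤½ 0≤½)

    ⅛≤½ : ⅛ ≤ ½
    ⅛≤½ = ℚ.≤-trans (*-monoʳ 0≤½ (ℚ.≤-trans (*-monoʳ 0≤½ ½≤1) (ℚ.≤-trans (*-monoˡ 0≤1 ½≤1) (ℚ.≤-reflexive (ℚ.*-identityˡ 1ℚ)))))
                    (ℚ.≤-reflexive (ℚ.*-identityʳ ½))

    4^k⅛^k≡½^k : ∀ k → 2ℚ ^ (k ℕ.+ k) * ⅛ ^ k ≡ ½ ^ k
    4^k⅛^k≡½^k zero    = ℚ.*-identityˡ 1ℚ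
    4^k⅛^k≡½^k (suc k) = begin
      2ℚ ^ (suc k ℕ.+ suc k) * (⅛ * ⅛ ^ k)    ≡⟨ cong (λ j → 2ℚ ^ suc j * (⅛ * ⅛ ^ k)) (ℕ.+-suc k k) ⟩
      2ℚ * (2ℚ * 2ℚ ^ (k ℕ.+ k)) * (⅛ * ⅛ ^ k) ≡⟨ solve 2 (λ x y → con 2ℚ :* (con 2ℚ :* x) :* (con ⅛ :* y) := con ½ :* (x :* y)) refl (2ℚ ^ (k ℕ.+ k)) (⅛ ^ k) ⟩
      ½ * (2ℚ ^ (k ℕ.+ k) * ⅛ ^ k)            ≡⟨ cong (½ *_) (4^k⅛^k≡½^k k) ⟩
      ½ * ½ ^ k                               ∎
      where
      open ≡-Reasoning
      open +-*-Solver

    n≤2^n : ∀ n → n ℕ.≤ 2 ℕ.^ n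
    n≤2^n zero    = z≤n
    n≤2^n (suc n) = ℕ.+-mono-≤ (ℕ.m^n>0 2 n) (subst (n ℕ.≤_) (sym (ℕ.+-identityʳ (2 ℕ.^ n))) (n≤2^n n))

    -- Of the true decay `½ ^ (2 ^ i)` only `½ ^ i` is kept, which suffices for a geometric series.
    round-cost : ∀ i → 2ℚ ^ (2 ℕ.^ suc i) * ⅛ ^ suc (2 ℕ.^ i) ≤ ½ ^ i
    round-cost i = begin
      2ℚ ^ (2 ℕ.^ suc i) * ⅛ ^ suc k  ≤⟨ *-monoʳ (0≤^ (2 ℕ.^ suc i) 0≤2) (^-anti 0≤⅛ (ℚ.≤-trans ⅛≤½ ½≤1) (ℕ.n≤1+n k)) ⟩
      2ℚ ^ (2 ℕ.^ suc i) * ⅛ ^ k      ≡⟨ cong (λ j → 2ℚ ^ (k ℕ.+ j) * ⅛ ^ k) (ℕ.+-identityʳ k) ⟩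
      2ℚ ^ (k ℕ.+ k) * ⅛ ^ k          ≡⟨ 4^k⅛^k≡½^k k ⟩
      ½ ^ k                           ≤⟨ ^-anti 0≤½ ½≤1 (n≤2^n i) ⟩
      ½ ^ i                           ∎
      where
      open ℚ.≤-Reasoning
      k = 2 ℕ.^ i

    -- The empty set is contained in everything, so a nonempty `H` cannot be avoided. If all members
    -- were discarded, avoidance is certain but the factor `size H` vanishes.
    empties-unavoidable : ∀ (H : List (Subset N)) → All (λ S → ∣ S ∣ ℕ.≤ 0) H → size H * 𝔼 0ℚ (𝟙 ∘ avoids? H) ≤ 0ℚ
    empties-unavoidable {N} []      [] = ℚ.≤-reflexive (ℚ.*-zeroˡ (𝔼 {N} 0ℚ (𝟙 ∘ avoids? [])))
    empties-unavoidable {N} (S ∷ H) (∣S∣≤0 ∷ _) = ℚ.≤-trans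
      (*-monoʳ (∑-nonNeg (S ∷ H) (λ _ → 0≤1)) (𝔼-mono ℚ.≤-refl 0≤1 (λ W → 𝟙-mono {B = ⊥₀} (avoids? (S ∷ H) W) (no (λ ())) (λ none → none (here (empty {W}))))))
      (ℚ.≤-reflexive (trans (cong (size (S ∷ H) *_) (𝔼-const {N} 0ℚ 0ℚ)) (ℚ.*-zeroʳ (size (S ∷ H)))))
      where
      0<∣_∣ : ∀ {N} {U : Subset N} {x} → x ∈ U → 0 ℕ.< ∣ U ∣
      0<∣_∣ {U = U} {x} x∈U = subst (ℕ._≤ ∣ U ∣) (S.∣⁅x⁆∣≡1 x) (S.p⊆q⇒∣p∣≤∣q∣ (λ y∈ → subst (_∈ U) (sym (S.x∈⁅y⁆⇒x≡y x y∈)) x∈U))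
      empty : ∀ {W} → S ⊆ W
      empty x∈S = contradiction (ℕ.≤-trans 0<∣ x∈S ∣ ∣S∣≤0) λ ()

    density : ℚ → ℚ → ℕ → ℚ
    density p p₀ zero    = p₀
    density p p₀ (suc d) = p + density p p₀ d

    module _ {M q p p₀ r₀ : ℚ} (0≤M : 0ℚ ≤ M) (0≤q : 0ℚ ≤ q)
             (0≤p : 0ℚ ≤ p) (q≤p⅛ : q ≤ p * ⅛)
             (0≤p₀ : 0ℚ ≤ p₀) (0≤r₀ : 0ℚ ≤ r₀) (r₀≤1 : r₀ ≤ 1ℚ) (q≤p₀r₀ : q ≤ p₀ * r₀) (j : ℕ) where
      0≤density : ∀ d → 0ℚ ≤ density p p₀ d
      0≤density zero    = 0≤p₀
      0≤density (suc d) = 0≤+ 0≤p (0≤density d)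

      -- The factor `2 - 2 · ½^d` is the sum of `½^i` over `i < d`, so the second summand collects
      -- the costs of the `d` halvings. The first summand is the cost of the last set.
      rounds : ∀ d {H : List (Subset N)} → IsSpread M q H → All (λ S → ∣ S ∣ ℕ.≤ 2 ℕ.^ (d ℕ.+ j)) H → density p p₀ d ≤ 1ℚ →
               size H * 𝔼 (density p p₀ d) (𝟙 ∘ avoids? H) ≤ M * (2ℚ ^ (2 ℕ.^ j) * r₀ + ½ ^ j * (2ℚ - 2ℚ * ½ ^ d))
      rounds zero {H} spread H≤ p₀≤1 = subst₂ _≤_
        (cong (λ x → size H * 𝔼 x (𝟙 ∘ avoids? H)) (solve 1 (λ p → p :+ con 0ℚ :- p :* con 0ℚ := p) refl p₀))
        (solve 4 (λ m x r y → con 0ℚ :+ m :* (x :* (r :* con 1ℚ)) := m :* (x :* r :+ y :* (con 2ℚ :- con 2ℚ :* con 1ℚ))) refl M (2ℚ ^ (2 ℕ.^ j)) r₀ (½ ^ j))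
        -- With `b = 0` every nonempty fragment is large, and with `p′ = 0` nothing further is
        -- exposed. The price is `2^(2^j)` times only the first power of `r₀`.
        (round 0≤M 0≤q spread 0≤p₀ p₀≤1 0≤r₀ r₀≤1 q≤p₀r₀ H≤ 0 ℚ.≤-refl 0≤1 (λ H′ _ → empties-unavoidable H′))
        where open +-*-Solver
      rounds (suc d) {H} spread H≤ p≤1 = begin
        size H * 𝔼 (p + p′) (𝟙 ∘ avoids? H)
          -- The union has density `p + p′ - p p′`; the larger value `p + p′` is kept because it
          -- adds up to a linear expression in `d`.
          ≤⟨ *-monoʳ (∑-nonNeg H (λ _ → 0≤1)) (𝔼-antitone 0≤∪ ∪≤+ p≤1 (avoids-decreasing H)) ⟩
        size H * 𝔼 (p + p′ - p * p′) (𝟙 ∘ avoids? H)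
          ≤⟨ round 0≤M 0≤q spread 0≤p p≤1′ 0≤⅛ (ℚ.≤-trans ⅛≤½ ½≤1) q≤p⅛ H≤ (2 ℕ.^ (d ℕ.+ j)) (0≤density d) p′≤1
               (λ H′ spread′ H′≤ → rounds d spread′ H′≤ p′≤1) ⟩
        M * (X + Y * (2ℚ - 2ℚ * ½ ^ d)) + M * (2ℚ ^ (2 ℕ.^ suc (d ℕ.+ j)) * ⅛ ^ suc (2 ℕ.^ (d ℕ.+ j)))
          ≤⟨ ℚ.+-monoʳ-≤ (M * (X + Y * (2ℚ - 2ℚ * ½ ^ d))) (*-monoʳ 0≤M (round-cost (d ℕ.+ j))) ⟩
        M * (X + Y * (2ℚ - 2ℚ * ½ ^ d)) + M * ½ ^ (d ℕ.+ j)
          ≡⟨ cong (λ x → M * (X + Y * (2ℚ - 2ℚ * ½ ^ d)) + M * x) (^-homo-* ½ d j) ⟩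
        M * (X + Y * (2ℚ - 2ℚ * ½ ^ d)) + M * (½ ^ d * Y)
          ≡⟨ solve 4 (λ m x y z → m :* (x :+ y :* (con 2ℚ :- con 2ℚ :* z)) :+ m :* (z :* y) := m :* (x :+ y :* (con 2ℚ :- con 2ℚ :* (con ½ :* z)))) refl M X Y (½ ^ d) ⟩
        M * (X + Y * (2ℚ - 2ℚ * (½ * ½ ^ d))) ∎
        where
        open ℚ.≤-Reasoning
        open +-*-Solver
        p′ = density p p₀ d
        X = 2ℚ ^ (2 ℕ.^ j) * r₀
        Y = ½ ^ j
        p′≤1 : p′ ≤ 1ℚ
        p′≤1 = ℚ.≤-trans (subst (_≤ p + p′) (ℚ.+-identityˡ p′) (ℚ.+-monoˡ-≤ p′ 0≤p)) p≤1
        p≤1′ : p ≤ 1ℚ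
        p≤1′ = ℚ.≤-trans (subst (_≤ p + p′) (ℚ.+-identityʳ p) (ℚ.+-monoʳ-≤ p (0≤density d))) p≤1
        ∪≤+ : p + p′ - p * p′ ≤ p + p′
        ∪≤+ = subst (p + p′ - p * p′ ≤_) (ℚ.+-identityʳ (p + p′)) (ℚ.+-monoʳ-≤ (p + p′) (ℚ.neg-antimono-≤ (0≤* 0≤p (0≤density d))))
        0≤∪ : 0ℚ ≤ p + p′ - p * p′
        0≤∪ = subst (0ℚ ≤_) (solve 2 (λ p p′ → p′ :+ p :* (con 1ℚ :- p′) := p :+ p′ :- p :* p′) refl p p′)
          (0≤+ (0≤density d) (0≤* 0≤p (p≤q⇒0≤q-p p′≤1)))

      spread-lemma : ∀ d {H : List (Subset N)} {π} → IsSpread M q H → All (λ S → ∣ S ∣ ℕ.≤ 2 ℕ.^ (d ℕ.+ j)) H → density p p₀ d ≤ π → π ≤ 1ℚ →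
                     size H * 𝔼 π (𝟙 ∘ avoids? H) ≤ M * (2ℚ ^ (2 ℕ.^ j) * r₀ + ½ ^ j * 2ℚ)
      spread-lemma d {H} {π} spread H≤ ≤π π≤1 = begin
        size H * 𝔼 π (𝟙 ∘ avoids? H)
          ≤⟨ *-monoʳ (∑-nonNeg H (λ _ → 0≤1)) (𝔼-antitone (0≤density d) ≤π π≤1 (avoids-decreasing H)) ⟩
        size H * 𝔼 (density p p₀ d) (𝟙 ∘ avoids? H)
          ≤⟨ rounds d spread H≤ (ℚ.≤-trans ≤π π≤1) ⟩
        M * (2ℚ ^ (2 ℕ.^ j) * r₀ + ½ ^ j * (2ℚ - 2ℚ * ½ ^ d))
          ≤⟨ *-monoʳ 0≤M (ℚ.+-monoʳ-≤ (2ℚ ^ (2 ℕ.^ j) * r₀) (*-monoʳ (0≤^ j 0≤½)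
               (subst (2ℚ - 2ℚ * ½ ^ d ≤_) (ℚ.+-identityʳ 2ℚ) (ℚ.+-monoʳ-≤ 2ℚ (ℚ.neg-antimono-≤ (0≤* 0≤2 (0≤^ d 0≤½))))))) ⟩
        M * (2ℚ ^ (2 ℕ.^ j) * r₀ + ½ ^ j * 2ℚ) ∎
        where open ℚ.≤-Reasoning

  open Rounds public

module Embeddings where
  open D using (SimpleGraph; ContainsCopy; Comb; CombAdj; possibleEdges; Outcome; graph)
  open import Data.Fin.Subset using (Subset; inside; outside; ∣_∣; _⊆_) renaming (_∈_ to _∈ₛ_)
  open import Data.List.Membership.Propositional using (_∈_; _∉_)
  open import Data.Nat.Base using (_+_; _*_; _∸_; _≤_; _<_; _^_)

  -- Upper bounds for the number of elements with a property.

  module Cardinality where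
    private variable
      A B : Set

    length-filter-¬ : ∀ {P : A → Set} (P? : Decidable P) xs →
                      length (filter P? xs) + length (filter (¬? ∘ P?) xs) ≡ length xs
    length-filter-¬ P? []       = refl
    length-filter-¬ P? (x ∷ xs) with P? x
    ... | yes _ = cong suc (length-filter-¬ P? xs)
    ... | no _  = trans (ℕ.+-suc (length (filter P? xs)) _) (cong suc (length-filter-¬ P? xs))

    -- w |Q| ≤ K
    Card≤ : ℕ → (A → Set) → ℕ → Set
    Card≤ w Q K = ∀ xs → Unique xs → All Q xs → w * length xs ≤ K

    module _ {w : ℕ} {Q : A → Set} where
      Card≤-⊆ : ∀ {Q′ : A → Set} {K} → (∀ {x} → Q x → Q′ x) → Card≤ w Q′ K → Card≤ w Q K
      Card≤-⊆ Q⊆Q′ bound xs xs! Qxs = bound xs xs! (All.map Q⊆Q′ Qxs)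

      -- An empty family satisfies every bound, so the bound may be derived with the help of one
      -- given element.
      Card≤-inhabited : ∀ {K} → (∀ {x} → Q x → Card≤ w Q K) → Card≤ w Q K
      Card≤-inhabited {K} bound []       xs! Qxs        = subst (_≤ K) (sym (ℕ.*-zeroʳ w)) z≤n
      Card≤-inhabited     bound (x ∷ xs) xs! (Qx ∷ Qxs) = bound Qx (x ∷ xs) xs! (Qx ∷ Qxs)

      Card≤-∪ : ∀ {Q₁ Q₂ : A → Set} {K₁ K₂} → Decidable Q₁ → (∀ {x} → Q x → Q₁ x ⊎ Q₂ x) →
                Card≤ w (λ x → Q x × Q₁ x) K₁ → Card≤ w (λ x → Q x × Q₂ x) K₂ → Card≤ w Q (K₁ + K₂)
      Card≤-∪ {Q₁} {Q₂} {K₁} {K₂} Q₁? cover bound₁ bound₂ xs xs! Qxs = begin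
        w * length xs                                                      ≡⟨ cong (w *_) (length-filter-¬ Q₁? xs) ⟨
        w * (length (filter Q₁? xs) + length (filter (¬? ∘ Q₁?) xs))       ≡⟨ ℕ.*-distribˡ-+ w (length (filter Q₁? xs)) _ ⟩
        w * length (filter Q₁? xs) + w * length (filter (¬? ∘ Q₁?) xs)     ≤⟨ ℕ.+-mono-≤
          (bound₁ (filter Q₁? xs) (Unique.filter⁺ Q₁? xs!) (All.zip (All.filter⁺ Q₁? Qxs , All.all-filter Q₁? xs)))
          (bound₂ (filter (¬? ∘ Q₁?) xs) (Unique.filter⁺ (¬? ∘ Q₁?) xs!)
            (All.map (λ (q , ¬q₁) → q , Sum.[ (λ q₁ → contradiction q₁ ¬q₁) , id ] (cover q)) (All.zip (All.filter⁺ (¬? ∘ Q₁?) Qxs , All.all-filter (¬? ∘ Q₁?) xs)))) ⟩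
        K₁ + K₂                                                            ∎
        where open ℕ.≤-Reasoning

    Card≤-cover : ∀ {w K} {Q : A → Set} {R : B → A → Set} → (∀ y → Decidable (R y)) → (ys : List B) →
                  (∀ {x} → Q x → Any (λ y → R y x) ys) → (∀ y → Card≤ w (λ x → Q x × R y x) K) → Card≤ w Q (length ys * K)
    Card≤-cover {w = w} R? [] cover bound []       xs! Qxs      = ℕ.≤-reflexive (ℕ.*-zeroʳ w)
    Card≤-cover         R? [] cover bound (x ∷ xs) xs! (Qx ∷ _) = contradiction (cover Qx) λ ()
    Card≤-cover {w = w} {K} {Q} {R} R? (y ∷ ys) cover bound = Card≤-∪ {w = w} {Q} {R y} {λ x → Any (λ y → R y x) ys}
      (R? y) (Any.toSum ∘ cover) (bound y)
      (Card≤-cover {w = w} R? ys proj₂ (λ z → Card≤-⊆ {w = w} (λ ((q , _) , r) → q , r) (bound z)))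

    Card≤-fibres : ∀ {w K} {Q : A → Set} → DecidableEquality B → (f : A → B) (ys : List B) → (∀ {x} → Q x → f x ∈ ys) →
                   (∀ y → Card≤ w (λ x → Q x × f x ≡ y) K) → Card≤ w Q (length ys * K)
    Card≤-fibres {w = w} _≟_ f = Card≤-cover {w = w} (λ y x → f x ≟ y)

    Card≤-subsingleton : ∀ {Q : A → Set} → (∀ {x y} → Q x → Q y → x ≡ y) → Card≤ 1 Q 1
    Card≤-subsingleton unique []           xs!              Qxs                = z≤n
    Card≤-subsingleton unique (x ∷ [])     xs!              Qxs                = s≤s z≤n
    Card≤-subsingleton unique (x ∷ y ∷ xs) ((x≢y ∷ _) ∷ _) (Qx ∷ Qy ∷ _) = contradiction (unique Qx Qy) x≢y

    unique⇒length≤ : ∀ {xs ys : List A} → DecidableEquality A → Unique xs → All (_∈ ys) xs → length xs ≤ length ys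
    unique⇒length≤ {xs = xs} {ys} _≟_ xs! xs⊆ys = subst₂ _≤_ (ℕ.*-identityˡ (length xs)) (ℕ.*-identityʳ (length ys))
      (Card≤-fibres {w = 1} _≟_ id ys id (λ y → Card≤-subsingleton (λ { (_ , refl) (_ , refl) → refl })) xs xs! xs⊆ys)

    module _ {n : ℕ} where
      open import Data.List.Membership.DecPropositional (Fin._≟_ {n}) public using (_∈?_)

      others : List (Fin n) → List (Fin n)
      others us = filter (λ i → ¬? (i ∈? us)) (allFin n)

      length-others : ∀ {us} → Unique us → length us + length (others us) ≡ n
      length-others {us} us! = begin
        length us + length (others us)                               ≡⟨ cong (_+ length (others us)) same ⟩
        length (filter (_∈? us) (allFin n)) + length (others us)     ≡⟨ length-filter-¬ (_∈? us) (allFin n) ⟩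
        length (allFin n)                                            ≡⟨ List.length-tabulate id ⟩
        n                                                            ∎
        where
        open ≡-Reasoning
        same : length us ≡ length (filter (_∈? us) (allFin n))
        same = ℕ.≤-antisym
          (unique⇒length≤ Fin._≟_ us! (All.tabulate (λ i∈ → L.∈-filter⁺ (_∈? us) (L.∈-allFin _) i∈)))
          (unique⇒length≤ Fin._≟_ (Unique.filter⁺ (_∈? us) (Unique.allFin⁺ n)) (All.all-filter (_∈? us) (allFin n)))

  open Cardinality public

  -- Falling factorials compared with powers.

  module FallingFactorials where
    falling : ℕ → ℕ → ℕ
    falling m zero    = 1
    falling m (suc c) = m * falling (pred m) c

    falling-suc : ∀ m c → falling m (suc c) ≡ falling m c * (m ∸ c)
    falling-suc m zero    = trans (ℕ.*-identityʳ m) (sym (ℕ.+-identityʳ m))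
    falling-suc m (suc c) = begin
      m * falling (pred m) (suc c)            ≡⟨ cong (m *_) (falling-suc (pred m) c) ⟩
      m * (falling (pred m) c * (pred m ∸ c)) ≡⟨ ℕ.*-assoc m (falling (pred m) c) _ ⟨
      m * falling (pred m) c * (pred m ∸ c)   ≡⟨ cong (m * falling (pred m) c *_) (ℕ.∸-+-assoc m 1 c) ⟩
      m * falling (pred m) c * (m ∸ suc c)    ∎
      where open ≡-Reasoning

    falling-+ : ∀ m c d → falling m (c + d) ≡ falling m c * falling (m ∸ c) d
    falling-+ m zero    d = sym (ℕ.+-identityʳ (falling m d))
    falling-+ m (suc c) d = begin
      m * falling (pred m) (c + d)                        ≡⟨ cong (m *_) (falling-+ (pred m) c d) ⟩
      m * (falling (pred m) c * falling (pred m ∸ c) d)   ≡⟨ ℕ.*-assoc m (falling (pred m) c) _ ⟨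
      m * falling (pred m) c * falling (pred m ∸ c) d     ≡⟨ cong (λ x → m * falling (pred m) c * falling x d) (ℕ.∸-+-assoc m 1 c) ⟩
      m * falling (pred m) c * falling (m ∸ suc c) d      ∎
      where open ≡-Reasoning

    open ℕ.+-*-Solver

    ^-distribʳ-* : ∀ s a b → (a * b) ^ s ≡ a ^ s * b ^ s
    ^-distribʳ-* zero    a b = refl
    ^-distribʳ-* (suc s) a b = trans (cong (a * b *_) (^-distribʳ-* s a b))
      (solve 4 (λ a b x y → a :* b :* (x :* y) := a :* x :* (b :* y)) refl a b (a ^ s) (b ^ s))

    -- (1 + 1/m)ʲ ≤ 1/(1 - j/m), for m = j + r
    bernoulli : ∀ j r → suc (j + r) ^ j * r ≤ (j + r) ^ suc j
    bernoulli zero    r = ℕ.≤-reflexive (solve 1 (λ r → con 1 :* r := r :* con 1) refl r)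
    bernoulli (suc j) r = begin
      (1 + m) * (1 + m) ^ j * r         ≡⟨ solve 3 (λ x y r → x :* y :* r := y :* (x :* r)) refl (1 + m) ((1 + m) ^ j) r ⟩
      (1 + m) ^ j * ((1 + m) * r)       ≤⟨ ℕ.*-monoʳ-≤ ((1 + m) ^ j) smaller ⟩
      (1 + m) ^ j * (suc r * m)         ≡⟨ ℕ.*-assoc ((1 + m) ^ j) (suc r) m ⟨
      (1 + m) ^ j * suc r * m           ≤⟨ ℕ.*-monoˡ-≤ m ih ⟩
      m * m ^ j * m                     ≡⟨ ℕ.*-comm (m * m ^ j) m ⟩
      m * (m * m ^ j)                   ∎
      where
      open ℕ.≤-Reasoning
      m = suc (j + r)
      ih : (1 + m) ^ j * suc r ≤ m ^ suc j
      ih = subst (λ k → suc k ^ j * suc r ≤ k ^ suc j) (ℕ.+-suc j r) (bernoulli j (suc r))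
      smaller : (1 + m) * r ≤ suc r * m
      smaller = subst (_≤ suc r * m) (solve 2 (λ m r → r :+ r :* m := (con 1 :+ m) :* r) refl m r)
        (ℕ.+-monoˡ-≤ (r * m) (ℕ.≤-trans (ℕ.m≤n+m r j) (ℕ.n≤1+n (j + r))))

    -- The quotient `m / (m - h)` from `bernoulli` is at most 2 when `m` is at least `2h`.
    [1+m]^h≤2m^h : ∀ h r → suc (h + (h + r)) ^ h ≤ 2 * (h + (h + r)) ^ h
    [1+m]^h≤2m^h zero    r       = s≤s z≤n
    [1+m]^h≤2m^h (suc h′) r = ℕ.*-cancelʳ-≤ _ _ (h + r) (begin
      suc m ^ h * (h + r)      ≤⟨ bernoulli h (h + r) ⟩
      m * m ^ h                ≤⟨ ℕ.*-monoˡ-≤ (m ^ h) (ℕ.+-monoˡ-≤ (h + r) (ℕ.m≤m+n h r)) ⟩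
      (h + r + (h + r)) * m ^ h ≡⟨ solve 2 (λ x y → (x :+ x) :* y := con 2 :* y :* x) refl (h + r) (m ^ h) ⟩
      2 * m ^ h * (h + r)      ∎)
      where
      open ℕ.≤-Reasoning
      h = suc h′
      m = h + (h + r)

    halves : ∀ s → ∃[ h ] (s ≡ h + h ⊎ s ≡ suc (h + h))
    halves zero    = 0 , inj₁ refl
    halves (suc s) with halves s
    ... | h , inj₁ refl = h , inj₂ refl
    ... | h , inj₂ refl = suc h , inj₁ (cong suc (sym (ℕ.+-suc h h)))

    -- The exponent is split into two halves and possibly one more unit, each of which contributes a
    -- factor of at most 2. The value 8 stands in for `e`.
    [1+m]^s≤8m^s : ∀ {s m} → s ≤ m → suc m ^ s ≤ 8 * m ^ s
    [1+m]^s≤8m^s {s} {m} s≤m with halves s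
    ... | h , inj₁ refl = begin
      suc m ^ (h + h)               ≡⟨ ℕ.^-distribˡ-+-* (suc m) h h ⟩
      suc m ^ h * suc m ^ h         ≤⟨ ℕ.*-mono-≤ half half ⟩
      2 * m ^ h * (2 * m ^ h)       ≡⟨ solve 1 (λ x → con 2 :* x :* (con 2 :* x) := con 4 :* (x :* x)) refl (m ^ h) ⟩
      4 * (m ^ h * m ^ h)           ≡⟨ cong (4 *_) (ℕ.^-distribˡ-+-* m h h) ⟨
      4 * m ^ (h + h)               ≤⟨ ℕ.*-monoˡ-≤ (m ^ (h + h)) (ℕ.m≤m+n 4 4) ⟩
      8 * m ^ (h + h)               ∎
      where
      open ℕ.≤-Reasoning
      half : suc m ^ h ≤ 2 * m ^ h
      half = subst (λ k → suc k ^ h ≤ 2 * k ^ h) (trans (sym (ℕ.+-assoc h h (m ∸ (h + h)))) (ℕ.m+[n∸m]≡n s≤m)) ([1+m]^h≤2m^h h (m ∸ (h + h)))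
    ... | h , inj₂ refl = begin
      suc m * suc m ^ (h + h)               ≡⟨ cong (suc m *_) (ℕ.^-distribˡ-+-* (suc m) h h) ⟩
      suc m * (suc m ^ h * suc m ^ h)       ≤⟨ ℕ.*-mono-≤ double (ℕ.*-mono-≤ half half) ⟩
      2 * m * (2 * m ^ h * (2 * m ^ h))     ≡⟨ solve 2 (λ m x → con 2 :* m :* (con 2 :* x :* (con 2 :* x)) := con 8 :* (m :* (x :* x))) refl m (m ^ h) ⟩
      8 * (m * (m ^ h * m ^ h))             ≡⟨ cong (λ x → 8 * (m * x)) (ℕ.^-distribˡ-+-* m h h) ⟨
      8 * (m * m ^ (h + h))                 ∎
      where
      open ℕ.≤-Reasoning
      half : suc m ^ h ≤ 2 * m ^ h
      half = subst (λ k → suc k ^ h ≤ 2 * k ^ h) (trans (sym (ℕ.+-assoc h h (m ∸ (h + h)))) (ℕ.m+[n∸m]≡n (ℕ.≤-trans (ℕ.n≤1+n _) s≤m))) ([1+m]^h≤2m^h h (m ∸ (h + h)))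
      double : suc m ≤ 2 * m
      double = ℕ.+-mono-≤ (ℕ.≤-trans (s≤s z≤n) s≤m) (ℕ.≤-reflexive (sym (ℕ.+-identityʳ m)))

    -- A substitute for Stirling's formula: raising both `s` and `m` by one multiplies the ratio of
    -- `m^s` to `falling m s` by `(1 + 1/m)^s`, which is at most 8.
    m^s≤8^s*falling : ∀ s y → (s + y) ^ s ≤ 8 ^ s * falling (s + y) s
    m^s≤8^s*falling zero    y = s≤s z≤n
    m^s≤8^s*falling (suc s) y = begin
      suc m * suc m ^ s                   ≤⟨ ℕ.*-monoʳ-≤ (suc m) ([1+m]^s≤8m^s (ℕ.m≤m+n s y)) ⟩
      suc m * (8 * m ^ s)                 ≤⟨ ℕ.*-monoʳ-≤ (suc m) (ℕ.*-monoʳ-≤ 8 (m^s≤8^s*falling s y)) ⟩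
      suc m * (8 * (8 ^ s * falling m s)) ≡⟨ solve 3 (λ m x y → m :* (con 8 :* (x :* y)) := con 8 :* x :* (m :* y)) refl (suc m) (8 ^ s) (falling m s) ⟩
      8 * 8 ^ s * (suc m * falling m s)   ∎
      where
      open ℕ.≤-Reasoning
      m = s + y

    -- Here `c`, `s` and `y` are the numbers of roots, children and remaining vertices. Compared
    -- with `falling n n`, the left product lacks the factor `falling (s + y) s` for the children.
    -- Since `c ≤ s`, `n` is at most `2(s + y)`, so that factor is at least `(n/16)^s`.
    n^s*falling≤16^s*falling : ∀ {n} c s y → c + (s + y) ≡ n → c ≤ s → n ^ s * (falling n c * falling y y) ≤ 16 ^ s * falling n n
    n^s*falling≤16^s*falling {n} c s y refl c≤s = begin
      n ^ s * (falling n c * falling y y)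
        ≤⟨ ℕ.*-monoˡ-≤ _ (ℕ.^-monoˡ-≤ s (ℕ.+-monoˡ-≤ m (ℕ.≤-trans c≤s (ℕ.m≤m+n s y)))) ⟩
      (m + m) ^ s * (falling n c * falling y y)
        ≡⟨ cong (λ x → x ^ s * (falling n c * falling y y)) (cong (m +_) (sym (ℕ.+-identityʳ m))) ⟩
      (2 * m) ^ s * (falling n c * falling y y)
        ≡⟨ cong (_* (falling n c * falling y y)) (^-distribʳ-* s 2 m) ⟩
      2 ^ s * m ^ s * (falling n c * falling y y)
        ≤⟨ ℕ.*-monoˡ-≤ _ (ℕ.*-monoʳ-≤ (2 ^ s) (m^s≤8^s*falling s y)) ⟩
      2 ^ s * (8 ^ s * falling m s) * (falling n c * falling y y)
        ≡⟨ solve 5 (λ a b f g h → a :* (b :* f) :* (g :* h) := a :* b :* (g :* (f :* h))) refl (2 ^ s) (8 ^ s) (falling m s) (falling n c) (falling y y) ⟩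
      2 ^ s * 8 ^ s * (falling n c * (falling m s * falling y y))
        ≡⟨ cong₂ (λ x z → x * (falling n c * z)) (sym (^-distribʳ-* s 2 8))
             (trans (cong (λ x → falling m s * falling x y) (sym (ℕ.m+n∸m≡n s y))) (sym (falling-+ m s y))) ⟩
      16 ^ s * (falling n c * falling m m)
        ≡⟨ cong (16 ^ s *_) (trans (cong (λ x → falling n c * falling x m) (sym (ℕ.m+n∸m≡n c m))) (sym (falling-+ n c m))) ⟩
      16 ^ s * falling n n ∎
      where
      open ℕ.≤-Reasoning
      m = s + y

  open FallingFactorials public

  -- Enumeration of the injective words.

  module Words where
    private variable
      m n : ℕ

    Word : ℕ → ℕ → Set
    Word n m = Vec (Fin n) m

    Injective : Word n m → Set
    Injective w = ∀ {i j} → lookup w i ≡ lookup w j → i ≡ j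

    extensions : Word n m → List (Word n (suc m))
    extensions w = map (_∷ w) (others (toList w))

    words : ∀ n m → List (Word n m)
    words n zero    = [] ∷ []
    words n (suc m) = concatMap extensions (words n m)

    private
      concatMap-All : ∀ {A B : Set} {P : A → Set} {Q : B → Set} (f : A → List B) → (∀ {x} → P x → All Q (f x)) →
                      ∀ {xs} → All P xs → All Q (concatMap f xs)
      concatMap-All f PQ []         = []
      concatMap-All f PQ (Px ∷ Pxs) = All.++⁺ (PQ Px) (concatMap-All f PQ Pxs)

    words-distinct : ∀ m → All (λ w → Unique (toList w)) (words n m)
    words-distinct zero    = [] ∷ []
    words-distinct {n} (suc m) = concatMap-All extensions distinct (words-distinct m)
      where
      distinct : ∀ {w : Word n m} → Unique (toList w) → All (λ w → Unique (toList w)) (extensions w)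
      distinct {w} w! = All.map⁺ (All.map (λ {y} y∉w → All.¬Any⇒All¬ (toList w) y∉w ∷ w!)
        (All.all-filter (λ i → ¬? (i ∈? toList w)) (allFin n)))

    words-injective : ∀ m → All Injective (words n m)
    words-injective m = All.map (λ {w} → injective w) (words-distinct m)
      where
      lookup-∈ : ∀ {m} (w : Word n m) i → lookup w i ∈ toList w
      lookup-∈ w i = Vec.∈-toList⁺ (Vec.∈-lookup i w)
      injective : ∀ {m} (w : Word n m) → Unique (toList w) → Injective w
      injective (x ∷ w) (x∉ ∷ w!) {zero}  {zero}  eq = refl
      injective (x ∷ w) (x∉ ∷ w!) {suc i} {suc j} eq = cong suc (injective w w! eq)
      injective (x ∷ w) (x∉ ∷ w!) {zero}  {suc j} eq = contradiction eq (All.lookup x∉ (lookup-∈ w j))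
      injective (x ∷ w) (x∉ ∷ w!) {suc i} {zero}  eq = contradiction (sym eq) (All.lookup x∉ (lookup-∈ w i))

    words-unique : ∀ m → Unique (words n m)
    words-unique zero    = [] ∷ []
    words-unique {n} (suc m) = unique (words-unique m)
      where
      tail∈ : ∀ {ws : List (Word n m)} {y w} → (y ∷ w) ∈ concatMap extensions ws → w ∈ ws
      tail∈ {v ∷ ws} y∷w∈ with L.∈-++⁻ (extensions v) y∷w∈
      ... | inj₂ rest = there (tail∈ rest)
      ... | inj₁ y∷w∈v with L.∈-map⁻ (_∷ v) y∷w∈v
      ...   | _ , _ , refl = here refl
      unique : ∀ {ws : List (Word n m)} → Unique ws → Unique (concatMap extensions ws)
      unique []         = []
      unique {w ∷ ws} (w∉ ∷ ws!) = Unique.++⁺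
        (Unique.map⁺ (λ { refl → refl }) (Unique.filter⁺ (λ i → ¬? (i ∈? toList w)) (Unique.allFin⁺ n)))
        (unique ws!) disjoint
        where
        disjoint : ∀ {v} → ¬ (v ∈ extensions w × v ∈ concatMap extensions ws)
        disjoint (v∈w , v∈ws) with L.∈-map⁻ (_∷ w) v∈w
        ... | _ , _ , refl = All.lookup w∉ (tail∈ v∈ws) refl

    length-words : ∀ n m → length (words n m) ≡ falling n m
    length-words n zero    = refl
    length-words n (suc m) = trans (extend (words-distinct m)) (trans (cong (_* (n ∸ m)) (length-words n m)) (sym (falling-suc n m)))
      where
      length-extensions : ∀ {w : Word n m} → Unique (toList w) → length (extensions w) ≡ n ∸ m
      length-extensions {w} w! = begin
        length (extensions w)                                                     ≡⟨ List.length-map (_∷ w) (others (toList w)) ⟩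
        length (others (toList w))                                                ≡⟨ ℕ.m+n∸m≡n (length (toList w)) _ ⟨
        length (toList w) + length (others (toList w)) ∸ length (toList w)        ≡⟨ cong₂ _∸_ (length-others w!) (Vec.length-toList w) ⟩
        n ∸ m                                                                     ∎
        where open ≡-Reasoning
      extend : ∀ {ws : List (Word n m)} → All (λ w → Unique (toList w)) ws → length (concatMap extensions ws) ≡ length ws * (n ∸ m)
      extend []                  = refl
      extend {w ∷ ws} (w! ∷ ws!) = trans (List.length-++ (extensions w)) (cong₂ _+_ (length-extensions w!) (extend ws!))

  open Words public

  -- Counting words by fixing their values one position at a time.

  module Assignments where
    private variable
      n : ℕ

    AgreeAt : (Word n n → Set) → Fin n → Set
    AgreeAt Q i = ∀ ψ ψ′ → Q ψ → Q ψ′ → lookup ψ i ≡ lookup ψ′ i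

    word≡ : ∀ {m} {v w : Word n m} → (∀ i → lookup v i ≡ lookup w i) → v ≡ w
    word≡ {v = []}    {[]}    eq = refl
    word≡ {v = x ∷ v} {y ∷ w} eq = cong₂ _∷_ (eq zero) (word≡ (eq ∘ suc))

    -- At the positions `js` all words of `Q` already agree, and injectivity forbids those values
    -- elsewhere, which leaves `n - |js|` choices for the next position. The continuation covers
    -- arbitrary subfamilies `Q′`, so that the values at further positions can be deduced from the
    -- chosen ones before the counting resumes.
    Card≤-assign : ∀ {Q : Word n n → Set} {K} {is js : List (Fin n)} → Unique is → Unique js → All (_∉ js) is →
      (∀ {ψ} → Q ψ → Injective ψ) → All (AgreeAt Q) js →
      (∀ {Q′ : Word n n → Set} → (∀ {ψ} → Q′ ψ → Q ψ) → All (AgreeAt Q′) is → Card≤ 1 Q′ K) →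
      Card≤ 1 Q (falling (n ∸ length js) (length is) * K)
    Card≤-assign {Q = Q} {K} {[]} is! js! is∉js inj agree bound = subst (Card≤ 1 Q) (sym (ℕ.+-identityʳ K)) (bound id [])
    Card≤-assign {n} {Q} {K} {i ∷ is} {js} (i∉is ∷ is!) js! (i∉js ∷ is∉js) inj agree bound =
      -- One word `ψ` of the family supplies the list of used values; by agreement on `js` it is the
      -- same list for all the others.
      Card≤-inhabited {w = 1} (λ {ψ} Qψ → subst (Card≤ 1 Q) (count ψ Qψ) (Card≤-fibres {w = 1} Fin._≟_ value (choices ψ) (fresh Qψ) fibre))
      where
      value : Word n n → Fin n
      value ψ = lookup ψ i
      choices : Word n n → List (Fin n)
      choices ψ = others (map (lookup ψ) js)
      rest : ℕ
      rest = falling (n ∸ suc (length js)) (length is) * K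
      fresh : ∀ {ψ} → Q ψ → ∀ {ψ′} → Q ψ′ → value ψ′ ∈ choices ψ
      fresh {ψ} Qψ {ψ′} Qψ′ = L.∈-filter⁺ (λ x → ¬? (x ∈? map (lookup ψ) js)) (L.∈-allFin (value ψ′)) used
        where
        used : value ψ′ ∉ map (lookup ψ) js
        used ∈ with L.∈-map⁻ (lookup ψ) ∈
        ... | j , j∈js , eq = i∉js (subst (_∈ js) (sym (inj Qψ′ (trans eq (All.lookup agree j∈js ψ ψ′ Qψ Qψ′)))) j∈js)
      fibre : ∀ y → Card≤ 1 (λ ψ → Q ψ × value ψ ≡ y) rest
      fibre y = Card≤-assign is! (All.¬Any⇒All¬ js i∉js ∷ js!)
        (All.zipWith (λ (i≢k , k∉js) → λ { (here k≡i) → i≢k (sym k≡i) ; (there k∈js) → k∉js k∈js }) (i∉is , is∉js))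
        (inj ∘ proj₁)
        ((λ _ _ (_ , eq) (_ , eq′) → trans eq (sym eq′)) ∷ All.map (λ agree ψ ψ′ (q , _) (q′ , _) → agree ψ ψ′ q q′) agree)
        (λ Q′⊆ agree′ → bound (proj₁ ∘ Q′⊆) ((λ _ _ q q′ → trans (proj₂ (Q′⊆ q)) (sym (proj₂ (Q′⊆ q′)))) ∷ agree′))
      count : ∀ ψ → Q ψ → length (choices ψ) * rest ≡ falling (n ∸ length js) (suc (length is)) * K
      count ψ Qψ = begin
        length (choices ψ) * (falling (n ∸ suc (length js)) (length is) * K)   ≡⟨ ℕ.*-assoc (length (choices ψ)) _ K ⟨
        length (choices ψ) * falling (n ∸ suc (length js)) (length is) * K     ≡⟨ cong₂ (λ x y → x * falling y (length is) * K) number (sym (ℕ.pred[m∸n]≡m∸[1+n] n (length js))) ⟩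
        falling (n ∸ length js) (suc (length is)) * K                          ∎
        where
        open ≡-Reasoning
        values = map (lookup ψ) js
        number : length (choices ψ) ≡ n ∸ length js
        number = begin
          length (choices ψ)                                     ≡⟨ ℕ.m+n∸m≡n (length values) _ ⟨
          length values + length (choices ψ) ∸ length values     ≡⟨ cong₂ _∸_ (length-others (Unique.map⁺ (inj Qψ) js!)) (List.length-map (lookup ψ) js) ⟩
          n ∸ length js                                          ∎

    Card≤-determined : ∀ {Q : Word n n → Set} → (∀ i → AgreeAt Q i) → Card≤ 1 Q 1
    Card≤-determined agree = Card≤-subsingleton (λ q q′ → word≡ (λ i → agree i _ _ q q′))

  open Assignments public

  -- Counting the bijections whose image contains prescribed edges.

  module ForestCount {n : ℕ}
    (Step : Bool → Fin n → Fin n → Set) (step? : ∀ t x y → Dec (Step t x y))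
    (step-functional : ∀ {t x y z} → Step t x y → Step t x z → y ≡ z)
    (parent-unique : ∀ {t t′ x y z} → Step t x z → Step t′ y z → x ≡ y)
    (depth : Fin n → ℕ) (step-deepens : ∀ {t x y} → Step t x y → depth x < depth y) where

    Edge : Set
    Edge = Fin n × Fin n

    -- An edge with the kind of its step and whether the step goes backwards.
    LabelledEdge : Set
    LabelledEdge = Edge × (Bool × Bool)

    parent child : LabelledEdge → Fin n
    parent ((u , v) , (_ , false)) = u
    parent ((u , v) , (_ , true))  = v
    child  ((u , v) , (_ , false)) = v
    child  ((u , v) , (_ , true))  = u

    Respects : Word n n → LabelledEdge → Set
    Respects ψ l@(_ , (t , _)) = Step t (lookup ψ (parent l)) (lookup ψ (child l))

    Ordered : Edge → Set
    Ordered (u , v) = u Fin.< v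

    edge-unique : ∀ {l l′} → Ordered (proj₁ l) → Ordered (proj₁ l′) → parent l ≡ parent l′ → child l ≡ child l′ → proj₁ l ≡ proj₁ l′
    edge-unique {_ , (_ , false)} {_ , (_ , false)} _   _     refl refl = refl
    edge-unique {_ , (_ , true)}  {_ , (_ , true)}  _   _     refl refl = refl
    edge-unique {_ , (_ , false)} {_ , (_ , true)}  u<v v<u   refl refl = contradiction v<u (Fin.<-asym u<v)
    edge-unique {_ , (_ , true)}  {_ , (_ , false)} u<v v<u   refl refl = contradiction v<u (Fin.<-asym u<v)

    private
      map-unique : ∀ {A B C : Set} {f : A → B} {g : A → C} {xs} → (∀ {x y} → x ∈ xs → y ∈ xs → g x ≡ g y → f x ≡ f y) →
                   Unique (map f xs) → Unique (map g xs)
      map-unique {xs = []}     g⇒f []          = []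
      map-unique {xs = x ∷ xs} g⇒f (fx∉ ∷ fxs!) =
        All.map⁺ (All.tabulate (λ y∈ gx≡gy → All.lookup (All.map⁻ fx∉) y∈ (g⇒f (here refl) (there y∈) gx≡gy))) ∷
        map-unique (λ x∈ y∈ → g⇒f (there x∈) (there y∈)) fxs!

    module _ {ls : List LabelledEdge} (ls! : Unique (map proj₁ ls)) (ordered : All (Ordered ∘ proj₁) ls) where
      private
        s = length ls

        Solution : Word n n → Set
        Solution ψ = Injective ψ × All (Respects ψ) ls

        children parents roots outsiders : List (Fin n)
        children  = map child ls
        parents   = map parent ls
        roots     = filter (_∈? parents) (others children)
        outsiders = filter (λ i → ¬? (i ∈? parents)) (others children)

        -- Edges with a common child have parents with the same image by `parent-unique`, hence the
        -- same parent by injectivity. The conclusion does not mention `ψ`, but it rests on the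
        -- existence of one solution.
        children! : ∀ {ψ} → Solution ψ → Unique children
        children! {ψ} (inj , respects) = map-unique same ls!
          where
          same : ∀ {l l′} → l ∈ ls → l′ ∈ ls → child l ≡ child l′ → proj₁ l ≡ proj₁ l′
          same {l} {l′} l∈ l′∈ eq = edge-unique {l} {l′} (All.lookup ordered l∈) (All.lookup ordered l′∈)
            (inj (parent-unique (All.lookup respects l∈)
              (subst (λ x → Step (proj₁ (proj₂ l′)) (lookup ψ (parent l′)) (lookup ψ x)) (sym eq) (All.lookup respects l′∈)))) eq

        -- The values at the roots propagate from parents to children.
        agree-children : ∀ {Q : Word n n → Set} → (∀ {ψ} → Q ψ → Solution ψ) → All (AgreeAt Q) roots → ∀ {i} → i ∈ children → AgreeAt Q i
        agree-children {Q} Q⊆ agree i∈ ψ ψ′ q q′ with L.∈-map⁻ child i∈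
        ... | l , l∈ , refl = go _ l l∈ ℕ.≤-refl
          where
          -- The fuel `d` exceeds the depth of the child's image. Passing from a child to its parent
          -- lowers that depth, so the walk upwards ends at a root.
          go : ∀ d l → l ∈ ls → depth (lookup ψ (child l)) < d → lookup ψ (child l) ≡ lookup ψ′ (child l)
          go (suc d) l l∈ <d = step-functional step (subst (λ x → Step _ x (lookup ψ′ (child l))) (sym parent≡) step′)
            where
            step = All.lookup (proj₂ (Q⊆ q)) l∈
            step′ = All.lookup (proj₂ (Q⊆ q′)) l∈
            parent≡ : lookup ψ (parent l) ≡ lookup ψ′ (parent l)
            parent≡ with parent l ∈? children
            ... | no p∉ = All.lookup agree (L.∈-filter⁺ (_∈? parents) (L.∈-filter⁺ (λ i → ¬? (i ∈? children)) (L.∈-allFin _) p∉) (L.∈-map⁺ parent l∈)) ψ ψ′ q q′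
            ... | yes p∈ with L.∈-map⁻ child p∈
            ...   | l′ , l′∈ , eq = subst (λ p → lookup ψ p ≡ lookup ψ′ p) (sym eq)
              (go d l′ l′∈ (ℕ.<-≤-trans (subst (λ p → depth (lookup ψ p) < _) eq (step-deepens step)) (ℕ.s≤s⁻¹ <d)))

        c≤s : length roots ≤ s
        c≤s = subst (length roots ≤_) (List.length-map parent ls)
          (unique⇒length≤ Fin._≟_ (Unique.filter⁺ (_∈? parents) (Unique.filter⁺ (λ i → ¬? (i ∈? children)) (Unique.allFin⁺ n)))
            (All.all-filter (_∈? parents) (others children)))

        total : Unique children → length roots + (s + length outsiders) ≡ n
        total cs! = begin
          c + (s + y)                                   ≡⟨ solve 3 (λ c s y → c :+ (s :+ y) := s :+ (c :+ y)) refl c s y ⟩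
          s + (c + y)                                   ≡⟨ cong₂ _+_ (sym (List.length-map child ls)) (length-filter-¬ (_∈? parents) (others children)) ⟩
          length children + length (others children)    ≡⟨ length-others cs! ⟩
          n                                             ∎
          where
          open ≡-Reasoning
          open ℕ.+-*-Solver
          c = length roots
          y = length outsiders

        -- The roots are assigned freely, the children then follow from them, and the outsiders
        -- share the values that are left, as many as there are outsiders.
        Card≤-Solution : Unique children → Card≤ 1 Solution (falling n (length roots) * falling (length outsiders) (length outsiders))
        Card≤-Solution cs! = Card≤-assign {is = roots} {[]} roots! [] (All.tabulate (λ _ ())) proj₁ [] extend
          where
          c = length roots
          y = length outsiders
          others! : Unique (others children)
          others! = Unique.filter⁺ (λ i → ¬? (i ∈? children)) (Unique.allFin⁺ n)
          roots! : Unique roots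
          roots! = Unique.filter⁺ (_∈? parents) others!
          ∉children : ∀ {i} → i ∈ others children → i ∉ children
          ∉children i∈ = proj₂ (L.∈-filter⁻ (λ i → ¬? (i ∈? children)) {xs = allFin n} i∈)
          remaining : n ∸ length (roots List.++ children) ≡ y
          remaining = begin
            n ∸ length (roots List.++ children)    ≡⟨ cong₂ _∸_ (sym (total cs!)) (trans (List.length-++ roots) (cong (c +_) (List.length-map child ls))) ⟩
            c + (s + y) ∸ (c + s)                  ≡⟨ cong (_∸ (c + s)) (ℕ.+-assoc c s y) ⟨
            c + s + y ∸ (c + s)                    ≡⟨ ℕ.m+n∸m≡n (c + s) y ⟩
            y                                      ∎
            where open ≡-Reasoning
          extend : ∀ {Q : Word n n → Set} → (∀ {ψ} → Q ψ → Solution ψ) → All (AgreeAt Q) roots → Card≤ 1 Q (falling y y)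
          extend {Q} Q⊆ agree-roots = subst (Card≤ 1 Q) (trans (ℕ.*-identityʳ _) (cong (λ m → falling m y) remaining))
            (Card≤-assign {is = outsiders} {roots List.++ children}
              (Unique.filter⁺ (λ i → ¬? (i ∈? parents)) others!)
              (Unique.++⁺ roots! cs! (λ (i∈roots , i∈children) → ∉children (proj₁ (L.∈-filter⁻ (_∈? parents) i∈roots)) i∈children))
              (All.tabulate (λ i∈outsiders i∈ → apart i∈outsiders (L.∈-++⁻ roots i∈)))
              (proj₁ ∘ Q⊆)
              (All.++⁺ agree-roots (All.tabulate (agree-children Q⊆ agree-roots)))
              (λ Q′⊆ agree-outsiders → Card≤-determined (everywhere Q′⊆ agree-outsiders)))
            where
            apart : ∀ {i} → i ∈ outsiders → ¬ (i ∈ roots ⊎ i ∈ children)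
            apart i∈ (inj₁ i∈roots) = proj₂ (L.∈-filter⁻ (λ i → ¬? (i ∈? parents)) {xs = others children} i∈)
                                            (proj₂ (L.∈-filter⁻ (_∈? parents) {xs = others children} i∈roots))
            apart i∈ (inj₂ i∈children) = ∉children (proj₁ (L.∈-filter⁻ (λ i → ¬? (i ∈? parents)) {xs = others children} i∈)) i∈children
            everywhere : ∀ {Q′ : Word n n → Set} → (∀ {ψ} → Q′ ψ → Q ψ) → All (AgreeAt Q′) outsiders → ∀ i → AgreeAt Q′ i
            everywhere Q′⊆ agree-outsiders i ψ ψ′ q q′ with i ∈? children
            ... | yes i∈ = agree-children Q⊆ agree-roots i∈ ψ ψ′ (Q′⊆ q) (Q′⊆ q′)
            ... | no i∉ with i ∈? parents
            ...   | yes i∈p = All.lookup agree-roots (L.∈-filter⁺ (_∈? parents) (L.∈-filter⁺ (λ i → ¬? (i ∈? children)) (L.∈-allFin i) i∉) i∈p) ψ ψ′ (Q′⊆ q) (Q′⊆ q′)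
            ...   | no i∉p  = All.lookup agree-outsiders (L.∈-filter⁺ (λ i → ¬? (i ∈? parents)) (L.∈-filter⁺ (λ i → ¬? (i ∈? children)) (L.∈-allFin i) i∉) i∉p) ψ ψ′ q q′

      Card≤-labelled : Card≤ (n ^ s) Solution (16 ^ s * falling n n)
      Card≤-labelled = Card≤-inhabited {w = n ^ s} (λ {ψ} sol xs xs! sols → let cs! = children! {ψ} sol in ℕ.≤-trans
        (ℕ.*-monoʳ-≤ (n ^ s) (subst (_≤ _) (ℕ.*-identityˡ (length xs)) (Card≤-Solution cs! xs xs! sols)))
        (n^s*falling≤16^s*falling (length roots) s (length outsiders) (total cs!) c≤s))

    Embeds : Word n n → Edge → Set
    Embeds ψ (u , v) = ∃[ t ] (Step t (lookup ψ u) (lookup ψ v) ⊎ Step t (lookup ψ v) (lookup ψ u))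

    private
      labels : List (Bool × Bool)
      labels = (false , false) ∷ (false , true) ∷ (true , false) ∷ (true , true) ∷ []

      -- The labels are chosen one edge after another; `Q` is arbitrary so that it can absorb the
      -- conditions on the edges already labelled.
      Card≤-label : ∀ {w K} es {Q : Word n n → Set} →
        (∀ ls → map proj₁ ls ≡ es → Card≤ w (λ ψ → Q ψ × All (Respects ψ) ls) K) →
        Card≤ w (λ ψ → Q ψ × All (Embeds ψ) es) (4 ^ length es * K)
      Card≤-label {w} {K} []       {Q} bound = subst (Card≤ w (λ ψ → Q ψ × All (Embeds ψ) [])) (sym (ℕ.+-identityʳ K))
        (Card≤-⊆ {w = w} (λ (q , _) → q , []) (bound [] refl))
      Card≤-label {w} {K} (e ∷ es) {Q} bound = subst (Card≤ w (λ ψ → Q ψ × All (Embeds ψ) (e ∷ es))) (sym (ℕ.*-assoc 4 (4 ^ length es) K))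
        (Card≤-cover {w = w} {R = λ lab ψ → Respects ψ (e , lab)}
          (λ lab ψ → step? (proj₁ lab) (lookup ψ (parent (e , lab))) (lookup ψ (child (e , lab)))) labels (λ {ψ} → label {ψ} ∘ All.head ∘ proj₂)
          (λ lab → Card≤-⊆ {w = w} (λ ((q , embs) , r) → (q , r) , All.tail embs)
            (Card≤-label {w} es {λ ψ → Q ψ × Respects ψ (e , lab)} (λ ls eq → Card≤-⊆ {w = w} (λ ((q , r) , rs) → q , r ∷ rs) (bound ((e , lab) ∷ ls) (cong (e ∷_) eq))))))
        where
        label : ∀ {ψ} → Embeds ψ e → Any (λ lab → Respects ψ (e , lab)) labels
        label (false , inj₁ st) = here st
        label (false , inj₂ st) = there (here st)
        label (true , inj₁ st)  = there (there (here st))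
        label (true , inj₂ st)  = there (there (there (here st)))

    -- Per edge, 4 accounts for the label and 16 for the loss in `Card≤-labelled`.
    Card≤-embeddings : ∀ {es} → Unique es → All Ordered es →
      Card≤ (n ^ length es) (λ ψ → Injective ψ × All (Embeds ψ) es) (64 ^ length es * falling n n)
    Card≤-embeddings {es} es! ordered = subst (Card≤ (n ^ length es) (λ ψ → Injective ψ × All (Embeds ψ) es))
      (trans (sym (ℕ.*-assoc (4 ^ length es) (16 ^ length es) (falling n n))) (cong (_* falling n n) (sym (^-distribʳ-* (length es) 4 16))))
      (Card≤-label {n ^ length es} es {Injective} labelled)
      where
      labelled : ∀ ls → map proj₁ ls ≡ es → Card≤ (n ^ length es) (λ ψ → Injective ψ × All (Respects ψ) ls) (16 ^ length es * falling n n)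
      labelled ls refl = subst (λ k → Card≤ (n ^ k) (λ ψ → Injective ψ × All (Respects ψ) ls) (16 ^ k * falling n n))
        (sym (List.length-map proj₁ ls)) (Card≤-labelled {ls} es! (All.map⁻ ordered))

  module Selection where
    private variable
      A : Set

    select : (xs : List A) → Subset (length xs) → List A
    select []       []            = []
    select (x ∷ xs) (inside ∷ U)  = x ∷ select xs U
    select (x ∷ xs) (outside ∷ U) = select xs U

    length-select : ∀ (xs : List A) U → length (select xs U) ≡ ∣ U ∣
    length-select []       []            = refl
    length-select (x ∷ xs) (inside ∷ U)  = cong suc (length-select xs U)
    length-select (x ∷ xs) (outside ∷ U) = length-select xs U

    select-All : ∀ {P : A → Set} {xs} U → All P xs → All P (select xs U)
    select-All []            []         = []
    select-All (inside ∷ U)  (Px ∷ Pxs) = Px ∷ select-All U Pxs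
    select-All (outside ∷ U) (Px ∷ Pxs) = select-All U Pxs

    select-unique : ∀ {xs : List A} U → Unique xs → Unique (select xs U)
    select-unique []            []          = []
    select-unique (inside ∷ U)  (x∉ ∷ xs!) = select-All U x∉ ∷ select-unique U xs!
    select-unique (outside ∷ U) (x∉ ∷ xs!) = select-unique U xs!

    module _ {P : A → Set} (P? : Decidable P) where
      satisfying : (xs : List A) → Subset (length xs)
      satisfying []       = []
      satisfying (x ∷ xs) = does (P? x) ∷ satisfying xs

      ⊆satisfying : ∀ xs U → U ⊆ satisfying xs → All P (select xs U)
      ⊆satisfying []       []            U⊆ = []
      ⊆satisfying (x ∷ xs) (outside ∷ U) U⊆ = ⊆satisfying xs U (S.drop-∷-⊆ U⊆)
      ⊆satisfying (x ∷ xs) (inside ∷ U)  U⊆ with P? x | U⊆ here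
      ... | yes Px | _ = Px ∷ ⊆satisfying xs U (λ x∈ → S.drop-there (U⊆ (there x∈)))

      ∈satisfying : ∀ {x xs} (x∈ : x ∈ xs) → P x → Any.index x∈ ∈ₛ satisfying xs
      ∈satisfying {x} {_ ∷ xs} (here refl) Px = subst (λ b → zero ∈ₛ b ∷ satisfying xs) (sym (dec-true (P? x) Px)) here
      ∈satisfying (there x∈)  Px = there (∈satisfying x∈ Px)

  open Selection public

  -- The family of copies of the comb and its spread.

  module CombEmbeddings (q k : ℕ) where
    n : ℕ
    n = q * k

    -- The comb is oriented away from its corner `(0 , 0)`. A vertex may have two children, which is
    -- why the two kinds of step are distinguished: the kind and the parent then determine the
    -- child.
    CombStep : Bool → Fin q × Fin k → Fin q × Fin k → Set
    CombStep false (i , a) (j , b) = i ≡ j × suc (toℕ a) ≡ toℕ b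
    CombStep true  (i , a) (j , b) = toℕ a ≡ 0 × toℕ b ≡ 0 × suc (toℕ i) ≡ toℕ j

    Step : Bool → Fin n → Fin n → Set
    Step t x y = CombStep t (remQuot k x) (remQuot k y)

    private
      step? : ∀ t x y → Dec (Step t x y)
      step? false x y = proj₁ (remQuot {q} k x) Fin.≟ proj₁ (remQuot {q} k y) ×-dec suc (toℕ (proj₂ (remQuot {q} k x))) ℕ.≟ toℕ (proj₂ (remQuot {q} k y))
      step? true  x y = toℕ (proj₂ (remQuot {q} k x)) ℕ.≟ 0 ×-dec toℕ (proj₂ (remQuot {q} k y)) ℕ.≟ 0 ×-dec suc (toℕ (proj₁ (remQuot {q} k x))) ℕ.≟ toℕ (proj₁ (remQuot {q} k y))

      remQuot-injective : ∀ {x y : Fin n} → remQuot {q} k x ≡ remQuot k y → x ≡ y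
      remQuot-injective {x} {y} eq = trans (sym (Fin.combine-remQuot {q} k x)) (trans (cong (λ (i , a) → combine i a) eq) (Fin.combine-remQuot {q} k y))

      functional : ∀ t {u v w} → CombStep t u v → CombStep t u w → v ≡ w
      functional false (refl , a≡) (refl , a≡′) = cong (_ ,_) (Fin.toℕ-injective (trans (sym a≡) a≡′))
      functional true  (_ , b≡0 , i≡) (_ , b′≡0 , i≡′) = cong₂ _,_ (Fin.toℕ-injective (trans (sym i≡) i≡′)) (Fin.toℕ-injective (trans b≡0 (sym b′≡0)))

      unique : ∀ t t′ {u v w} → CombStep t u w → CombStep t′ v w → u ≡ v
      unique false false (refl , a≡) (refl , a≡′) = cong (_ ,_) (Fin.toℕ-injective (ℕ.suc-injective (trans a≡ (sym a≡′))))
      unique true  true  (a≡0 , _ , i≡) (a′≡0 , _ , i≡′) = cong₂ _,_ (Fin.toℕ-injective (ℕ.suc-injective (trans i≡ (sym i≡′)))) (Fin.toℕ-injective (trans a≡0 (sym a′≡0)))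
      unique false true  (_ , a≡) (_ , c≡0 , _) = contradiction (trans a≡ c≡0) λ ()
      unique true  false (_ , c≡0 , _) (_ , a≡) = contradiction (trans a≡ c≡0) λ ()

      -- The distance from the corner `(0 , 0)` in the comb.
      depth : Fin q × Fin k → ℕ
      depth (i , a) = toℕ i + toℕ a

      deepens : ∀ t {u v} → CombStep t u v → depth u < depth v
      deepens false {i , a} (refl , a≡) = subst (λ b → toℕ i + toℕ a < toℕ i + b) a≡ (ℕ.+-monoʳ-< (toℕ i) (ℕ.n<1+n (toℕ a)))
      deepens true {i , a} {j , b} (a≡0 , b≡0 , i≡) = ℕ.+-mono-<-≤ (ℕ.≤-reflexive i≡) (ℕ.≤-reflexive (trans a≡0 (sym b≡0)))

    open ForestCount Step step? (λ {t} st st′ → remQuot-injective (functional t st st′))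
      (λ {t} {t′} st st′ → remQuot-injective (unique t t′ st st′)) (depth ∘ remQuot k) (λ {t} → deepens t)
      using (Embeds; Card≤-embeddings)

    embeds? : ∀ ψ e → Dec (Embeds ψ e)
    embeds? ψ (u , v) = map′ Sum.[ (false ,_) , (true ,_) ]
      (λ { (false , emb) → inj₁ emb ; (true , emb) → inj₂ emb }) (either false ⊎-dec either true)
      where
      either : ∀ t → Dec (Step t (lookup ψ u) (lookup ψ v) ⊎ Step t (lookup ψ v) (lookup ψ u))
      either t = step? t (lookup ψ u) (lookup ψ v) ⊎-dec step? t (lookup ψ v) (lookup ψ u)

    N : ℕ
    N = length (possibleEdges n)

    length-cartesianProduct : ∀ {A B : Set} (xs : List A) (ys : List B) → length (List.cartesianProduct xs ys) ≡ length xs * length ys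
    length-cartesianProduct []       ys = refl
    length-cartesianProduct (x ∷ xs) ys = trans (List.length-++ (map (x ,_) ys))
      (cong₂ _+_ (List.length-map (x ,_) ys) (length-cartesianProduct xs ys))

    -- This crude bound on the number of edges of a copy is good enough, because only its logarithm
    -- matters, as the number of rounds.
    N≤n² : N ≤ n * n
    N≤n² = ℕ.≤-trans (List.length-filter _ (List.cartesianProduct (allFin n) (allFin n)))
      (ℕ.≤-reflexive (trans (length-cartesianProduct (allFin n) (allFin n)) (cong₂ _*_ (List.length-tabulate {n = n} id) (List.length-tabulate {n = n} id))))

    possibleEdges-unique : Unique (possibleEdges n)
    possibleEdges-unique = Unique.filter⁺ _ (Unique.cartesianProduct⁺ (Unique.allFin⁺ n) (Unique.allFin⁺ n))

    -- `ψ` runs from the vertices of the random graph to those of the comb, opposite to a copy, so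
    -- whether an edge belongs to the copy is read off from the values at its ends.
    edgeSet : Word n n → Subset N
    edgeSet ψ = satisfying (embeds? ψ) (possibleEdges n)

    edgeSet-spread : ∀ U → n ^ ∣ U ∣ * length (filter (λ ψ → U S.⊆? edgeSet ψ) (words n n)) ≤ 64 ^ ∣ U ∣ * falling n n
    edgeSet-spread U = subst (λ s → n ^ s * length good ≤ 64 ^ s * falling n n) (length-select (possibleEdges n) U)
      (Card≤-embeddings (select-unique U possibleEdges-unique) (select-All U (All.all-filter _ (List.cartesianProduct (allFin n) (allFin n))))
        good (Unique.filter⁺ _ (words-unique n))
        (All.zip (All.filter⁺ _ (words-injective n) , All.map {P = λ ψ → U ⊆ edgeSet ψ} (λ {ψ} U⊆ → ⊆satisfying (embeds? ψ) (possibleEdges n) U U⊆) (All.all-filter (λ ψ → U S.⊆? edgeSet ψ) (words n n)))))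
      where good = filter (λ ψ → U S.⊆? edgeSet ψ) (words n n)

    injective⇒surjective : ∀ {ψ : Word n n} → Injective ψ → ∀ y → ∃[ x ] lookup ψ x ≡ y
    injective⇒surjective {ψ} inj y with y ∈? map (lookup ψ) (allFin n)
    ... | yes y∈ with L.∈-map⁻ (lookup ψ) y∈
    ...   | x , _ , eq = x , sym eq
    injective⇒surjective {ψ} inj y | no y∉ = contradiction (length-others (Unique.map⁺ inj (Unique.allFin⁺ n))) (ℕ.<⇒≢ tooMany ∘ sym)
      where
      tooMany : n < length (map (lookup ψ) (allFin n)) + length (others (map (lookup ψ) (allFin n)))
      tooMany = subst₂ _≤_ (ℕ.+-comm n 1) (cong (_+ length (others (map (lookup ψ) (allFin n)))) (sym (trans (List.length-map (lookup ψ) (allFin n)) (List.length-tabulate {n = n} id))))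
        (ℕ.+-monoʳ-≤ n (nonempty (L.∈-filter⁺ (λ i → ¬? (i ∈? map (lookup ψ) (allFin n))) (L.∈-allFin y) y∉)))
        where
        nonempty : ∀ {A : Set} {x : A} {xs} → x ∈ xs → 1 ≤ length xs
        nonempty (here _)  = s≤s z≤n
        nonempty (there _) = s≤s z≤n

    edgeSet⊆⇒containsCopy : ∀ {ψ} → Injective ψ → ∀ (ω : Outcome n) → edgeSet ψ ⊆ ω → ContainsCopy (graph ω) (Comb n k (divides q refl))
    edgeSet⊆⇒containsCopy {ψ} inj ω E⊆ω = f , f-injective , λ {u} {v} → f-hom {u} {v}
      where
      f : Fin q × Fin k → Fin n
      f (i , a) = proj₁ (injective⇒surjective {ψ} inj (combine i a))
      ψf : ∀ u → remQuot k (lookup ψ (f u)) ≡ u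
      ψf (i , a) = trans (cong (remQuot k) (proj₂ (injective⇒surjective {ψ} inj (combine i a)))) (Fin.remQuot-combine i a)
      f-injective : ∀ {u v} → f u ≡ f v → u ≡ v
      f-injective {u} {v} eq = trans (sym (ψf u)) (trans (cong (remQuot k ∘ lookup ψ) eq) (ψf v))
      step : ∀ {u v} → CombAdj u v → ∃[ t ] (CombStep t u v ⊎ CombStep t v u)
      step (inj₁ (i≡j , inj₁ ab)) = false , inj₁ (i≡j , ab)
      step (inj₁ (i≡j , inj₂ ba)) = false , inj₂ (sym i≡j , ba)
      step (inj₂ (a≡0 , b≡0 , inj₁ ij)) = true , inj₁ (a≡0 , b≡0 , ij)
      step (inj₂ (a≡0 , b≡0 , inj₂ ji)) = true , inj₂ (b≡0 , a≡0 , ji)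
      present : ∀ {x y} → x Fin.< y → Embeds ψ (x , y) → ∃[ e ] e ∈ₛ ω × List.lookup (possibleEdges n) e ≡ (x , y)
      present {x} {y} x<y emb = Any.index xy∈ , E⊆ω (∈satisfying (embeds? ψ) xy∈ emb) , sym (Any.lookup-index xy∈)
        where
        xy∈ : (x , y) ∈ possibleEdges n
        xy∈ = L.∈-filter⁺ _ (L.∈-cartesianProduct⁺ (L.∈-allFin x) (L.∈-allFin y)) x<y
      f-hom : ∀ {u v} → CombAdj u v → SimpleGraph.Adj (graph ω) (f u) (f v)
      -- Each possible edge is listed with its smaller end first, so the order of the two images
      -- decides in which direction it is looked up. Equal images are excluded because a step
      -- strictly increases `depth`.
      f-hom {u} {v} uv with step uv | Fin.<-cmp (f u) (f v)
      ... | t , st | tri< fu<fv _ _ with present fu<fv (t , subst₂ (λ u v → CombStep t u v ⊎ CombStep t v u) (sym (ψf u)) (sym (ψf v)) st)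
      ...   | e , e∈ω , eq = e , e∈ω , inj₁ eq
      f-hom {u} {v} uv | t , st | tri> _ _ fv<fu with present fv<fu (t , subst₂ (λ u v → CombStep t v u ⊎ CombStep t u v) (sym (ψf u)) (sym (ψf v)) (Sum.swap st))
      ...   | e , e∈ω , eq = e , e∈ω , inj₂ eq
      f-hom {u} {v} uv | t , st | tri≈ _ fu≡fv _ with f-injective {u} {v} fu≡fv
      ...   | refl = contradiction (Sum.[_,_]′ {C = depth u < depth u} (deepens t) (deepens t) st) (ℕ.<-irrefl refl)

module Estimates where
  open import Algebra.Properties.CommutativeSemiring.Exp (CommutativeRing.commutativeSemiring ℚ.+-*-commutativeRing) using (^-distrib-*)
  open import Data.Fin.Subset using (Subset; inside; outside; _⊆_; ∣_∣)
  open import Data.List.Membership.Propositional using (find)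
  open import Data.Rational.Base using (_+_; _*_; _-_; -_; _≤_; _<_)
  open D using (ℝ; approx; SimpleGraph; graph; possibleEdges; containsCopy?; Comb; ℙ[𝒢_,_⊨_]; sumSubsets; weight; reciprocalSum; logRiemannSum; log; fromℚ; 0ℝ; 1ℝ; _⟶_)
  open RandomSubsets
  open Embeddings

  module Casts where
    open import Data.Integer.Base using (+_)

    ι : ℕ → ℚ
    ι n = + n ℚ./ 1

    recip : (n : ℕ) → .{{NonZero n}} → ℚ
    recip n = + 1 ℚ./ n

    private
      toℚᵘ-ι : ∀ n → ℚ.toℚᵘ (ι n) ℚᵘ.≃ mkℚᵘ (+ n) 0
      toℚᵘ-ι n = ℚ.toℚᵘ-fromℚᵘ (mkℚᵘ (+ n) 0)

      open import Relation.Binary.Reasoning.Setoid ℚᵘ.≃-setoid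

    ι-+ : ∀ m n → ι (m ℕ.+ n) ≡ ι m + ι n
    ι-+ m n = ℚ.toℚᵘ-injective (begin
      ℚ.toℚᵘ (ι (m ℕ.+ n))               ≈⟨ toℚᵘ-ι (m ℕ.+ n) ⟩
      mkℚᵘ (+ (m ℕ.+ n)) 0               ≈⟨ *≡* (solve 2 (λ m n → (m :+ n) :* con (+ 1) := (m :* con (+ 1) :+ n :* con (+ 1)) :* con (+ 1)) refl (+ m) (+ n)) ⟩
      mkℚᵘ (+ m) 0 ℚᵘ.+ mkℚᵘ (+ n) 0     ≈⟨ ℚᵘ.+-cong (toℚᵘ-ι m) (toℚᵘ-ι n) ⟨
      ℚ.toℚᵘ (ι m) ℚᵘ.+ ℚ.toℚᵘ (ι n)     ≈⟨ ℚ.toℚᵘ-homo-+ (ι m) (ι n) ⟨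
      ℚ.toℚᵘ (ι m + ι n)                 ∎)
      where open ℤ.+-*-Solver

    ι-* : ∀ m n → ι (m ℕ.* n) ≡ ι m * ι n
    ι-* m n = ℚ.toℚᵘ-injective (begin
      ℚ.toℚᵘ (ι (m ℕ.* n))               ≈⟨ toℚᵘ-ι (m ℕ.* n) ⟩
      mkℚᵘ (+ (m ℕ.* n)) 0               ≈⟨ *≡* (cong (ℤ._* + 1) (ℤ.pos-* m n)) ⟩
      mkℚᵘ (+ m) 0 ℚᵘ.* mkℚᵘ (+ n) 0     ≈⟨ ℚᵘ.*-cong (toℚᵘ-ι m) (toℚᵘ-ι n) ⟨
      ℚ.toℚᵘ (ι m) ℚᵘ.* ℚ.toℚᵘ (ι n)     ≈⟨ ℚ.toℚᵘ-homo-* (ι m) (ι n) ⟨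
      ℚ.toℚᵘ (ι m * ι n)                 ∎)

    ι-recip : ∀ n .{{_ : NonZero n}} → ι n * recip n ≡ 1ℚ
    ι-recip (suc n) = ℚ.toℚᵘ-injective (begin
      ℚ.toℚᵘ (ι (suc n) * recip (suc n))                 ≈⟨ ℚ.toℚᵘ-homo-* (ι (suc n)) (recip (suc n)) ⟩
      ℚ.toℚᵘ (ι (suc n)) ℚᵘ.* ℚ.toℚᵘ (recip (suc n))     ≈⟨ ℚᵘ.*-cong (toℚᵘ-ι (suc n)) (ℚ.toℚᵘ-fromℚᵘ (mkℚᵘ (+ 1) n)) ⟩
      mkℚᵘ (+ suc n) 0 ℚᵘ.* mkℚᵘ (+ 1) n                 ≈⟨ *≡* (solve 1 (λ n → n :* con (+ 1) :* con (+ 1) := con (+ 1) :* (con (+ 1) :* n)) refl (+ suc n)) ⟩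
      ℚ.toℚᵘ 1ℚ                                          ∎)
      where open ℤ.+-*-Solver

    0≤ι : ∀ n → 0ℚ ≤ ι n
    0≤ι n = ℚ.nonNegative⁻¹ (ι n) {{ℚ.normalize-nonNeg n 1}}

    ι-mono : ∀ {m n} → m ℕ.≤ n → ι m ≤ ι n
    ι-mono {m} {n} m≤n = subst₂ _≤_ (ℚ.+-identityʳ (ι m)) (trans (sym (ι-+ m (n ℕ.∸ m))) (cong ι (ℕ.m+[n∸m]≡n m≤n)))
      (ℚ.+-monoʳ-≤ (ι m) (0≤ι (n ℕ.∸ m)))

    ι-suc : ∀ n → ι (suc n) ≡ 1ℚ + ι n
    ι-suc = ι-+ 1

    ι-^ : ∀ m k → ι (m ℕ.^ k) ≡ ι m ^ k
    ι-^ m zero    = refl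
    ι-^ m (suc k) = trans (ι-* m (m ℕ.^ k)) (cong (ι m *_) (ι-^ m k))

    0≤recip : ∀ n .{{_ : NonZero n}} → 0ℚ ≤ recip n
    0≤recip n = ℚ.nonNegative⁻¹ (recip n) {{ℚ.normalize-nonNeg 1 n}}

    ≤*recip : ∀ {x y} n .{{_ : NonZero n}} → x * ι n ≤ y → x ≤ y * recip n
    ≤*recip {x} {y} n xn≤y = subst (_≤ y * recip n)
      (trans (ℚ.*-assoc x (ι n) (recip n)) (trans (cong (x *_) (ι-recip n)) (ℚ.*-identityʳ x)))
      (*-monoˡ (0≤recip n) xn≤y)

    *recip≤ : ∀ {x y} n .{{_ : NonZero n}} → x ≤ y * ι n → x * recip n ≤ y
    *recip≤ {x} {y} n x≤yn = subst (x * recip n ≤_)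
      (trans (ℚ.*-assoc y (ι n) (recip n)) (trans (cong (y *_) (ι-recip n)) (ℚ.*-identityʳ y)))
      (*-monoˡ (0≤recip n) x≤yn)

    recip-anti : ∀ {m n} .{{_ : NonZero m}} .{{_ : NonZero n}} → m ℕ.≤ n → recip n ≤ recip m
    recip-anti {m} {n} m≤n = subst₂ _≤_ (ℚ.*-identityˡ (recip n)) refl
      (*recip≤ n (subst (_≤ recip m * ι n) (trans (ℚ.*-comm (recip m) (ι m)) (ι-recip m)) (*-monoʳ (0≤recip m) (ι-mono m≤n))))

    recip-below : ∀ {e} → 0ℚ < e → ∃[ d ] recip (suc d) ≤ e
    recip-below {mkℚ (+ zero) d c} (ℚ.*<* (ℤ.+<+ ()))
    recip-below {mkℚ (-[1+ _ ]) d c} (ℚ.*<* ())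
    recip-below {mkℚ (+ suc a) d c} _ = d , ℚ.toℚᵘ-cancel-≤ (ℚᵘ.≤-trans (ℚᵘ.≤-reflexive (ℚ.toℚᵘ-fromℚᵘ (mkℚᵘ (+ 1) d)))
      (ℚᵘ.*≤* (ℤ.*-monoʳ-≤-nonNeg (+ suc d) (ℤ.+≤+ {1} {suc a} (s≤s z≤n)))))

  open Casts

  -- Bounds for the Riemann sums of the logarithm.

  module LogBounds where
    private
      R : ℕ → ℕ → ℚ
      R a l = reciprocalSum (suc a) l

      R-+ : ∀ a k l → R a (k ℕ.+ l) ≡ R a k + R (a ℕ.+ k) l
      R-+ a zero    l = trans (cong (λ b → R b l) (sym (ℕ.+-identityʳ a))) (sym (ℚ.+-identityˡ _))
      R-+ a (suc k) l = trans (cong (λ x → recip (suc a) + x) (trans (R-+ (suc a) k l) (cong (λ b → R (suc a) k + R b l) (sym (ℕ.+-suc a k)))))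
        (sym (ℚ.+-assoc (recip (suc a)) (R (suc a) k) (R (a ℕ.+ suc k) l)))

      ≤R : ∀ a l b .{{_ : NonZero b}} → a ℕ.+ l ℕ.≤ b → ι l * recip b ≤ R a l
      ≤R a zero    b _ = ℚ.≤-reflexive (ℚ.*-zeroˡ (recip b))
      ≤R a (suc l) b a+l≤b = subst (_≤ R a (suc l))
        (sym (trans (cong (_* recip b) (ι-suc l)) (trans (ℚ.*-distribʳ-+ (recip b) 1ℚ (ι l)) (cong (_+ ι l * recip b) (ℚ.*-identityˡ (recip b))))))
        (ℚ.+-mono-≤ (recip-anti (ℕ.≤-trans (ℕ.m≤m+n (suc a) l) a+l<b)) (≤R (suc a) l b a+l<b))
        where
        a+l<b : suc (a ℕ.+ l) ℕ.≤ b
        a+l<b = subst (ℕ._≤ b) (ℕ.+-suc a l) a+l≤b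

      R≤ : ∀ a l b .{{_ : NonZero b}} → b ℕ.≤ suc a → R a l ≤ ι l * recip b
      R≤ a zero    b _ = ℚ.≤-reflexive (sym (ℚ.*-zeroˡ (recip b)))
      R≤ a (suc l) b b≤ = subst (R a (suc l) ≤_)
        (sym (trans (cong (_* recip b) (ι-suc l)) (trans (ℚ.*-distribʳ-+ (recip b) 1ℚ (ι l)) (cong (_+ ι l * recip b) (ℚ.*-identityˡ (recip b))))))
        (ℚ.+-mono-≤ (recip-anti b≤) (R≤ (suc a) l b (ℕ.≤-trans b≤ (ℕ.n≤1+n (suc a)))))

      0≤R : ∀ a l → 0ℚ ≤ R a l
      0≤R a zero    = ℚ.≤-refl
      0≤R a (suc l) = 0≤+ (0≤recip (suc a)) (0≤R (suc a) l)

      double : ∀ A X → A ℕ.* (2 ℕ.* X) ≡ (A ℕ.+ A) ℕ.* X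
      double = solve 2 (λ A X → A :* (con 2 :* X) := (A :+ A) :* X) refl
        where open ℕ.+-*-Solver

      -- Oresme's grouping: with `A = a + 1`, the first `A` terms are at least `1/(2A)` each and add
      -- up to at least `½`; the next block starts at `2A`.
      ℓ/2≤R : ∀ ℓ a l → suc a ℕ.* 2 ℕ.^ ℓ ℕ.≤ suc a ℕ.+ l → ι ℓ * ½ ≤ R a l
      ℓ/2≤R zero    a l _ = ℚ.≤-trans (ℚ.≤-reflexive (ℚ.*-zeroˡ ½)) (0≤R a l)
      ℓ/2≤R (suc ℓ) a l big = subst (λ l → ι (suc ℓ) * ½ ≤ R a l) (ℕ.m+[n∸m]≡n A≤l) (begin
        ι (suc ℓ) * ½             ≡⟨ cong (_* ½) (ι-suc ℓ) ⟩
        (1ℚ + ι ℓ) * ½            ≡⟨ solve 1 (λ x → (con 1ℚ :+ x) :* con ½ := con ½ :+ x :* con ½) refl (ι ℓ) ⟩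
        ½ + ι ℓ * ½               ≤⟨ ℚ.+-mono-≤ first (ℓ/2≤R ℓ (a ℕ.+ A) l′ rest) ⟩
        R a A + R (a ℕ.+ A) l′    ≡⟨ R-+ a A l′ ⟨
        R a (A ℕ.+ l′)            ∎)
        where
        open ℚ.≤-Reasoning
        open +-*-Solver
        A = suc a
        l′ = l ℕ.∸ A
        A≤l : A ℕ.≤ l
        A≤l = ℕ.+-cancelˡ-≤ A A l (ℕ.≤-trans (ℕ.≤-trans (ℕ.≤-reflexive (sym (ℕ.*-identityʳ (A ℕ.+ A)))) (ℕ.*-monoʳ-≤ (A ℕ.+ A) (ℕ.m^n>0 2 ℓ)))
          (subst (ℕ._≤ A ℕ.+ l) (double A (2 ℕ.^ ℓ)) big))
        rest : (A ℕ.+ A) ℕ.* 2 ℕ.^ ℓ ℕ.≤ A ℕ.+ A ℕ.+ l′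
        rest = subst₂ ℕ._≤_ (double A (2 ℕ.^ ℓ)) (trans (cong (A ℕ.+_) (sym (ℕ.m+[n∸m]≡n A≤l))) (sym (ℕ.+-assoc A A l′))) big
        first : ½ ≤ R a A
        first = ℚ.≤-trans (≤*recip {½} {ι A} (A ℕ.+ A) (ℚ.≤-reflexive (trans (cong (½ *_) (ι-+ A A)) (solve 1 (λ x → con ½ :* (x :+ x) := x) refl (ι A)))))
          (≤R a A (A ℕ.+ A) (ℕ.+-monoˡ-≤ A (ℕ.n≤1+n a)))

      -- In the same blocks, `A` terms are at most `1/A` each and add up to at most 1; an incomplete
      -- last block is no larger.
      R≤ℓ : ∀ ℓ a l → suc a ℕ.+ l ℕ.≤ suc a ℕ.* 2 ℕ.^ ℓ → R a l ≤ ι ℓ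
      R≤ℓ zero    a zero    small = ℚ.≤-refl
      R≤ℓ zero    a (suc l) small = contradiction (ℕ.≤-trans small (ℕ.≤-reflexive (ℕ.*-identityʳ (suc a)))) (ℕ.m+1+n≰m (suc a))
      R≤ℓ (suc ℓ) a l small with ℕ.≤-total l (suc a)
      ... | inj₁ l≤A = ℚ.≤-trans (R≤ a l (suc a) ℕ.≤-refl) (ℚ.≤-trans (*recip≤ {y = 1ℚ} (suc a) (subst (ι l ≤_) (sym (ℚ.*-identityˡ (ι (suc a)))) (ι-mono l≤A)))
        (ι-mono {1} {suc ℓ} (s≤s z≤n)))
      ... | inj₂ A≤l = subst (λ l → R a l ≤ ι (suc ℓ)) (ℕ.m+[n∸m]≡n A≤l) (begin
        R a (A ℕ.+ l′)            ≡⟨ R-+ a A l′ ⟩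
        R a A + R (a ℕ.+ A) l′    ≤⟨ ℚ.+-mono-≤ (R≤ a A A ℕ.≤-refl) (R≤ℓ ℓ (a ℕ.+ A) l′ rest) ⟩
        ι A * recip A + ι ℓ       ≡⟨ cong (_+ ι ℓ) (ι-recip A) ⟩
        1ℚ + ι ℓ                  ≡⟨ ι-suc ℓ ⟨
        ι (suc ℓ)                 ∎)
        where
        open ℚ.≤-Reasoning
        A = suc a
        l′ = l ℕ.∸ A
        rest : A ℕ.+ A ℕ.+ l′ ℕ.≤ (A ℕ.+ A) ℕ.* 2 ℕ.^ ℓ
        rest = subst₂ ℕ._≤_ (trans (cong (A ℕ.+_) (sym (ℕ.m+[n∸m]≡n A≤l))) (sym (ℕ.+-assoc A A l′))) (double A (2 ℕ.^ ℓ)) small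

      logRiemannSum≡R : ∀ n m → logRiemannSum n m ≡ R (pred (2 ℕ.^ m)) (2 ℕ.^ m ℕ.* pred n)
      logRiemannSum≡R n m = reciprocalSum-cong {l = 2 ℕ.^ m ℕ.* pred n} {{ℕ.m^n≢0 2 m}} (sym (ℕ.suc-pred (2 ℕ.^ m) {{ℕ.m^n≢0 2 m}}))
        where
        reciprocalSum-cong : ∀ {a b l} .{{_ : NonZero a}} .{{_ : NonZero b}} → a ≡ b → reciprocalSum a l ≡ reciprocalSum b l
        reciprocalSum-cong refl = refl

      end : ∀ n m .{{_ : NonZero n}} → suc (pred (2 ℕ.^ m)) ℕ.+ 2 ℕ.^ m ℕ.* pred n ≡ suc (pred (2 ℕ.^ m)) ℕ.* n
      end (suc n) m = subst (λ A → A ℕ.+ 2 ℕ.^ m ℕ.* n ≡ A ℕ.* suc n) (sym (ℕ.suc-pred (2 ℕ.^ m) {{ℕ.m^n≢0 2 m}})) (sym (ℕ.*-suc (2 ℕ.^ m) n))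

    module _ {n : ℕ} .{{_ : NonZero n}} (ℓ m : ℕ) where
      -- The denominators run from `A = 2^m` up to, but excluding, `A n`, so the number of doublings
      -- depends on `n` alone and the bound is uniform in the mesh.
      logRiemannSum-lower : 2 ℕ.^ ℓ ℕ.≤ n → ι ℓ * ½ ≤ logRiemannSum n m
      logRiemannSum-lower 2^ℓ≤n = subst (ι ℓ * ½ ≤_) (sym (logRiemannSum≡R n m))
        (ℓ/2≤R ℓ (pred (2 ℕ.^ m)) (2 ℕ.^ m ℕ.* pred n) (subst (suc (pred (2 ℕ.^ m)) ℕ.* 2 ℕ.^ ℓ ℕ.≤_) (sym (end n m)) (ℕ.*-monoʳ-≤ (suc (pred (2 ℕ.^ m))) 2^ℓ≤n)))

      logRiemannSum-upper : n ℕ.≤ 2 ℕ.^ ℓ → logRiemannSum n m ≤ ι ℓ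
      logRiemannSum-upper n≤2^ℓ = subst (_≤ ι ℓ) (sym (logRiemannSum≡R n m))
        (R≤ℓ ℓ (pred (2 ℕ.^ m)) (2 ℕ.^ m ℕ.* pred n) (subst (ℕ._≤ suc (pred (2 ℕ.^ m)) ℕ.* 2 ℕ.^ ℓ) (sym (end n m)) (ℕ.*-monoʳ-≤ (suc (pred (2 ℕ.^ m))) n≤2^ℓ)))

  open LogBounds

  -- The probability of missing every copy of the comb.

  module CombProbability (q k : ℕ) .{{_ : NonZero (q ℕ.* k)}} where
    open CombEmbeddings q k

    M q̂ : ℚ
    M = ι (falling n n)
    q̂ = ι 64 * recip n

    combs : List (Subset N)
    combs = map edgeSet (words n n)

    private
      ∑1≡ι-length : ∀ {A : Set} (xs : List A) → ∑ xs (λ _ → 1ℚ) ≡ ι (length xs)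
      ∑1≡ι-length []       = refl
      ∑1≡ι-length (x ∷ xs) = trans (cong (1ℚ +_) (∑1≡ι-length xs)) (sym (ι-suc (length xs)))

      1^ : ∀ s → 1ℚ ^ s ≡ 1ℚ
      1^ zero    = refl
      1^ (suc s) = trans (ℚ.*-identityˡ (1ℚ ^ s)) (1^ s)

      1≤falling : ∀ m → 1 ℕ.≤ falling m m
      1≤falling zero    = s≤s z≤n
      1≤falling (suc m) = ℕ.*-mono-≤ {1} {suc m} (s≤s z≤n) (1≤falling m)

      0<M : 0ℚ < M
      0<M = ℚ.<-≤-trans (ℚ.positive⁻¹ 1ℚ) (ι-mono (1≤falling n))

    size-combs : size combs ≡ M
    size-combs = trans (∑-map (words n n) edgeSet (λ _ → 1ℚ)) (trans (∑1≡ι-length (words n n)) (cong ι (length-words n n)))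

    combs-spread : IsSpread M q̂ combs
    combs-spread U = begin
      ∑ combs (λ S → 𝟙 (U S.⊆? S))
        ≡⟨ ∑-map (words n n) edgeSet (λ S → 𝟙 (U S.⊆? S)) ⟩
      ∑ (words n n) (λ ψ → 𝟙 (U S.⊆? edgeSet ψ))
        ≤⟨ ∑-mono (words n n) (λ {ψ} _ → ℚ.≤-reflexive (sym (ℚ.*-identityʳ (𝟙 (U S.⊆? edgeSet ψ))))) ⟩
      ∑ (words n n) (λ ψ → 𝟙 (U S.⊆? edgeSet ψ) * 1ℚ)
        ≡⟨ ∑-filter (λ ψ → U S.⊆? edgeSet ψ) (words n n) (λ _ → 1ℚ) ⟨
      ∑ good (λ _ → 1ℚ)
        ≡⟨ ∑1≡ι-length good ⟩
      ι (length good)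
        ≡⟨ ℚ.*-identityʳ (ι (length good)) ⟨
      ι (length good) * 1ℚ
        -- The factor `(n · 1/n)^s = 1` brings in the `n^s` with which `edgeSet-spread` is stated.
        ≡⟨ cong (ι (length good) *_) (trans (sym (1^ s)) (trans (cong (_^ s) (sym (ι-recip n))) (^-distrib-* (ι n) (recip n) s))) ⟩
      ι (length good) * (ι n ^ s * recip n ^ s)
        ≡⟨ solve 3 (λ a b c → a :* (b :* c) := b :* a :* c) refl (ι (length good)) (ι n ^ s) (recip n ^ s) ⟩
      ι n ^ s * ι (length good) * recip n ^ s
        ≡⟨ cong (_* recip n ^ s) (trans (cong (_* ι (length good)) (sym (ι-^ n s))) (sym (ι-* (n ℕ.^ s) (length good)))) ⟩
      ι (n ℕ.^ s ℕ.* length good) * recip n ^ s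
        ≤⟨ *-monoˡ (0≤^ s (0≤recip n)) (ι-mono (edgeSet-spread U)) ⟩
      ι (64 ℕ.^ s ℕ.* falling n n) * recip n ^ s
        ≡⟨ cong (_* recip n ^ s) (trans (ι-* (64 ℕ.^ s) (falling n n)) (cong (_* M) (ι-^ 64 s))) ⟩
      ι 64 ^ s * M * recip n ^ s
        ≡⟨ solve 3 (λ a b c → a :* b :* c := b :* (a :* c)) refl (ι 64 ^ s) M (recip n ^ s) ⟩
      M * (ι 64 ^ s * recip n ^ s)
        ≡⟨ cong (M *_) (^-distrib-* (ι 64) (recip n) s) ⟨
      M * q̂ ^ s ∎
      where
      open ℚ.≤-Reasoning
      open +-*-Solver
      s = ∣ U ∣
      good = filter (λ ψ → U S.⊆? edgeSet ψ) (words n n)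

    combs-avoided : ∀ {ω} → ¬ D.ContainsCopy (graph {n} ω) (Comb n k (divides q refl)) → ¬ Any (_⊆ ω) combs
    combs-avoided {ω} none some with find (Any.map⁻ {f = edgeSet} some)
    ... | ψ , ψ∈ , E⊆ω = none (edgeSet⊆⇒containsCopy (All.lookup (words-injective n) ψ∈) ω E⊆ω)

    density-linear : ∀ p p₀ d → density p p₀ d ≡ ι d * p + p₀
    density-linear p p₀ zero    = sym (trans (cong (_+ p₀) (ℚ.*-zeroˡ p)) (ℚ.+-identityˡ p₀))
    density-linear p p₀ (suc d) = trans (cong (p +_) (density-linear p p₀ d))
      (trans (solve 3 (λ p p₀ x → p :+ (x :* p :+ p₀) := (con 1ℚ :+ x) :* p :+ p₀) refl p p₀ (ι d))
             (cong (λ x → x * p + p₀) (sym (ι-suc d))))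
      where open +-*-Solver

    -- The `d` halvings use sets of density `8 q̂`, matching `⅛`, and the last set has density
    -- `l q̂`, matching `r₀ = 1/l`. Their sum has to fit under `π`.
    comb-probability : (contains? : ∀ ω → Dec (D.ContainsCopy (graph {n} ω) (Comb n k (divides q refl)))) → ∀ j l d {π} .{{_ : NonZero l}} → n ℕ.* n ℕ.≤ 2 ℕ.^ (d ℕ.+ j) →
      (ι d * ι 8 + ι l) * q̂ ≤ π → π ≤ 1ℚ →
      1ℚ - 𝔼 π (𝟙 ∘ contains?) ≤ 2ℚ ^ (2 ℕ.^ j) * recip l + ½ ^ j * 2ℚ
    comb-probability contains? j l d {π} n²≤ dense π≤1 = begin
      1ℚ - 𝔼 π (𝟙 ∘ contains?)
        ≤⟨ ℚ.+-monoˡ-≤ (- 𝔼 π (𝟙 ∘ contains?)) covered ⟩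
      𝔼 π (𝟙 ∘ contains?) + 𝔼 π (𝟙 ∘ avoids? combs) - 𝔼 π (𝟙 ∘ contains?)
        ≡⟨ solve 2 (λ x y → x :+ y :- x := y) refl (𝔼 π (𝟙 ∘ contains?)) (𝔼 π (𝟙 ∘ avoids? combs)) ⟩
      𝔼 π (𝟙 ∘ avoids? combs)
        -- For the full family the size equals `M`, so the weight cancels and a bound for the
        -- probability itself remains.
        ≤⟨ ℚ.*-cancelˡ-≤-pos M {{ℚ.positive 0<M}} (subst (λ m → m * 𝔼 π (𝟙 ∘ avoids? combs) ≤ M * (2ℚ ^ (2 ℕ.^ j) * recip l + ½ ^ j * 2ℚ)) size-combs
             (spread-lemma (0≤ι (falling n n)) 0≤q̂ 0≤p q̂≤p⅛ 0≤p₀ (0≤recip l) (recip-anti {1} {l} (ℕ.>-nonZero⁻¹ l)) q̂≤p₀r₀ j d combs-spread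
               (All.map⁺ (All.universal (λ ψ → ℕ.≤-trans (S.∣p∣≤n (edgeSet ψ)) (ℕ.≤-trans N≤n² n²≤)) (words n n)))
               density≤π π≤1)) ⟩
      2ℚ ^ (2 ℕ.^ j) * recip l + ½ ^ j * 2ℚ ∎
      where
      open ℚ.≤-Reasoning
      open +-*-Solver
      p p₀ : ℚ
      p  = q̂ * ι 8
      p₀ = ι l * q̂
      0≤q̂ : 0ℚ ≤ q̂
      0≤q̂ = 0≤* (0≤ι 64) (0≤recip n)
      0≤p : 0ℚ ≤ p
      0≤p = 0≤* 0≤q̂ (0≤ι 8)
      0≤p₀ : 0ℚ ≤ p₀
      0≤p₀ = 0≤* (0≤ι l) 0≤q̂
      q̂≤p⅛ : q̂ ≤ p * ⅛
      q̂≤p⅛ = ℚ.≤-reflexive (sym (trans (ℚ.*-assoc q̂ (ι 8) ⅛) (ℚ.*-identityʳ q̂)))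
      q̂≤p₀r₀ : q̂ ≤ p₀ * recip l
      q̂≤p₀r₀ = ≤*recip l (ℚ.≤-reflexive (ℚ.*-comm q̂ (ι l)))
      density≤π : density p p₀ d ≤ π
      density≤π = ℚ.≤-trans (ℚ.≤-reflexive (trans (density-linear p p₀ d)
        (solve 4 (λ d e l q → d :* (q :* e) :+ l :* q := (d :* e :+ l) :* q) refl (ι d) (ι 8) (ι l) q̂))) dense
      0≤π : 0ℚ ≤ π
      0≤π = ℚ.≤-trans (0≤* (0≤+ (0≤* (0≤ι d) (0≤ι 8)) (0≤ι l)) 0≤q̂) dense
      covered : 1ℚ ≤ 𝔼 π (𝟙 ∘ contains?) + 𝔼 π (𝟙 ∘ avoids? combs)
      covered = begin
        1ℚ
          ≡⟨ 𝔼-const {N} π 1ℚ ⟨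
        𝔼 {N} π (λ _ → 1ℚ)
          ≤⟨ 𝔼-mono 0≤π π≤1 (λ ω → subst (λ x → 1ℚ ≤ x + 𝟙 (avoids? combs ω)) (ℚ.*-identityʳ (𝟙 (contains? ω))) (𝟙-cover (contains? ω) (avoids? combs ω) combs-avoided)) ⟩
        𝔼 π (λ ω → 𝟙 (contains? ω) + 𝟙 (avoids? combs ω))
          ≡⟨ 𝔼-+ π (𝟙 ∘ contains?) (𝟙 ∘ avoids? combs) ⟩
        𝔼 π (𝟙 ∘ contains?) + 𝔼 π (𝟙 ∘ avoids? combs) ∎

  -- The choice of `C` and the range of `n`.

  module Thresholds where
    floor-log : ∀ n .{{_ : NonZero n}} → ∃[ ℓ ] 2 ℕ.^ ℓ ℕ.≤ n × n ℕ.< 2 ℕ.^ suc ℓ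
    floor-log (suc zero)      = 0 , s≤s z≤n , s≤s (s≤s z≤n)
    floor-log (suc n@(suc _)) with floor-log n
    ... | ℓ , lower , upper with suc n ℕ.<? 2 ℕ.^ suc ℓ
    ...   | yes below = ℓ , ℕ.≤-trans lower (ℕ.n≤1+n n) , below
    ...   | no ¬below = suc ℓ , ℕ.≮⇒≥ ¬below , ℕ.≤-<-trans upper (ℕ.m<m+n (2 ℕ.^ suc ℓ) (subst (0 ℕ.<_) (sym (ℕ.+-identityʳ (2 ℕ.^ suc ℓ))) (ℕ.m^n>0 2 (suc ℓ))))

    2^-reflects-≤ : ∀ {a b n} → 2 ℕ.^ a ℕ.≤ n → n ℕ.< 2 ℕ.^ suc b → a ℕ.≤ b
    2^-reflects-≤ {a} {b} 2^a≤n n<2^1+b = ℕ.≮⇒≥ (λ b<a → ℕ.<⇒≱ n<2^1+b (ℕ.≤-trans (ℕ.^-monoʳ-≤ 2 b<a) 2^a≤n))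

    -- Since 8192 is `2^13`, the inequality first holds at `ℓ = 18`, where it reads `19 ≤ 32`. It
    -- ensures that `C log n / n` is at most 1.
    8192ℓ≤2^ℓ : ∀ {ℓ} → 18 ℕ.≤ ℓ → (4096 ℕ.+ 4096) ℕ.* suc ℓ ℕ.≤ 2 ℕ.^ ℓ
    8192ℓ≤2^ℓ {ℓ} 18≤ℓ = subst (λ ℓ → (4096 ℕ.+ 4096) ℕ.* suc ℓ ℕ.≤ 2 ℕ.^ ℓ) (ℕ.m∸n+n≡m 18≤ℓ) (go (ℓ ℕ.∸ 18))
      where
      go : ∀ t → (4096 ℕ.+ 4096) ℕ.* suc (t ℕ.+ 18) ℕ.≤ 2 ℕ.^ (t ℕ.+ 18)
      go zero    = ℕ.≤ᵇ⇒≤ ((4096 ℕ.+ 4096) ℕ.* 19) (2 ℕ.^ 18) tt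
      go (suc t) = begin
        a ℕ.* suc (suc b)              ≡⟨ ℕ.*-suc a (suc b) ⟩
        a ℕ.+ a ℕ.* suc b              ≤⟨ ℕ.+-monoˡ-≤ (a ℕ.* suc b) (ℕ.m≤m*n a (suc b)) ⟩
        a ℕ.* suc b ℕ.+ a ℕ.* suc b    ≤⟨ ℕ.+-mono-≤ (go t) (ℕ.≤-trans (go t) (ℕ.≤-reflexive (sym (ℕ.+-identityʳ (2 ℕ.^ b))))) ⟩
        2 ℕ.* 2 ℕ.^ b                  ∎
        where
        open ℕ.≤-Reasoning
        a = 4096 ℕ.+ 4096
        b = t ℕ.+ 18

    -- C = 2c, which makes up for the factor ½ in log n ≥ ½ ⌊log₂ n⌋.
    c : ℚ
    c = ι 4096

    module _ {n : ℕ} .{{_ : NonZero n}} {ℓ : ℕ} (2^ℓ≤n : 2 ℕ.^ ℓ ℕ.≤ n) (n<2^1+ℓ : n ℕ.< 2 ℕ.^ suc ℓ) (18≤ℓ : 18 ℕ.≤ ℓ) (m : ℕ) where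
      private
        open +-*-Solver
        S = logRiemannSum n m

      density≤1 : (c + c) * S * recip n ≤ 1ℚ
      density≤1 = *recip≤ n (begin
        (c + c) * S                              ≤⟨ *-monoʳ (0≤+ (0≤ι 4096) (0≤ι 4096)) (logRiemannSum-upper (suc ℓ) m (ℕ.<⇒≤ n<2^1+ℓ)) ⟩
        (c + c) * ι (suc ℓ)                      ≡⟨ trans (cong (_* ι (suc ℓ)) (sym (ι-+ 4096 4096))) (sym (ι-* (4096 ℕ.+ 4096) (suc ℓ))) ⟩
        ι ((4096 ℕ.+ 4096) ℕ.* suc ℓ)            ≤⟨ ι-mono (ℕ.≤-trans (8192ℓ≤2^ℓ 18≤ℓ) 2^ℓ≤n) ⟩
        ι n                                      ≡⟨ ℚ.*-identityˡ (ι n) ⟨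
        1ℚ * ι n                                 ∎)
        where open ℚ.≤-Reasoning

      density-large : ∀ {d l} → d ℕ.≤ suc ℓ ℕ.+ suc ℓ → l ℕ.≤ ℓ → (ι d * ι 8 + ι l) * (ι 64 * recip n) ≤ (c + c) * S * recip n
      density-large {d} {l} d≤ l≤ℓ = begin
        (ι d * ι 8 + ι l) * (ι 64 * recip n)     ≡⟨ ℚ.*-assoc (ι d * ι 8 + ι l) (ι 64) (recip n) ⟨
        (ι d * ι 8 + ι l) * ι 64 * recip n       ≡⟨ cong (λ x → x * ι 64 * recip n) (trans (cong (_+ ι l) (sym (ι-* d 8))) (sym (ι-+ (d ℕ.* 8) l))) ⟩
        ι (d ℕ.* 8 ℕ.+ l) * ι 64 * recip n       ≡⟨ cong (_* recip n) (ι-* (d ℕ.* 8 ℕ.+ l) 64) ⟨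
        ι ((d ℕ.* 8 ℕ.+ l) ℕ.* 64) * recip n     ≤⟨ *-monoˡ (0≤recip n) (ι-mono enough) ⟩
        ι (4096 ℕ.* ℓ) * recip n                 ≡⟨ cong (_* recip n) (trans (ι-* 4096 ℓ) (solve 2 (λ c x → c :* x := (c :+ c) :* (x :* con ½)) refl c (ι ℓ))) ⟩
        (c + c) * (ι ℓ * ½) * recip n            ≤⟨ *-monoˡ (0≤recip n) (*-monoʳ (0≤+ (0≤ι 4096) (0≤ι 4096)) (logRiemannSum-lower ℓ m 2^ℓ≤n)) ⟩
        (c + c) * S * recip n                    ∎
        where
        open ℚ.≤-Reasoning
        -- As `d ≤ 2(ℓ + 1) ≤ 4ℓ` and `l ≤ ℓ`, the required multiple of `ℓ/n` is
        -- `(4 · 8 + 1) · 64 = 2112`; the next power of two is 4096.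
        enough : (d ℕ.* 8 ℕ.+ l) ℕ.* 64 ℕ.≤ 4096 ℕ.* ℓ
        enough = ℕ.≤-trans (ℕ.*-monoˡ-≤ 64 (ℕ.+-mono-≤ (ℕ.*-monoˡ-≤ 8 (ℕ.≤-trans d≤ (ℕ.+-mono-≤ 1+ℓ≤2ℓ 1+ℓ≤2ℓ))) l≤ℓ))
          (ℕ.≤-trans (ℕ.≤-reflexive (solveℕ 1 (λ ℓ → ((ℓ :+ₙ ℓ :+ₙ (ℓ :+ₙ ℓ)) :*ₙ conₙ 8 :+ₙ ℓ) :*ₙ conₙ 64 :=ₙ conₙ 2112 :*ₙ ℓ) refl ℓ))
            (ℕ.*-monoˡ-≤ ℓ (ℕ.≤ᵇ⇒≤ 2112 4096 tt)))
          where
          open ℕ.+-*-Solver using () renaming (solve to solveℕ; _:+_ to _:+ₙ_; _:*_ to _:*ₙ_; con to conₙ; _:=_ to _:=ₙ_)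
          1+ℓ≤2ℓ : suc ℓ ℕ.≤ ℓ ℕ.+ ℓ
          1+ℓ≤2ℓ = ℕ.+-monoˡ-≤ ℓ (ℕ.≤-trans (s≤s z≤n) 18≤ℓ)

  open Thresholds

  -- Passage to the real probabilities and the limit.

  module Limit where
    -- `x` accumulates the weights of the elements already decided: in the recursion of `sumSubsets`
    -- every summand still carries its full weight, whereas `𝔼` takes each factor out at once.
    approx-sumSubsets : ∀ {N} (p : ℝ) m (f : Subset N → ℝ) (g : Subset N → ℚ) x →
      (∀ ω → approx (f ω) m ≡ x * (g ω * approx (weight p ω) m)) → approx (sumSubsets f) m ≡ x * 𝔼 (approx p m) g
    approx-sumSubsets {zero}  p m f g x eq = trans (eq []) (cong (x *_) (ℚ.*-identityʳ (g [])))
    approx-sumSubsets {suc N} p m f g x eq = begin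
      approx (sumSubsets (f ∘ (inside ∷_))) m + approx (sumSubsets (f ∘ (outside ∷_))) m
        ≡⟨ cong₂ _+_ (approx-sumSubsets p m (f ∘ (inside ∷_)) (g ∘ (inside ∷_)) (x * π) (split inside π (λ _ → refl)))
                     (approx-sumSubsets p m (f ∘ (outside ∷_)) (g ∘ (outside ∷_)) (x * (1ℚ - π)) (split outside (1ℚ - π) (λ _ → refl))) ⟩
      x * π * 𝔼 π (g ∘ (inside ∷_)) + x * (1ℚ - π) * 𝔼 π (g ∘ (outside ∷_))
        ≡⟨ solve 5 (λ x p r a b → x :* p :* a :+ x :* r :* b := x :* (p :* a :+ r :* b)) refl x π (1ℚ - π) (𝔼 π (g ∘ (inside ∷_))) (𝔼 π (g ∘ (outside ∷_))) ⟩
      x * (π * 𝔼 π (g ∘ (inside ∷_)) + (1ℚ - π) * 𝔼 π (g ∘ (outside ∷_))) ∎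
      where
      open ≡-Reasoning
      open +-*-Solver
      π = approx p m
      split : ∀ s y → (∀ ω → approx (weight p (s ∷ ω)) m ≡ y * approx (weight p ω) m) →
              ∀ ω → approx (f (s ∷ ω)) m ≡ x * y * (g (s ∷ ω) * approx (weight p ω) m)
      split s y wt ω = trans (eq (s ∷ ω)) (trans (cong (λ w → x * (g (s ∷ ω) * w)) (wt ω))
        (solve 4 (λ x y g w → x :* (g :* (y :* w)) := x :* y :* (g :* w)) refl x y (g (s ∷ ω)) (approx (weight p ω) m)))

    -- Real operations act termwise on approximations, so each approximation of the probability is
    -- itself an expectation at a rational density.
    approx-ℙ : ∀ n (p : ℝ) {A : SimpleGraph (Fin n) → Set} (A? : Decidable A) m →
               approx ℙ[𝒢 n , p ⊨ A? ] m ≡ 𝔼 (approx p m) (λ ω → 𝟙 (A? (graph {n} ω)))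
    approx-ℙ n p A? m = trans (approx-sumSubsets p m _ (λ ω → 𝟙 (A? (graph ω))) 1ℚ (λ ω → trans (cases (does (A? (graph ω))) ω) (sym (ℚ.*-identityˡ _)))) (ℚ.*-identityˡ _)
      where
      cases : ∀ b ω → approx (if b then weight p ω else 0ℝ) m ≡ (if b then 1ℚ else 0ℚ) * approx (weight p ω) m
      cases true  ω = sym (ℚ.*-identityˡ (approx (weight p ω) m))
      cases false ω = sym (ℚ.*-zeroˡ (approx (weight p ω) m))

    ½^-small : ∀ {e} d → recip (suc d) ≤ e → ½ ^ suc d ≤ e
    ½^-small d 1/D≤e = ℚ.≤-trans (subst (½ ^ D ≤_) (ℚ.*-identityˡ (recip D)) (≤*recip D (ℚ.≤-trans
      (*-monoʳ (0≤^ D 0≤½) (ι-mono (n≤2^n D)))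
      (ℚ.≤-reflexive (trans (cong (½ ^ D *_) (ι-^ 2 D)) (halve D)))))) 1/D≤e
      where
      open +-*-Solver
      D = suc d
      halve : ∀ k → ½ ^ k * ι 2 ^ k ≡ 1ℚ
      halve zero    = refl
      halve (suc k) = trans (solve 2 (λ x y → con ½ :* x :* (con (ι 2) :* y) := x :* y) refl (½ ^ k) (ι 2 ^ k)) (halve k)

    -- With `D = d + 1`, the choice of `l` turns the first summand into `1/(4D)`, and that of `j`
    -- turns the second into `½^D / 4`; each is at most `e/4`.
    error-small : ∀ {e} d j l .{{_ : NonZero l}} → recip (suc d) ≤ e → j ≡ 3 ℕ.+ suc d → l ≡ 2 ℕ.^ (2 ℕ.^ j) ℕ.* (4 ℕ.* suc d) →
                  2ℚ ^ (2 ℕ.^ j) * recip l + ½ ^ j * 2ℚ ≤ ½ * e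
    error-small {e} d j l 1/D≤e j≡ l≡ =
      ℚ.≤-trans (ℚ.+-mono-≤ {y = ½ * (½ * e)} first second) (ℚ.≤-reflexive (solve 1 (λ e → con ½ :* (con ½ :* e) :+ con ½ :* (con ½ :* e) := con ½ :* e) refl e))
      where
      open +-*-Solver
      D = suc d
      X = 2 ℕ.^ (2 ℕ.^ j)
      first : 2ℚ ^ (2 ℕ.^ j) * recip l ≤ ½ * (½ * e)
      first = *recip≤ l (begin
        2ℚ ^ (2 ℕ.^ j)                        ≡⟨ ι-^ 2 (2 ℕ.^ j) ⟨
        ι X                                   ≡⟨ ℚ.*-identityʳ (ι X) ⟨
        ι X * 1ℚ                              ≤⟨ *-monoʳ (0≤ι X) (ℚ.≤-trans (ℚ.≤-reflexive (sym (trans (ℚ.*-comm (recip D) (ι D)) (ι-recip D)))) (*-monoˡ (0≤ι D) 1/D≤e)) ⟩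
        ι X * (e * ι D)                       ≡⟨ solve 3 (λ x e d → x :* (e :* d) := con ½ :* (con ½ :* e) :* (x :* (con (ι 4) :* d))) refl (ι X) e (ι D) ⟩
        ½ * (½ * e) * (ι X * (ι 4 * ι D))     ≡⟨ cong (½ * (½ * e) *_) (trans (cong (ι X *_) (sym (ι-* 4 D))) (sym (ι-* X (4 ℕ.* D)))) ⟩
        ½ * (½ * e) * ι (X ℕ.* (4 ℕ.* D))     ≡⟨ cong (λ l → ½ * (½ * e) * ι l) l≡ ⟨
        ½ * (½ * e) * ι l                     ∎)
        where open ℚ.≤-Reasoning
      second : ½ ^ j * 2ℚ ≤ ½ * (½ * e)
      second = subst (_≤ ½ * (½ * e)) (trans (solve 1 (λ x → con ½ :* (con ½ :* x) := con ½ :* (con ½ :* (con ½ :* x)) :* con 2ℚ) refl (½ ^ D)) (cong (λ j → ½ ^ j * 2ℚ) (sym j≡)))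
        (*-monoʳ 0≤½ (*-monoʳ 0≤½ (½^-small d 1/D≤e)))

    module _ {e : ℚ} (j l : ℕ) .{{_ : NonZero l}} (small : 2ℚ ^ (2 ℕ.^ j) * recip l + ½ ^ j * 2ℚ ≤ ½ * e)
             (K : ℕ) (18≤K : 18 ℕ.≤ K) (j+l≤K : j ℕ.+ l ℕ.≤ K) where
      module _ (q k : ℕ) .{{_ : NonZero (q ℕ.* k)}} (large : 2 ℕ.^ K ℕ.≤ q ℕ.* k) (m : ℕ)
               (contains? : (ω : D.Outcome (q ℕ.* k)) → Dec (D.ContainsCopy (graph {q ℕ.* k} ω) (Comb (q ℕ.* k) k (divides q refl)))) where
        private
          n = q ℕ.* k
          π E : ℚ
          π = (c + c) * D.logRiemannSum n m * recip n
          E = 𝔼 π (λ ω → 𝟙 (contains? ω))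

        expectation-estimate : ∀ ℓ → 2 ℕ.^ ℓ ℕ.≤ n → n ℕ.< 2 ℕ.^ suc ℓ → ℚ.∣ E - 1ℚ ∣ ≤ ½ * e
        expectation-estimate ℓ 2^ℓ≤n n<2^1+ℓ = begin
          ℚ.∣ E - 1ℚ ∣            ≡⟨ ℚ.∣-p∣≡∣p∣ (E - 1ℚ) ⟨
          ℚ.∣ - (E - 1ℚ) ∣        ≡⟨ cong ℚ.∣_∣ (solve 1 (λ x → :- (x :- con 1ℚ) := con 1ℚ :- x) refl E) ⟩
          ℚ.∣ 1ℚ - E ∣            ≡⟨ ℚ.0≤p⇒∣p∣≡p (p≤q⇒0≤q-p E≤1) ⟩
          1ℚ - E                  ≤⟨ CombProbability.comb-probability q k contains? j l d n²≤ dense π≤1 ⟩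
          2ℚ ^ (2 ℕ.^ j) * recip l + ½ ^ j * 2ℚ ≤⟨ small ⟩
          ½ * e                   ∎
          where
          open ℚ.≤-Reasoning
          open +-*-Solver
          top d : ℕ
          top = suc ℓ ℕ.+ suc ℓ
          -- Sizes start below `2^top`, because `n²` does, and halving stops at `2^j`.
          d = top ℕ.∸ j
          K≤ℓ : K ℕ.≤ ℓ
          K≤ℓ = 2^-reflects-≤ large n<2^1+ℓ
          18≤ℓ : 18 ℕ.≤ ℓ
          18≤ℓ = ℕ.≤-trans 18≤K K≤ℓ
          j+l≤ℓ : j ℕ.+ l ℕ.≤ ℓ
          j+l≤ℓ = ℕ.≤-trans j+l≤K K≤ℓ
          l≤ℓ : l ℕ.≤ ℓ
          l≤ℓ = ℕ.m+n≤o⇒n≤o j j+l≤ℓ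
          j≤top : j ℕ.≤ top
          j≤top = ℕ.≤-trans (ℕ.m+n≤o⇒m≤o j j+l≤ℓ) (ℕ.≤-trans (ℕ.n≤1+n ℓ) (ℕ.m≤m+n (suc ℓ) (suc ℓ)))
          n²≤ : n ℕ.* n ℕ.≤ 2 ℕ.^ (d ℕ.+ j)
          n²≤ = subst (n ℕ.* n ℕ.≤_) (trans (sym (ℕ.^-distribˡ-+-* 2 (suc ℓ) (suc ℓ))) (cong (2 ℕ.^_) (sym (ℕ.m∸n+n≡m j≤top))))
            (ℕ.*-mono-≤ (ℕ.<⇒≤ n<2^1+ℓ) (ℕ.<⇒≤ n<2^1+ℓ))
          π≤1 : π ≤ 1ℚ
          π≤1 = density≤1 2^ℓ≤n n<2^1+ℓ 18≤ℓ m
          dense : (ι d * ι 8 + ι l) * (ι 64 * recip n) ≤ π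
          dense = density-large 2^ℓ≤n n<2^1+ℓ 18≤ℓ m (ℕ.m∸n≤m top j) l≤ℓ
          0≤π : 0ℚ ≤ π
          0≤π = ℚ.≤-trans (0≤* (0≤+ (0≤* (0≤ι d) (0≤ι 8)) (0≤ι l)) (0≤* (0≤ι 64) (0≤recip n))) dense
          E≤1 : E ≤ 1ℚ
          E≤1 = ℚ.≤-trans (𝔼-mono 0≤π π≤1 (λ ω → 𝟙≤1 (contains? ω))) (ℚ.≤-reflexive (𝔼-const {length (possibleEdges n)} π 1ℚ))

      comb-estimate : ∀ (p : ℝ) m n .{{_ : NonZero n}} → approx p m ≡ (c + c) * D.logRiemannSum n m * recip n →
        ∀ k (k∣n : k ∣ n) → 2 ℕ.^ K ℕ.≤ n → ℚ.∣ approx ℙ[𝒢 n , p ⊨ (λ G → containsCopy? G (Comb n k k∣n)) ] m - 1ℚ ∣ ≤ ½ * e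
      comb-estimate p m n eq k (divides q refl) large = let ℓ , 2^ℓ≤n , n<2^1+ℓ = floor-log n in
        subst (λ x → ℚ.∣ x - 1ℚ ∣ ≤ ½ * e)
          (trans (cong (λ π → 𝔼 π (λ ω → 𝟙 (contains? ω))) (sym eq)) (sym (approx-ℙ n p (λ G → containsCopy? G (Comb n k (divides q refl))) m)))
          (expectation-estimate q k large m contains? ℓ 2^ℓ≤n n<2^1+ℓ)
        where
        contains? : (ω : D.Outcome n) → Dec (D.ContainsCopy (graph ω) (Comb n k (divides q refl)))
        contains? ω = containsCopy? (graph ω) (Comb n k (divides q refl))

    -- The last random set has density 64 l / n, and the estimate holds for n ≥ 2^K.
    Constants : ℚ → Set
    Constants e = ∃[ j ] ∃[ l ] ∃[ K ] Σ[ l≢0 ∈ NonZero l ] 18 ℕ.≤ K × j ℕ.+ l ℕ.≤ K ×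
                  2ℚ ^ (2 ℕ.^ j) * recip l {{l≢0}} + ½ ^ j * 2ℚ ≤ ½ * e

    constants : ∀ {e} → 0ℚ < e → Constants e
    constants {e} e>0 = let d , 1/D≤e = recip-below e>0 in choose d 1/D≤e _ _ refl refl
      where
      choose : ∀ d → recip (suc d) ≤ e → ∀ j l → j ≡ 3 ℕ.+ suc d → l ≡ 2 ℕ.^ (2 ℕ.^ j) ℕ.* (4 ℕ.* suc d) → Constants e
      -- The 18 makes the density at most 1, `j` leaves room for stopping the rounds at `2^j`, and
      -- `l` keeps the last set within the density available.
      choose d 1/D≤e j l j≡ l≡ = j , l , 18 ℕ.+ (j ℕ.+ l) , l≢0 ,
        ℕ.m≤m+n 18 (j ℕ.+ l) , ℕ.m≤n+m (j ℕ.+ l) 18 , error-small d j l {{l≢0}} 1/D≤e j≡ l≡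
        where
        l≢0 : NonZero l
        l≢0 = subst NonZero (sym l≡) (ℕ.m*n≢0 (2 ℕ.^ (2 ℕ.^ j)) (4 ℕ.* suc d) {{ℕ.m^n≢0 2 (2 ℕ.^ j)}})

    edgeProbability : ℚ → (n : ℕ) → .{{NonZero n}} → ℝ
    edgeProbability x n = (fromℚ x D.* log n) D./ n

    approx-edgeProbability : ∀ x n .{{_ : NonZero n}} m → approx (edgeProbability x n) m ≡ x * D.logRiemannSum n m * recip n
    approx-edgeProbability x n m = refl

    -- A strict inequality of reals needs a rational gap: one half of `e` bounds the distance to 1,
    -- the other half is the gap.
    approx-close⇒close : ∀ (x ε : ℝ) {e} → 0ℚ < e → ∃[ N ] (∀ {m} → N ℕ.≤ m → 0ℚ + e ≤ approx ε m) →
                         (∀ m → ℚ.∣ approx x m - 1ℚ ∣ ≤ ½ * e) → D.∣ x D.- 1ℝ ∣ D.< ε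
    approx-close⇒close x ε {e} e>0 (N , e≤ε) close = ½ * e , subst (_< ½ * e) (ℚ.*-zeroʳ ½) (ℚ.*-monoʳ-<-pos ½ e>0) , N , λ {m} N≤m →
      ℚ.≤-trans (ℚ.+-monoˡ-≤ (½ * e) (close m))
        (subst (_≤ approx ε m) (solve 1 (λ e → con 0ℚ :+ e := con ½ :* e :+ con ½ :* e) refl e) (e≤ε N≤m))
      where open +-*-Solver

    comb-limit : (k : ℕ → ℕ) (k∣n : ∀ n → k n ∣ n) →
      (λ n → ℙ[𝒢 n , (fromℚ (c + c) D.* log n) D./ n ⊨ (λ G → containsCopy? G (Comb n (k n) (k∣n n))) ]) ⟶ 1ℝ
    comb-limit k k∣n ε (e , e>0 , e≤ε) = estimate (constants e>0)
      where
      estimate : Constants e → ∃[ n₀ ] (∀ n → .{{_ : NonZero n}} → n₀ ℕ.≤ n →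
        D.∣ ℙ[𝒢 n , (fromℚ (c + c) D.* log n) D./ n ⊨ (λ G → containsCopy? G (Comb n (k n) (k∣n n))) ] D.- 1ℝ ∣ D.< ε)
      estimate (j , l , K , l≢0 , 18≤K , j+l≤K , small) = 2 ℕ.^ K , λ n {{n≢0}} large →
        approx-close⇒close ℙ[𝒢 n , edgeProbability (c + c) n {{n≢0}} ⊨ (λ G → containsCopy? G (Comb n (k n) (k∣n n))) ] ε {e} e>0 e≤ε
          (λ m → comb-estimate {e} j l {{l≢0}} small K 18≤K j+l≤K (edgeProbability (c + c) n {{n≢0}}) m n {{n≢0}} (approx-edgeProbability (c + c) n {{n≢0}} m) (k n) (k∣n n) large)

    0<c+c : 0ℚ < c + c
    0<c+c = ℚ.<-≤-trans (ℚ.positive⁻¹ 1ℚ) (subst (1ℚ ≤_) (ι-+ 4096 4096) (ι-mono {1} {4096 ℕ.+ 4096} (s≤s z≤n)))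

open import Defs

theorem1p2 : ∃[ C ] 0ℝ < C ×
    ((k : ℕ → ℕ) (k∣n : ∀ n → k n ∣ n) →
    (λ n → ℙ[𝒢 n , C * log n / n ⊨ (λ G → containsCopy? G (Comb n (k n) (k∣n n))) ]) ⟶ 1ℝ)
theorem1p2 = fromℚ (c ℚ.+ c) , (c ℚ.+ c , 0<c+c , 0 , λ _ → ℚ.≤-reflexive (ℚ.+-identityˡ (c ℚ.+ c))) , comb-limit
  where
  open Estimates.Thresholds
  open Estimates.Limit
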